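{- The closure operation is a bijection between the set $\mathcal{T}_0$ of well-charged trees of total charge $0$ and the set $\bar{\mathcal{M}}$ of rooted bipartite plane maps. Moreover, this bijection preserves the vertex-degree distribution and the color of the root vertex.
   Context: A planar map is a proper embedding of a connected planar (multi)graph in the sphere, up to orientation-preserving homeomorphism; a corner is a pair of consecutive half-edges around a vertex; the degree of a vertex is its number of incident corners (half-edges). A map is rooted by distinguishing a corner (root corner); its vertex is the root vertex. A plane map is a map with an additional marked face (the outer face), which need not be the face containing the root corner. A bipartite map always comes with a fixed proper black/white coloring of its vertices; $\bar{\mathcal{M}}$ is the set of rooted bipartite plane maps. A blossoming tree is a plane tree (rooted at a corner) whose vertices may additionally carry dangling half-edges called opening stems (outgoing) and closing stems (ingoing); these count in vertex degrees. The charge of a blossoming tree is (number of closing stems) minus (number of opening stems); the charge of a vertex $v$ is the charge of the subtree rooted at $v$. A well-charged tree is a rooted blossoming tree with a proper black/white coloring of its vertices such that: black vertices carry no closing stems and every non-root black vertex has charge at most $1$; white vertices carry no opening stems and every non-root white vertex has nonnegative charge. $\mathcal{T}_0$ denotes the set of well-charged trees of total charge $0$. Closure: traverse the contour of the unique face of the blossoming tree clockwise, reading the cyclic sequence of opening and closing stems; this induces a parenthesis-type matching (opening stem = opening parenthesis). Each matched opening/closing pair is merged into a new edge, drawn so that the outer (infinite) face lies on its left when oriented from the opening stem to the closing stem. For charge $0$ all stems are matched and the result is a rooted plane map (rooted at the tree's root corner, outer face = the infinite face). -}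

module Defs where

open import Data.Bool using (Bool; true; false; not; _∧_; if_then_else_)
open import Data.Nat using (ℕ; zero; suc; _+_; _*_; _≤ᵇ_; _<ᵇ_; _≡ᵇ_)
open import Data.Nat.Properties using (_<?_)
import Data.Integer.Properties as ℤP
open import Relation.Nullary.Decidable using (⌊_⌋)
open import Data.Integer as ℤ using (ℤ; +_; -[1+_])
open import Data.Fin using (Fin; toℕ; fromℕ<)
open import Data.List using (List; []; _∷_; _++_; length; map; upTo; reverse; zip; foldr; filterᵇ)
open import Data.Maybe using (Maybe; just; nothing)
open import Data.Product using (Σ; _×_; _,_; proj₁; proj₂; ∃)
open import Data.Unit using (⊤)
open import Data.Empty using (⊥)
open import Data.Fin.Base using () renaming (zero to fzero)
open import Relation.Nullary using (¬_; yes; no)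
open import Relation.Binary.PropositionalEquality using (_≡_; _≢_)

data Color : Set where
  black white : Color

flipC : Color → Color
flipC black = white
flipC white = black

-- Blossoming trees (plane trees rooted at a corner, with stems).
-- A vertex is given by the list of its incident items in clockwise
-- order: for the root vertex starting right after the root corner, for
-- a non-root vertex starting right after the edge to its parent.

data Tree : Set
data Item : Set

data Tree where
  node : List Item → Tree

data Item where
  child   : Tree → Item
  opening : Item
  closing : Item

chargeItems : List Item → ℤ
chargeItems [] = + 0
chargeItems (child (node js) ∷ is) = chargeItems js ℤ.+ chargeItems is
chargeItems (opening ∷ is) = -[1+ 0 ] ℤ.+ chargeItems is
chargeItems (closing ∷ is) = + 1 ℤ.+ chargeItems is

charge : Tree → ℤ
charge (node is) = chargeItems is

-- A rooted blossoming tree with a proper black/white colouring: the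
-- colouring is determined by the colour of the root vertex.
record CTree : Set where
  constructor ctree
  field
    rootColor : Color
    tree      : Tree
open CTree public

WCItems : Color → List Item → Set
WCNonRoot : Color → Tree → Set

WCItems c [] = ⊤
WCItems c (child t ∷ is) = WCNonRoot (flipC c) t × WCItems c is
WCItems black (opening ∷ is) = WCItems black is
WCItems black (closing ∷ is) = ⊥
WCItems white (opening ∷ is) = ⊥
WCItems white (closing ∷ is) = WCItems white is

WCNonRoot black (node is) = (chargeItems is ℤ.≤ + 1) × WCItems black is
WCNonRoot white (node is) = (+ 0 ℤ.≤ chargeItems is) × WCItems white is

WellCharged : CTree → Set
WellCharged (ctree c (node is)) = WCItems c is

InT0 : CTree → Set
InT0 T = WellCharged T × (charge (tree T) ≡ + 0)

-- Combinatorial rooted bipartite plane maps.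
-- Half-edges are Fin size; σ = clockwise rotation around vertices,
-- α = edge involution.  A corner is represented by the half-edge
-- FOLLOWING it clockwise (corner (σ⁻¹ h , h) is represented by h);
-- faces are then the orbits of φ = σ ∘ α acting on corners.
-- 'col h' is the colour of the vertex incident to h.

record CMap : Set where
  field
    size  : ℕ
    σ     : Fin size → Fin size
    α     : Fin size → Fin size
    root  : Fin size
    outer : Fin size          -- a corner of the outer face
    col   : Fin size → Color

-- The vertex map (one vertex, no edge, one corner) has no half-edges,
-- so it is treated separately (it carries the colour of its vertex).
data RMap : Set where
  vertexMap : Color → RMap
  edgeMap   : CMap → RMap

iter : {n : ℕ} → (Fin n → Fin n) → ℕ → Fin n → Fin n
iter f zero x = x
iter f (suc k) x = f (iter f k x)

isOrbitRep : (n : ℕ) → (Fin n → Fin n) → Fin n → Bool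
isOrbitRep n f x = foldr (λ k b → (toℕ x ≤ᵇ toℕ (iter f k x)) ∧ b) true (upTo n)

allFinL : (n : ℕ) → List (Fin n)
allFinL n = Data.List.tabulate {n = n} (λ i → i)

countB : {A : Set} → (A → Bool) → List A → ℕ
countB p xs = length (filterᵇ p xs)

numOrbits : (n : ℕ) → (Fin n → Fin n) → ℕ
numOrbits n f = countB (isOrbitRep n f) (allFinL n)

-- size of the f-orbit of x: least k ∈ {1..n} with f^k x = x (0 if none)
orbitSize : (n : ℕ) → (Fin n → Fin n) → Fin n → ℕ
orbitSize n f x = go (map suc (upTo n))
  where
  go : List ℕ → ℕ
  go [] = 0
  go (k ∷ ks) = if toℕ (iter f k x) ≡ᵇ toℕ x then k else go ks

data Reach {n : ℕ} (σ α : Fin n → Fin n) (x : Fin n) : Fin n → Set where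
  here : Reach σ α x x
  viaσ : ∀ {y} → Reach σ α x y → Reach σ α x (σ y)
  viaα : ∀ {y} → Reach σ α x y → Reach σ α x (α y)

IsPerm : {n : ℕ} → (Fin n → Fin n) → Set
IsPerm {n} f = Σ (Fin n → Fin n) λ g → (∀ x → g (f x) ≡ x) × (∀ x → f (g x) ≡ x)

-- (size, σ, α) is a connected planar map (Euler: V - E + F = 2, with
-- E = size/2), bicoloured properly by col (col constant on vertices,
-- opposite at the two ends of every edge).
IsRBPMap : RMap → Set
IsRBPMap (vertexMap c) = ⊤
IsRBPMap (edgeMap M) =
  IsPerm σ ×
  (∀ x → α (α x) ≡ x) × (∀ x → α x ≢ x) ×
  (∀ x y → Reach σ α x y) ×
  (2 * numOrbits size σ + 2 * numOrbits size (λ h → σ (α h)) ≡ size + 4) ×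
  (∀ x → col (σ x) ≡ col x) × (∀ x → col (α x) ≢ col x)
  where open CMap M

CIso : CMap → CMap → Set
CIso M N =
  Σ (Fin (CMap.size M) → Fin (CMap.size N)) λ π →
    (Σ (Fin (CMap.size N) → Fin (CMap.size M)) λ ρ →
        (∀ x → ρ (π x) ≡ x) × (∀ y → π (ρ y) ≡ y)) ×
    (∀ x → π (CMap.σ M x) ≡ CMap.σ N (π x)) ×
    (∀ x → π (CMap.α M x) ≡ CMap.α N (π x)) ×
    (π (CMap.root M) ≡ CMap.root N) ×
    (∃ λ k → iter (λ h → CMap.σ N (CMap.α N h)) k (π (CMap.outer M)) ≡ CMap.outer N) ×
    (∀ x → CMap.col N (π x) ≡ CMap.col M x)

_≅_ : RMap → RMap → Set
vertexMap c ≅ vertexMap d = c ≡ d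
vertexMap c ≅ edgeMap N = ⊥
edgeMap M ≅ vertexMap d = ⊥
edgeMap M ≅ edgeMap N = CIso M N

-- Closure.
-- Half-edges of the tree (tree half-edges and stems) are labelled
-- 0,1,2,… in the order in which the clockwise contour walk starting at
-- the root corner passes them; label j also names the contour corner
-- just before that half-edge.

record Out : Set where
  field
    labs   : List ℕ                 -- labels of the items of the vertex, in order
    next   : ℕ
    rots   : List (List ℕ × Color)  -- rotations (clockwise) of descendant vertices
    alphas : List (ℕ × ℕ)           -- tree-edge half-edge pairs
    stems  : List (ℕ × Bool)        -- stems in contour order (true = opening)

walkItems : Color → List Item → ℕ → Out
walkItems c [] p = record { labs = [] ; next = p ; rots = [] ; alphas = [] ; stems = [] }
walkItems c (opening ∷ is) p =
  let o = walkItems c is (suc p) in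
  record o { labs = p ∷ Out.labs o ; stems = (p , true) ∷ Out.stems o }
walkItems c (closing ∷ is) p =
  let o = walkItems c is (suc p) in
  record o { labs = p ∷ Out.labs o ; stems = (p , false) ∷ Out.stems o }
walkItems c (child (node js) ∷ is) p =
  let ch = walkItems (flipC c) js (suc p)
      u  = Out.next ch
      o  = walkItems c is (suc u)
  in record
    { labs   = p ∷ Out.labs o
    ; next   = Out.next o
    ; rots   = (Out.labs ch ++ (u ∷ []) , flipC c) ∷ (Out.rots ch ++ Out.rots o)
    ; alphas = (p , u) ∷ (u , p) ∷ (Out.alphas ch ++ Out.alphas o)
    ; stems  = Out.stems ch ++ Out.stems o }

nextCyc : List ℕ → ℕ → Maybe ℕ
nextCyc [] x = nothing
nextCyc (y ∷ ys) x = go (y ∷ ys)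
  where
  go : List ℕ → Maybe ℕ
  go [] = nothing
  go (a ∷ []) = if a ≡ᵇ x then just y else nothing
  go (a ∷ b ∷ r) = if a ≡ᵇ x then just b else go (b ∷ r)

memB : ℕ → List ℕ → Bool
memB x [] = false
memB x (y ∷ ys) = if x ≡ᵇ y then true else memB x ys

σℕ : List (List ℕ × Color) → ℕ → ℕ
σℕ [] x = x
σℕ ((r , _) ∷ rs) x with nextCyc r x
... | just y = y
... | nothing = σℕ rs x

colℕ : Color → List (List ℕ × Color) → ℕ → Color
colℕ d [] x = d
colℕ d ((r , c) ∷ rs) x = if memB x r then c else colℕ d rs x

αℕ : List (ℕ × ℕ) → ℕ → ℕ
αℕ [] x = x
αℕ ((a , b) ∷ ps) x = if a ≡ᵇ x then b else αℕ ps x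

-- linear parenthesis matching with a stack; returns matched pairs,
-- remaining stack (top first) and unmatched closings (in order)
matchGo : List (ℕ × Bool) → List ℕ → List ℕ → List (ℕ × ℕ) → List (ℕ × ℕ) × List ℕ × List ℕ
matchGo [] st uc acc = acc , st , reverse uc
matchGo ((x , true) ∷ r) st uc acc = matchGo r (x ∷ st) uc acc
matchGo ((x , false) ∷ r) [] uc acc = matchGo r [] (x ∷ uc) acc
matchGo ((x , false) ∷ r) (o ∷ st) uc acc = matchGo r st uc ((o , x) ∷ acc)

cyclicMatching : List (ℕ × Bool) → List (ℕ × ℕ)
cyclicMatching s with matchGo s [] [] []
... | acc , st , uc = acc ++ zip st uc

symPairs : List (ℕ × ℕ) → List (ℕ × ℕ)
symPairs [] = []
symPairs ((a , b) ∷ ps) = (a , b) ∷ (b , a) ∷ symPairs ps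

depth : List (ℕ × Bool) → ℕ → ℤ
depth [] j = + 0
depth ((x , b) ∷ s) j =
  if x <ᵇ j then ((if b then + 1 else -[1+ 0 ]) ℤ.+ depth s j) else depth s j

-- first corner (label < N) of minimal depth: a corner of the outer face
outerℕ : List (ℕ × Bool) → ℕ → ℕ
outerℕ s N = proj₁ (foldr step (0 , depth s 0) (reverse (upTo N)))
  where
  step : ℕ → ℕ × ℤ → ℕ × ℤ
  step j (b , d) = if ⌊ depth s j ℤP.<? d ⌋ then (j , depth s j) else (b , d)
  -- processed in increasing j; strict < keeps the first minimiser

toFinOr : {N : ℕ} → Fin N → ℕ → Fin N
toFinOr {N} d m with m <? N
... | yes p = fromℕ< p
... | no _ = d

buildC : Color → Out → (n : ℕ) → CMap
buildC c o n = record
  { size  = suc n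
  ; σ     = λ x → toFinOr x (σℕ rs (toℕ x))
  ; α     = λ x → toFinOr x (αℕ (Out.alphas o ++ symPairs (cyclicMatching (Out.stems o))) (toℕ x))
  ; root  = fzero
  ; outer = toFinOr fzero (outerℕ (Out.stems o) (suc n))
  ; col   = λ x → colℕ c rs (toℕ x) }
  where
  rs = (Out.labs o , c) ∷ Out.rots o

mkMap : Color → Out → ℕ → RMap
mkMap c o zero = vertexMap c
mkMap c o (suc n) = edgeMap (buildC c o n)

closure : CTree → RMap
closure (ctree c (node is)) = let o = walkItems c is 0 in mkMap c o (Out.next o)

-- number of vertices of degree k in the tree (stems count in degrees)
degCountItems : ℕ → List Item → ℕ
degCountItems k [] = 0
degCountItems k (child (node js) ∷ is) =
  (if suc (length js) ≡ᵇ k then 1 else 0) + degCountItems k js + degCountItems k is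
degCountItems k (opening ∷ is) = degCountItems k is
degCountItems k (closing ∷ is) = degCountItems k is

treeDegCount : CTree → ℕ → ℕ
treeDegCount (ctree c (node is)) k =
  (if length is ≡ᵇ k then 1 else 0) + degCountItems k is

mapDegCount : RMap → ℕ → ℕ
mapDegCount (vertexMap c) k = if 0 ≡ᵇ k then 1 else 0
mapDegCount (edgeMap M) k =
  countB (λ x → isOrbitRep size σ x ∧ (orbitSize size σ x ≡ᵇ k)) (allFinL size)
  where open CMap M

mapRootColor : RMap → Color
mapRootColor (vertexMap c) = c
mapRootColor (edgeMap M) = CMap.col M (CMap.root M)

{-# OPTIONS --safe #-}
-- In the closure of a tree, the number of open stems at a corner is constant on faces. Writing ℓ for it, every edge
-- with black end b and white end w has ℓ w ≤ ℓ b + 1 (this is well-chargedness for tree edges, and equality holds for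
-- stems), and every non-outer face carries exactly one closing stem w, with ℓ w = ℓ b + 1. Hence ℓ is the directed dual
-- distance from the outer face, and the stems are the edges of a geodesic spanning tree of the dual. Among these trees
-- it is singled out by the root: read along the contour, a tight edge kept in the tree is met first at its white end.
--
-- Uniqueness: at the first contour position where two such openings disagree, the face of the half-edge there has its
-- other stem enclosed by the first one, which contradicts the preference of either opening.
-- Existence: start from any geodesic dual tree and exchange a tight edge that violates the preference with the stem of
-- its face; the sequence of choices along the contour decreases lexicographically.
-- Planarity enters through the count of orbits: gluing the two half-edges of a pair in the same cycle splits the cycle
-- and otherwise merges two cycles. Cutting along a dual spanning tree therefore leaves one face, and Euler's formula then
-- forces the pairing of the remaining half-edges to be noncrossing, that is, to come from a plane tree.
module Submission where

open import Defs
open import Data.Bool using (Bool; true; false; _∧_; if_then_else_)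
import Data.Bool
open import Data.Bool.Properties using (T-≡)
open import Data.Nat using (ℕ; zero; suc; _+_; _*_; _∸_; _^_; _≤_; _<_; z≤n; s≤s; _≤ᵇ_; _<ᵇ_; _≡ᵇ_; _%_; _/_)
open import Data.Nat.Properties hiding (_≟_)
import Data.Nat.Properties as ℕP
import Data.Sum
open import Data.Nat.DivMod using (m≡m%n+[m/n]*n; m%n<n)
open import Data.Nat.Induction using (<-rec)
open import Data.Nat.Tactic.RingSolver using (solve-∀)
open import Data.Integer as ℤ using (ℤ; -[1+_])
import Data.Integer.Properties as ℤP
open import Data.Fin using (Fin; toℕ; fromℕ<; punchIn; punchOut) renaming (zero to fzero; suc to fsuc)
open import Data.Fin.Properties using (_≟_; any?; pigeonhole; injective⇒≤; toℕ<n; toℕ-injective; toℕ-fromℕ<; punchOut-injective; punchOut-cong; punchOut-punchIn; punchInᵢ≢i)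
open import Data.List using (List; []; _∷_; _++_; length; map; upTo; applyUpTo; reverse; zip; foldr; filterᵇ; filter; drop; lookup; allFin; concat)
open import Data.List.Properties using (concat-++; length-++; length-map; length-reverse; ++-assoc; ++-identityʳ; map-++; length-tabulate; ∷-injective; ∷-injectiveˡ; ∷-injectiveʳ; drop-map; drop-[]; unfold-reverse)
open import Data.List.Membership.Propositional using (_∈_; _∉_)
open import Data.List.Membership.Propositional.Properties using (∈-filter⁺; ∈-filter⁻; ∈-allFin; ∈-lookup; ∈-map⁺; ∈-map⁻; ∈-++⁺ˡ; ∈-++⁺ʳ; ∈-++⁻; ∈-upTo⁺; ∈-upTo⁻)
open import Data.List.Membership.Propositional.Properties.WithK using (unique∧set⇒bag)
import Data.List.Membership.DecPropositional as DecMem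
open import Data.List.Relation.Binary.BagAndSetEquality using (∼bag⇒↭)
import Data.List.Relation.Binary.Permutation.Setoid.Properties as PermS
open import Data.List.Relation.Binary.Permutation.Propositional using (↭⇒↭ₛ; _↭_; ↭-refl; ↭-sym; ↭-trans; prep)
open import Data.List.Relation.Binary.Permutation.Propositional.Properties using (↭-length; ∈-resp-↭; shift; ++⁺; ++⁺ˡ; ++⁺ʳ; filter-↭; ++-comm)
open import Data.List.Relation.Unary.Any using (here; there; index)
open import Data.List.Relation.Unary.Any.Properties using (lookup-index; reverse⁺; reverse⁻)
open import Data.List.Relation.Unary.All using (All; []; _∷_) renaming (lookup to All-lookup; tabulate to All-tabulate; map to All-map)
import Data.List.Relation.Unary.All.Properties as AllP
open import Data.List.Relation.Unary.AllPairs using (AllPairs; []; _∷_)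
import Data.List.Relation.Unary.AllPairs.Properties as AllPairsP
open import Data.List.Relation.Unary.Unique.Propositional using (Unique)
import Data.List.Relation.Unary.Unique.Propositional.Properties as UniqueP
open import Data.Maybe using (Maybe; just; nothing)
open import Data.Product using (Σ; _×_; _,_; proj₁; proj₂; ∃)
open import Data.Sum using (_⊎_; inj₁; inj₂; [_,_]′)
open import Data.Unit using (⊤; tt)
open import Data.Empty using (⊥; ⊥-elim)
open import Function using (_∘_; id; case_of_; mk⇔; Equivalence)
open import Relation.Nullary using (¬_; Dec; yes; no; does; contradiction; _×-dec_; _⊎-dec_; ¬?)
open import Relation.Nullary.Decidable using (⌊_⌋; map′; dec-true; dec-false; T?)
open import Relation.Binary.PropositionalEquality
open import Relation.Binary using (Tri; tri<; tri≈; tri>)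

-- Orbits of permutations

-- The preference comes from an asymmetry of well-chargedness. The charge of a child subtree is the
-- difference of the heights on the two sides of its edge. Charge at most 1 for a black child says ℓ
-- w ≤ ℓ b + 1, whereas charge at least 0 for a white child says ℓ w ≤ ℓ b: a tight tree edge can
-- only have its white end at the parent, and the contour meets that end first. Faces and vertices
-- are counted by the same argument. If τ is the contour, regluing the stems turns τ into the face
-- permutation σ ∘ α, and regluing the tree edges turns it into σ, so the calculus of cutting nested
-- pairs on one cycle is used twice. The matching is cyclic, so the stems that are open at the root
-- corner are invisible in a linear reading from there. They are recovered from the outer corner,
-- where nothing is open.

private variable
  n : ℕ

Inj : (Fin n → Fin n) → Set
Inj f = ∀ {x y} → f x ≡ f y → x ≡ y

iter-+ : (f : Fin n → Fin n) → ∀ j k x → iter f (j + k) x ≡ iter f j (iter f k x)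
iter-+ f zero k x = refl
iter-+ f (suc j) k x = cong f (iter-+ f j k x)

iter-suc : (f : Fin n → Fin n) → ∀ k x → iter f k (f x) ≡ f (iter f k x)
iter-suc f zero x = refl
iter-suc f (suc k) x = cong f (iter-suc f k x)

iter-cong : {f g : Fin n → Fin n} → (∀ x → f x ≡ g x) → ∀ k x → iter f k x ≡ iter g k x
iter-cong eq zero x = refl
iter-cong {f = f} eq (suc k) x = trans (cong f (iter-cong eq k x)) (eq _)

iter-inj : {f : Fin n → Fin n} → Inj f → ∀ k {x y} → iter f k x ≡ iter f k y → x ≡ y
iter-inj inj zero eq = eq
iter-inj inj (suc k) eq = iter-inj inj k (inj eq)

iter-* : (f : Fin n → Fin n) → ∀ m P {x} → iter f P x ≡ x → iter f (m * P) x ≡ x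
iter-* f zero P eq = refl
iter-* f (suc m) P {x} eq =
  trans (iter-+ f P (m * P) x) (trans (cong (iter f P) (iter-* f m P eq)) eq)

Orb : (Fin n → Fin n) → Fin n → Fin n → Set
Orb f x y = ∃ λ k → iter f k x ≡ y

orb-refl : {f : Fin n → Fin n} {x : Fin n} → Orb f x x
orb-refl = 0 , refl

orb-step : {f : Fin n → Fin n} {x : Fin n} → Orb f x (f x)
orb-step = 1 , refl

orb-trans : {f : Fin n → Fin n} {x y z : Fin n} → Orb f x y → Orb f y z → Orb f x z
orb-trans {f = f} {x} (j , p) (k , q) =
  k + j , trans (iter-+ f k j x) (trans (cong (iter f k) p) q)

orb-lift : {f g : Fin n → Fin n} → (∀ x → Orb g x (f x)) → ∀ {x y} → Orb f x y → Orb g x y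
orb-lift h (zero , refl) = orb-refl
orb-lift h (suc k , refl) = orb-trans (orb-lift h (k , refl)) (h _)

orb-invariant : {A : Set} {f : Fin n → Fin n} (c : Fin n → A) → (∀ x → c (f x) ≡ c x) →
  ∀ {x y} → Orb f x y → c x ≡ c y
orb-invariant c h (zero , refl) = refl
orb-invariant c h (suc k , refl) = trans (orb-invariant c h (k , refl)) (sym (h _))

module _ {f : Fin n → Fin n} (inj : Inj f) where

  period : ∀ x → ∃ λ k → k < n × iter f (suc k) x ≡ x
  period x with pigeonhole (n<1+n n) (λ i → iter f (toℕ i) x)
  ... | i , j , i<j , eq with toℕ j ∸ toℕ i in d | m+[n∸m]≡n (<⇒≤ i<j)
  ... | zero | q = contradiction i<j (≤⇒≯ (≤-reflexive (trans (sym q) (+-identityʳ _))))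
  ... | suc k | q = k , ≤-trans (≤-trans (m≤n+m (suc k) (toℕ i)) (≤-reflexive q)) (≤-pred (toℕ<n j)) ,
      iter-inj inj (toℕ i) (trans (sym (iter-+ f (toℕ i) (suc k) x)) (trans (cong (λ m → iter f m x) q) (sym eq)))

  -- From `x`, `k + k * p = k * suc p` steps are `k` full periods; after the `k` steps that lead to
  -- `y`, another `k * p` lead back.
  orb-sym : ∀ {x y} → Orb f x y → Orb f y x
  orb-sym {x} {y} (k , eq) with period x
  ... | p , _ , e = k * p , (begin
    iter f (k * p) y ≡⟨ cong (iter f (k * p)) (sym eq) ⟩
    iter f (k * p) (iter f k x) ≡⟨ sym (iter-+ f (k * p) k x) ⟩
    iter f (k * p + k) x ≡⟨ cong (λ m → iter f m x) (trans (+-comm (k * p) k) (sym (*-suc k p))) ⟩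
    iter f (k * suc p) x ≡⟨ iter-* f k (suc p) e ⟩
    x ∎)
    where open ≡-Reasoning

  orb-bounded : ∀ {x y} → Orb f x y → ∃ λ k → k < n × iter f k x ≡ y
  orb-bounded {x} {y} (k , eq) with period x
  ... | p , p<n , e = k % suc p , <-≤-trans (m%n<n k (suc p)) p<n , (begin
    iter f (k % suc p) x ≡⟨ cong (iter f (k % suc p)) (sym (iter-* f (k / suc p) (suc p) e)) ⟩
    iter f (k % suc p) (iter f (k / suc p * suc p) x) ≡⟨ sym (iter-+ f (k % suc p) _ x) ⟩
    iter f (k % suc p + k / suc p * suc p) x ≡⟨ cong (λ m → iter f m x) (sym (m≡m%n+[m/n]*n k (suc p))) ⟩
    iter f k x ≡⟨ eq ⟩
    y ∎)
    where open ≡-Reasoning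

  orb? : ∀ x y → Dec (Orb f x y)
  orb? x y = map′ (λ { (k , e) → toℕ k , e })
    (λ o → let (k , k<n , e) = orb-bounded o in fromℕ< k<n , trans (cong (λ m → iter f m x) (toℕ-fromℕ< k<n)) e)
    (any? (λ (k : Fin n) → iter f (toℕ k) x ≟ y))

-- Least representatives and the number of orbits

foldr-∧⇒ : {A : Set} (p : A → Bool) (xs : List A) → foldr (λ k b → p k ∧ b) true xs ≡ true →
  ∀ {k} → k ∈ xs → p k ≡ true
foldr-∧⇒ p (x ∷ xs) h m with p x in e
foldr-∧⇒ p (x ∷ xs) h (here refl) | true = e
foldr-∧⇒ p (x ∷ xs) h (there m) | true = foldr-∧⇒ p xs h m

foldr-∧⇐ : {A : Set} (p : A → Bool) (xs : List A) → (∀ {k} → k ∈ xs → p k ≡ true) →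
  foldr (λ k b → p k ∧ b) true xs ≡ true
foldr-∧⇐ p [] h = refl
foldr-∧⇐ p (x ∷ xs) h rewrite h (here refl) = foldr-∧⇐ p xs (h ∘ there)

≤ᵇ-true : ∀ {a b} → a ≤ b → (a ≤ᵇ b) ≡ true
≤ᵇ-true p = Equivalence.to T-≡ (≤⇒≤ᵇ p)

≤ᵇ-true⁻ : ∀ {a b} → (a ≤ᵇ b) ≡ true → a ≤ b
≤ᵇ-true⁻ {a} {b} p = ≤ᵇ⇒≤ a b (Equivalence.from T-≡ p)

isRep⇒ : (f : Fin n → Fin n) → ∀ {x} → isOrbitRep n f x ≡ true → ∀ {k} → k < n → toℕ x ≤ toℕ (iter f k x)
isRep⇒ {n} f {x} h k<n = ≤ᵇ-true⁻ (foldr-∧⇒ (λ k → toℕ x ≤ᵇ toℕ (iter f k x)) (upTo n) h (∈-upTo⁺ k<n))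

isRep⇐ : (f : Fin n → Fin n) → ∀ {x} → (∀ k → k < n → toℕ x ≤ toℕ (iter f k x)) → isOrbitRep n f x ≡ true
isRep⇐ {n} f {x} h = foldr-∧⇐ (λ k → toℕ x ≤ᵇ toℕ (iter f k x)) (upTo n) (λ m → ≤ᵇ-true (h _ (∈-upTo⁻ m)))

module _ {f : Fin n → Fin n} (inj : Inj f) where

  -- The test looks at the first `n` iterates only, which by `orb-bounded` run through the whole
  -- orbit.
  isRep-≤ : ∀ {x y} → isOrbitRep n f x ≡ true → Orb f x y → toℕ x ≤ toℕ y
  isRep-≤ h o with orb-bounded inj o
  ... | k , k<n , refl = isRep⇒ f h k<n

  private
    HasRep : Fin n → Set
    HasRep x = ∃ λ y → Orb f x y × isOrbitRep n f y ≡ true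

    find-rep : ∀ m (x : Fin n) → toℕ x ≡ m → HasRep x
    find-rep = <-rec (λ m → (x : Fin n) → toℕ x ≡ m → HasRep x) step
      where
      step : ∀ m → (∀ {k} → k < m → (x : Fin n) → toℕ x ≡ k → HasRep x) → (x : Fin n) → toℕ x ≡ m → HasRep x
      step m rec x refl with any? (λ (k : Fin n) → toℕ (iter f (toℕ k) x) <? toℕ x)
      ... | yes (k , lt) with rec lt (iter f (toℕ k) x) refl
      ...   | y , o , r = y , orb-trans (toℕ k , refl) o , r
      step m rec x refl | no ¬lt = x , orb-refl , isRep⇐ f λ k k<n → ≮⇒≥ λ lt → ¬lt (fromℕ< k<n ,
                   subst (λ m → toℕ (iter f m x) < toℕ x) (sym (toℕ-fromℕ< k<n)) lt)

  orbRep : ∀ x → ∃ λ y → Orb f x y × isOrbitRep n f y ≡ true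
  orbRep x = find-rep _ x refl

  reps-equal : ∀ {x y} → isOrbitRep n f x ≡ true → isOrbitRep n f y ≡ true → Orb f x y → x ≡ y
  reps-equal p q o = toℕ-injective (≤-antisym (isRep-≤ p o) (isRep-≤ q (orb-sym inj o)))

  orbRep-cong : ∀ {x y} → Orb f x y → proj₁ (orbRep x) ≡ proj₁ (orbRep y)
  orbRep-cong {x} {y} o with orbRep x | orbRep y
  ... | x′ , ox , rx | y′ , oy , ry = reps-equal rx ry (orb-trans (orb-sym inj ox) (orb-trans o oy))

-- The orbit set presented as `Fin c`: `cls` is a complete invariant and `rep` a section. By
-- `orbits-≤` the number `c` is unique, so orbits can be counted by exhibiting any such presentation
-- instead of manipulating the filtered list behind `numOrbits`.
record Orbits (f : Fin n → Fin n) (c : ℕ) : Set where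
  field
    cls  : Fin n → Fin c
    cls⇒ : ∀ {x y} → Orb f x y → cls x ≡ cls y
    cls⇐ : ∀ {x y} → cls x ≡ cls y → Orb f x y
    rep  : Fin c → Fin n
    cls-rep : ∀ i → cls (rep i) ≡ i

orbits-≤ : {f : Fin n → Fin n} {c d : ℕ} → Orbits f c → Orbits f d → c ≤ d
orbits-≤ A B = injective⇒≤ {f = B.cls ∘ A.rep} λ {i} {j} e →
    trans (sym (A.cls-rep i)) (trans (A.cls⇒ (B.cls⇐ e)) (A.cls-rep j))
  where module A = Orbits A ; module B = Orbits B

-- The class of a point is the place of the least element of its orbit in the list of all such
-- elements. The list has no repetitions, so this place does not depend on the membership proof.
orbits-numOrbits : {f : Fin n → Fin n} → Inj f → Orbits f (numOrbits n f)
orbits-numOrbits {n} {f} inj = record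
  { cls = λ x → index (mem x)
  ; cls⇒ = λ {x} {y} o → index-cong (mem x) (mem y) (orbRep-cong inj o)
  ; cls⇐ = λ {x} {y} e → orb-trans (proj₁ (proj₂ (orbRep inj x)))
      (subst (λ z → Orb f z y)
        (sym (trans (lookup-index (mem x)) (trans (cong (lookup R) e) (sym (lookup-index (mem y))))))
        (orb-sym inj (proj₁ (proj₂ (orbRep inj y)))))
  ; rep = lookup R
  ; cls-rep = λ i → trans (index-cong (mem (lookup R i)) (∈-lookup {xs = R} i) (rep-of-rep (∈-lookup {xs = R} i)))
      (index-lookup i) }
  where
  P? = λ x → T? (isOrbitRep n f x)
  R : List (Fin n)
  R = filterᵇ (isOrbitRep n f) (allFinL n)
  R-unique : Unique R
  R-unique = UniqueP.filter⁺ P? (UniqueP.allFin⁺ n)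
  mem : ∀ x → proj₁ (orbRep inj x) ∈ R
  mem x = ∈-filter⁺ P? (∈-allFin _) (Equivalence.from T-≡ (proj₂ (proj₂ (orbRep inj x))))
  index-cong′ : ∀ {xs : List (Fin n)} → Unique xs → ∀ {x} (p q : x ∈ xs) → index p ≡ index q
  index-cong′ u (here refl) (here refl) = refl
  index-cong′ u (here refl) (there q) = contradiction q (UniqueP.Unique[x∷xs]⇒x∉xs u)
  index-cong′ u (there p) (here refl) = contradiction p (UniqueP.Unique[x∷xs]⇒x∉xs u)
  index-cong′ (_ ∷ u) (there p) (there q) = cong fsuc (index-cong′ u p q)
  index-cong : ∀ {x y} (p : x ∈ R) (q : y ∈ R) → x ≡ y → index p ≡ index q
  index-cong p q refl = index-cong′ R-unique p q
  index-lookup′ : ∀ (xs : List (Fin n)) i → index (∈-lookup {xs = xs} i) ≡ i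
  index-lookup′ (x ∷ xs) fzero = refl
  index-lookup′ (x ∷ xs) (fsuc i) = cong fsuc (index-lookup′ xs i)
  index-lookup : ∀ i → index (∈-lookup {xs = R} i) ≡ i
  index-lookup = index-lookup′ R
  rep-of-rep : ∀ {x} → x ∈ R → proj₁ (orbRep inj x) ≡ x
  rep-of-rep {x} m with orbRep inj x
  ... | y , o , r = sym (reps-equal inj (Equivalence.to T-≡ (proj₂ (∈-filter⁻ P? {xs = allFinL n} m))) r o)

numOrbits-unique : {f : Fin n → Fin n} → Inj f → ∀ {c} → Orbits f c → numOrbits n f ≡ c
numOrbits-unique inj O = ≤-antisym (orbits-≤ (orbits-numOrbits inj) O) (orbits-≤ O (orbits-numOrbits inj))

orbits-transport : {f g : Fin n → Fin n} {c : ℕ} → (∀ {x y} → Orb f x y → Orb g x y) →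
  (∀ {x y} → Orb g x y → Orb f x y) → Orbits f c → Orbits g c
orbits-transport fg gf O = record { cls = cls ; cls⇒ = cls⇒ ∘ gf ; cls⇐ = fg ∘ cls⇐ ; rep = rep ; cls-rep = cls-rep }
  where open Orbits O

numOrbits-resp : {f g : Fin n → Fin n} → Inj f → Inj g → (∀ {x y} → Orb f x y → Orb g x y) →
  (∀ {x y} → Orb g x y → Orb f x y) → numOrbits n f ≡ numOrbits n g
numOrbits-resp injf injg fg gf = sym (numOrbits-unique injg (orbits-transport fg gf (orbits-numOrbits injf)))

numOrbits-cong : {f g : Fin n → Fin n} → Inj f → (∀ x → f x ≡ g x) → numOrbits n f ≡ numOrbits n g
numOrbits-cong {f = f} {g} inj eq = numOrbits-resp inj (λ {x} {y} e → inj (trans (eq x) (trans e (sym (eq y)))))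
  (orb-lift λ x → 1 , sym (eq x)) (orb-lift λ x → 1 , eq x)

numOrbits-transitive : {f : Fin n → Fin n} → Inj f → ∀ r → (∀ y → Orb f r y) → numOrbits n f ≡ 1
numOrbits-transitive inj r h = numOrbits-unique inj record
  { cls = λ _ → fzero ; cls⇒ = λ _ → refl ; cls⇐ = λ {x} {y} _ → orb-trans (orb-sym inj (h x)) (h y)
  ; rep = λ _ → r ; cls-rep = λ { fzero → refl } }

-- f′ is f precomposed with the transposition of a and b.
record Swapped (f f′ : Fin n → Fin n) (a b : Fin n) : Set where
  field
    at-a : f′ a ≡ f b
    at-b : f′ b ≡ f a
    off  : ∀ {x} → x ≢ a → x ≢ b → f′ x ≡ f x

swapped-sym : {f f′ : Fin n → Fin n} {a b : Fin n} → Swapped f f′ a b → Swapped f′ f a b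
swapped-sym S = record { at-a = sym at-b ; at-b = sym at-a ; off = λ p q → sym (off p q) }
  where open Swapped S

module Merge {f f′ : Fin n → Fin n} {a b : Fin n} (inj : Inj f) (inj′ : Inj f′) (S : Swapped f f′ a b) where
  open Swapped S

  -- From `b`, the map `f′` goes to `f a` and then follows the `f`-cycle of `a`, on which it differs
  -- from `f` only at `a` itself because `b` lies elsewhere. It therefore arrives at `a`.
  orb-b-a : ¬ Orb f a b → Orb f′ b a
  orb-b-a a≁b with period inj a
  ... | p , _ , e = [ id , subst (Orb f′ b) (trans (iter-suc f p a) e) ]′ (walk p)
    where
    walk : ∀ j → Orb f′ b a ⊎ Orb f′ b (iter f j (f a))
    walk zero = inj₂ (1 , at-b)
    walk (suc j) with walk j
    ... | inj₁ o = inj₁ o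
    ... | inj₂ o with iter f j (f a) ≟ a
    ...   | yes e₁ = inj₁ (subst (Orb f′ b) e₁ o)
    ...   | no ne with iter f j (f a) ≟ b
    ...     | yes e₂ = contradiction (orb-trans orb-step (j , e₂)) a≁b
    ...     | no ne₂ = inj₂ (orb-trans o (1 , off ne ne₂))

  -- The only `f`-steps that `f′` lacks start at `a` or `b`; each is made up for by going to the
  -- other of the two points first.
  orb-f⊆f′ : Orb f′ b a → ∀ {x y} → Orb f x y → Orb f′ x y
  orb-f⊆f′ ba = orb-lift step
    where
    step : ∀ x → Orb f′ x (f x)
    step x with x ≟ a
    ... | yes refl = orb-trans (orb-sym inj′ ba) (1 , at-b)
    ... | no ne with x ≟ b
    ...   | yes refl = orb-trans ba (1 , at-a)
    ...   | no ne₂ = 1 , off ne ne₂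

  -- The cycles of `a` and `b` fuse and all others survive. `m` renames the class of `a` to that of
  -- `b`, and `punchOut` removes the index that has become free.
  merge : ¬ Orb f a b → numOrbits n f ≡ suc (numOrbits n f′)
  merge a≁b = go (orbits-numOrbits inj)
    where
    f⊆f′ = orb-f⊆f′ (orb-b-a a≁b)
    go : ∀ {c} → Orbits f c → c ≡ suc (numOrbits n f′)
    go {zero} O with () ← Orbits.cls O a
    go {suc c} O = cong suc (sym (numOrbits-unique inj′ O′))
      where
      open Orbits O
      m : Fin (suc c) → Fin (suc c)
      m i with i ≟ cls a
      ... | yes _ = cls b
      ... | no _ = i
      m≢ : ∀ i → cls a ≢ m i
      m≢ i e with i ≟ cls a
      ... | yes _ = a≁b (cls⇐ e)
      ... | no ne = ne (sym e)
      m-id : ∀ {i} → i ≢ cls a → m i ≡ i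
      m-id {i} ne with i ≟ cls a
      ... | yes e = contradiction e ne
      ... | no _ = refl
      m-a : m (cls a) ≡ cls b
      m-a with cls a ≟ cls a
      ... | yes _ = refl
      ... | no ne = contradiction refl ne
      m-b : m (cls b) ≡ cls b
      m-b = m-id λ e → a≁b (cls⇐ (sym e))
      step : ∀ x → m (cls (f′ x)) ≡ m (cls x)
      step x with x ≟ a
      ... | yes refl = trans (cong m (trans (cong cls at-a) (sym (cls⇒ (orb-step {f = f} {b}))))) (trans m-b (sym m-a))
      ... | no ne with x ≟ b
      ...   | yes refl = trans (cong m (trans (cong cls at-b) (sym (cls⇒ (orb-step {f = f} {a}))))) (trans m-a (sym m-b))
      ...   | no ne₂ = cong m (trans (cong cls (off ne ne₂)) (sym (cls⇒ (orb-step {f = f} {x}))))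
      move : ∀ x → ∃ λ x′ → Orb f′ x x′ × cls x′ ≡ m (cls x)
      move x with cls x ≟ cls a
      ... | yes e = b , orb-trans (f⊆f′ (cls⇐ e)) (orb-sym inj′ (orb-b-a a≁b)) , refl
      ... | no _ = x , orb-refl , refl
      O′ : Orbits f′ c
      O′ = record
        { cls = λ x → punchOut (m≢ (cls x))
        ; cls⇒ = λ o → punchOut-cong (cls a) (orb-invariant (m ∘ cls) step o)
        ; cls⇐ = λ {x} {y} e → let (x′ , ox , ex) = move x ; (y′ , oy , ey) = move y in
            orb-trans ox (orb-trans
              (f⊆f′ (cls⇐ (trans ex (trans (punchOut-injective (m≢ (cls x)) (m≢ (cls y)) e) (sym ey)))))
              (orb-sym inj′ oy))
        ; rep = λ i → rep (punchIn (cls a) i)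
        ; cls-rep = λ i → trans (punchOut-cong (cls a)
              (trans (cong m (cls-rep _)) (m-id (punchInᵢ≢i (cls a) i))))
            (punchOut-punchIn (cls a)) }

open Merge public using (merge; orb-b-a; orb-f⊆f′)

-- Points on different cycles of one of the maps are covered by `merge`. Parity excludes that `a`
-- and `b` lie together for both maps, but it is shorter to observe that the two partitions would
-- then coincide.
numOrbits-swapped-≤ : {f f′ : Fin n → Fin n} {a b : Fin n} → Inj f → Inj f′ → Swapped f f′ a b →
  numOrbits n f ≤ suc (numOrbits n f′)
numOrbits-swapped-≤ {f = f} {f′} {a} {b} inj inj′ S with orb? inj a b
... | no a≁b = ≤-reflexive (merge inj inj′ S a≁b)
... | yes ab with orb? inj′ a b
...   | no a≁b = ≤-trans (n≤1+n _) (≤-trans (n≤1+n _) (s≤s (≤-reflexive (sym (merge inj′ inj (swapped-sym S) a≁b)))))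
...   | yes ab′ = ≤-trans (≤-reflexive (numOrbits-resp inj inj′
          (orb-f⊆f′ inj inj′ S (orb-sym inj′ ab′)) (orb-f⊆f′ inj′ inj (swapped-sym S) (orb-sym inj ab)))) (n≤1+n _)

-- Pairings glued along a cycle

orb-closed : {f : Fin n → Fin n} (P : Fin n → Set) → (∀ x → P x → P (f x)) → ∀ {x y} → P x → Orb f x y → P y
orb-closed P h p (zero , refl) = p
orb-closed P h p (suc k , refl) = h _ (orb-closed P h p (k , refl))

unique-↭ : {A : Set} {xs ys : List A} → Unique xs → Unique ys →
  (∀ {x} → x ∈ xs → x ∈ ys) → (∀ {x} → x ∈ ys → x ∈ xs) → xs ↭ ys
unique-↭ u v f g = ∼bag⇒↭ (unique∧set⇒bag u v (mk⇔ f g))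

half-count : (α : Fin n → Fin n) → (∀ x → α (α x) ≡ x) → (L : List (Fin n)) → Unique L →
  (∀ x → x ∈ L ⊎ α x ∈ L) → (∀ {x} → x ∈ L → α x ∉ L) → n ≡ length L + length L
half-count {n} α αα L u cover excl = begin
  n ≡⟨ sym (length-tabulate {n = n} id) ⟩
  length (allFin n) ≡⟨ ↭-length (unique-↭ (UniqueP.allFin⁺ n)
        (UniqueP.++⁺ u (UniqueP.map⁺ α-inj u) disj) (λ {x} _ → split x) (λ {x} _ → ∈-allFin x)) ⟩
  length (L ++ map α L) ≡⟨ length-++ L ⟩
  length L + length (map α L) ≡⟨ cong (length L +_) (length-map α L) ⟩
  length L + length L ∎
  where
  open ≡-Reasoning
  α-inj : ∀ {x y} → α x ≡ α y → x ≡ y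
  α-inj {x} {y} e = trans (sym (αα x)) (trans (cong α e) (αα y))
  disj : ∀ {v} → v ∈ L × v ∈ map α L → ⊥
  disj (p , q) with ∈-map⁻ α q
  ... | y , y∈ , refl = excl y∈ p
  split : ∀ x → x ∈ L ++ map α L
  split x with cover x
  ... | inj₁ p = ∈-++⁺ˡ p
  ... | inj₂ q = ∈-++⁺ʳ L (subst (_∈ map α L) (αα x) (∈-map⁺ α q))

fin-surjective : {f : Fin n → Fin n} → Inj f → ∀ j → ∃ λ i → f i ≡ j
fin-surjective {suc m} {f} inj j with any? (λ i → f i ≟ j)
... | yes p = p
... | no ¬p = contradiction (injective⇒≤ {f = λ i → punchOut (λ e → ¬p (i , sym e))}
                (λ {x} {y} e → inj (punchOut-injective (λ e → ¬p (x , sym e)) (λ e → ¬p (y , sym e)) e))) (<⇒≱ (n<1+n m))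

-- `τ` is a single cycle of length `n`, and `pos` is the time at which the walk from `r` visits a
-- point. Every statement about what the contour meets first is a comparison of `pos`.
record Enum (τ : Fin n → Fin n) (r : Fin n) : Set where
  field
    pos      : Fin n → ℕ
    pos<     : ∀ y → pos y < n
    iter-pos : ∀ y → iter τ (pos y) r ≡ y
    pos-iter : ∀ {j} → j < n → pos (iter τ j r) ≡ j
    iter-n   : iter τ n r ≡ r

  pos-inj : ∀ {x y} → pos x ≡ pos y → x ≡ y
  pos-inj {x} {y} e = trans (sym (iter-pos x)) (trans (cong (λ m → iter τ m r) e) (iter-pos y))

  pos-τ : ∀ y → suc (pos y) < n → pos (τ y) ≡ suc (pos y)
  pos-τ y lt = trans (cong (pos ∘ τ) (sym (iter-pos y))) (pos-iter lt)

  reach : ∀ y → Orb τ r y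
  reach y = pos y , iter-pos y

cyclic-enum : {τ : Fin n → Fin n} → Inj τ → ∀ r → (∀ y → Orb τ r y) → Enum τ r
cyclic-enum {n} {τ} inj r h = record
  { pos = pos ; pos< = pos< ; iter-pos = iter-pos ; pos-iter = pos-iter ; iter-n = iter-n n refl }
  where
  pos : Fin n → ℕ
  pos y = proj₁ (orb-bounded inj (h y))
  pos< : ∀ y → pos y < n
  pos< y = proj₁ (proj₂ (orb-bounded inj (h y)))
  iter-pos : ∀ y → iter τ (pos y) r ≡ y
  iter-pos y = proj₂ (proj₂ (orb-bounded inj (h y)))
  posF : Fin n → Fin n
  posF y = fromℕ< (pos< y)
  posF-inj : Inj posF
  posF-inj {x} {y} e = trans (sym (iter-pos x)) (trans (cong (λ m → iter τ m r)
    (trans (sym (toℕ-fromℕ< (pos< x))) (trans (cong toℕ e) (toℕ-fromℕ< (pos< y))))) (iter-pos y))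
  pos-iter : ∀ {j} → j < n → pos (iter τ j r) ≡ j
  pos-iter {j} lt with fin-surjective posF-inj (fromℕ< lt)
  ... | y , e = trans (cong pos (trans (cong (λ m → iter τ m r) (sym pos-y)) (iter-pos y))) pos-y
    where
    pos-y : pos y ≡ j
    pos-y = trans (sym (toℕ-fromℕ< (pos< y))) (trans (cong toℕ e) (toℕ-fromℕ< lt))
  iter-n : ∀ m → m ≡ n → iter τ m r ≡ r
  iter-n zero e = refl
  iter-n (suc m) e with pos (iter τ (suc m) r) in eq
  ... | zero = trans (sym (iter-pos (iter τ (suc m) r))) (cong (λ k → iter τ k r) eq)
  -- A position `suc k` would, after cancelling one `τ`, give `k = m`; but then `suc k` is not below
  -- `n`.
  ... | suc k = contradiction (subst (suc k <_) (sym e) k<) (<-irrefl (cong suc (trans (sym (pos-iter k<′)) (trans (cong pos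
          (inj (trans (cong (λ k → iter τ k r) (sym eq)) (iter-pos (iter τ (suc m) r))))) (pos-iter (≤-reflexive e))))))
    where
    k< : suc k < n
    k< = subst (_< n) eq (pos< (iter τ (suc m) r))
    k<′ : k < n
    k<′ = <-trans (n<1+n k) k<

module Toggle {n} (τ ρ : Fin n → Fin n) (τ-inj : Inj τ) (ρρ : ∀ x → ρ (ρ x) ≡ x) where
  open DecMem (_≟_ {n}) using (_∈?_)

  Cut : List (Fin n) → Fin n → Set
  Cut D y = y ∈ D ⊎ ρ y ∈ D

  cut? : ∀ D y → Dec (Cut D y)
  cut? D y = (y ∈? D) ⊎-dec (ρ y ∈? D)

  cut-ρ : ∀ {D y} → Cut D y → Cut D (ρ y)
  cut-ρ {D} {y} (inj₁ p) = inj₂ (subst (_∈ D) (sym (ρρ y)) p)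
  cut-ρ (inj₂ q) = inj₁ q

  uncut-ρ : ∀ {D y} → ¬ Cut D y → ¬ Cut D (ρ y)
  uncut-ρ {D} {y} ¬c c = ¬c (subst (Cut D) (ρρ y) (cut-ρ c))

  pairing : List (Fin n) → Fin n → Fin n
  pairing D y with cut? D y
  ... | yes _ = y
  ... | no _ = ρ y

  pairing-cut : ∀ {D y} → Cut D y → pairing D y ≡ y
  pairing-cut {D} {y} c with cut? D y
  ... | yes _ = refl
  ... | no ¬c = contradiction c ¬c

  pairing-uncut : ∀ {D y} → ¬ Cut D y → pairing D y ≡ ρ y
  pairing-uncut {D} {y} ¬c with cut? D y
  ... | yes c = contradiction c ¬c
  ... | no _ = refl

  pairing-involutive : ∀ D y → pairing D (pairing D y) ≡ y
  pairing-involutive D y with cut? D y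
  ... | yes c = pairing-cut {D} c
  ... | no ¬c = trans (pairing-uncut {D} (uncut-ρ ¬c)) (ρρ y)

  -- `glued []` is `τ ∘ ρ`, with every pair in place; cutting one end of each pair brings back `τ`.
  -- For the contour of a map, `ρ = stemMate` makes `glued []` the face permutation, and
  -- `ρ = treeMate` makes it the vertex rotation.
  glued : List (Fin n) → Fin n → Fin n
  glued D y = τ (pairing D y)

  glued-inj : ∀ D → Inj (glued D)
  glued-inj D {x} {y} e = trans (sym (pairing-involutive D x)) (trans (cong (pairing D) (τ-inj e)) (pairing-involutive D y))

  Indep : List (Fin n) → Set
  Indep D = ∀ {b} → b ∈ D → ρ b ∉ D

  indep-tail : ∀ {b D} → Indep (b ∷ D) → Indep D
  indep-tail i m m′ = i (there m) (there m′)

  head-uncut : ∀ {b D} → Unique (b ∷ D) → Indep (b ∷ D) → ¬ Cut D b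
  head-uncut u i (inj₁ p) = UniqueP.Unique[x∷xs]⇒x∉xs u p
  head-uncut u i (inj₂ q) = i (here refl) (there q)

  toggle : ∀ {D b} → ¬ Cut D b → Swapped (glued D) (glued (b ∷ D)) b (ρ b)
  toggle {D} {b} ¬c = record
    { at-a = cong τ (trans (pairing-cut {b ∷ D} (inj₁ (here refl))) (sym (trans (pairing-uncut {D} (uncut-ρ ¬c)) (ρρ b))))
    ; at-b = cong τ (trans (pairing-cut {b ∷ D} (inj₂ (here (ρρ b)))) (sym (pairing-uncut {D} ¬c)))
    ; off = λ {x} p q → cong τ (off x p q) }
    where
    off : ∀ x → x ≢ b → x ≢ ρ b → pairing (b ∷ D) x ≡ pairing D x
    off x p q = go (cut? D x)
      where
      go : Dec (Cut D x) → pairing (b ∷ D) x ≡ pairing D x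
      go (yes c@(inj₁ m)) = trans (pairing-cut {b ∷ D} (inj₁ (there m))) (sym (pairing-cut {D} c))
      go (yes c@(inj₂ m)) = trans (pairing-cut {b ∷ D} (inj₂ (there m))) (sym (pairing-cut {D} c))
      go (no ¬d) = trans (pairing-uncut {b ∷ D} λ where
          (inj₁ (here e)) → p e
          (inj₁ (there m)) → ¬d (inj₁ m)
          (inj₂ (here e)) → q (trans (sym (ρρ x)) (cong ρ e))
          (inj₂ (there m)) → ¬d (inj₂ m)) (sym (pairing-uncut {D} ¬d))

  numOrbits-glued-≤ : ∀ D → Unique D → Indep D → numOrbits n (glued []) ≤ length D + numOrbits n (glued D)
  numOrbits-glued-≤ [] u i = ≤-refl
  numOrbits-glued-≤ (b ∷ D) u@(_ ∷ u′) i = ≤-trans (numOrbits-glued-≤ D u′ (indep-tail i))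
    (≤-trans (+-monoʳ-≤ (length D) (numOrbits-swapped-≤ (glued-inj D) (glued-inj (b ∷ D)) (toggle (head-uncut u i))))
      (≤-reflexive (+-suc (length D) _)))

  Total : List (Fin n) → Set
  Total D = ∀ y → ρ y ≡ y ⊎ Cut D y

  pairing-total : ∀ {D y} → ρ y ≡ y ⊎ Cut D y → pairing D y ≡ y
  pairing-total {D} {y} t with cut? D y
  ... | yes _ = refl
  pairing-total (inj₁ e) | no _ = e
  pairing-total (inj₂ c) | no ¬c = contradiction c ¬c

  module Crossing {r : Fin n} (E : Enum τ r) (D : List (Fin n)) (D-unique : Unique D) (indep : Indep D) (total : Total D) where
    open Enum E

    -- Cutting all pairs leaves the single cycle τ; recreating two crossing pairs first splits it in two and
    -- then rejoins it, so that one of the |D| possible splittings is lost.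
    crossing-loses : ∀ {p q} → p ∈ D → q ∈ D → pos p < pos q → pos q < pos (ρ p) → pos (ρ p) < pos (ρ q) →
      numOrbits n (glued []) < length D
    crossing-loses {p} {q} p∈ q∈ p<q q<ρp ρp<ρq = begin-strict
      numOrbits n (glued []) ≤⟨ numOrbits-glued-≤ L L-unique (λ b∈ ρb∈ → indep (L⊆ b∈) (L⊆ ρb∈)) ⟩
      length L + numOrbits n (glued L) ≤⟨ +-monoʳ-≤ (length L) count-L ⟩
      length L + 1 ≡⟨ +-comm (length L) 1 ⟩
      suc (length L) <⟨ n<1+n _ ⟩
      length (p ∷ q ∷ L) ≡⟨ sym (↭-length D↭) ⟩
      length D ∎
      where
      open ≤-Reasoning
      P? = λ x → ¬? (x ≟ p) ×-dec ¬? (x ≟ q)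
      L : List (Fin n)
      L = filter P? D
      L-unique : Unique L
      L-unique = UniqueP.filter⁺ P? D-unique
      L⊆ : ∀ {x} → x ∈ L → x ∈ D
      L⊆ m = proj₁ (∈-filter⁻ P? {xs = D} m)
      p∉L : p ∉ L
      p∉L m = proj₁ (proj₂ (∈-filter⁻ P? {xs = D} m)) refl
      q∉L : q ∉ L
      q∉L m = proj₂ (proj₂ (∈-filter⁻ P? {xs = D} m)) refl
      p≢q : p ≢ q
      p≢q refl = <-irrefl refl p<q
      all⊆ : ∀ {x} → x ∈ p ∷ q ∷ L → x ∈ D
      all⊆ (here refl) = p∈
      all⊆ (there (here refl)) = q∈
      all⊆ (there (there m)) = L⊆ m
      all⊇ : ∀ {x} → x ∈ D → x ∈ p ∷ q ∷ L
      all⊇ {x} m with x ≟ p | x ≟ q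
      ... | yes e | _ = here e
      ... | no _ | yes e = there (here e)
      ... | no a | no b = there (there (∈-filter⁺ P? m (a , b)))
      not∈ : ∀ {x : Fin n} {xs} → x ∉ xs → All (x ≢_) xs
      not∈ x∉ = All-tabulate λ { m refl → x∉ m }
      pqL-unique : Unique (p ∷ q ∷ L)
      pqL-unique = (p≢q ∷ not∈ p∉L) ∷ (not∈ q∉L ∷ L-unique)
      D↭ : D ↭ p ∷ q ∷ L
      D↭ = unique-↭ D-unique pqL-unique all⊇ all⊆
      p-uncut : ¬ Cut (q ∷ L) p
      p-uncut (inj₁ (here e)) = p≢q e
      p-uncut (inj₁ (there m)) = p∉L m
      p-uncut (inj₂ (here e)) = <-irrefl (cong pos (sym e)) q<ρp
      p-uncut (inj₂ (there m)) = indep p∈ (L⊆ m)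
      q-uncut : ¬ Cut L q
      q-uncut (inj₁ m) = q∉L m
      q-uncut (inj₂ m) = indep q∈ (L⊆ m)
      count-all : numOrbits n (glued (p ∷ q ∷ L)) ≡ 1
      count-all = numOrbits-transitive (glued-inj (p ∷ q ∷ L)) r λ y →
        orb-lift (λ x → 1 , cong τ (pairing-total {p ∷ q ∷ L} (tot x))) (reach y)
        where
        tot : Total (p ∷ q ∷ L)
        tot y with total y
        ... | inj₁ e = inj₁ e
        ... | inj₂ (inj₁ m) = inj₂ (inj₁ (all⊇ m))
        ... | inj₂ (inj₂ m) = inj₂ (inj₂ (all⊇ m))
      tot₁ : ∀ y → y ≢ p → y ≢ ρ p → ρ y ≡ y ⊎ Cut (q ∷ L) y
      tot₁ y a b with total y
      ... | inj₁ e = inj₁ e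
      ... | inj₂ (inj₁ m) with all⊇ m
      ...   | here e = contradiction e a
      ...   | there m′ = inj₂ (inj₁ m′)
      tot₁ y a b | inj₂ (inj₂ m) with all⊇ m
      ...   | here e = contradiction (trans (sym (ρρ y)) (cong ρ e)) b
      ...   | there m′ = inj₂ (inj₂ m′)
      -- With only the pair of `p` in place, the walk jumps at `ρ p` back to the successor of `p`.
      -- The positions after `p` up to `ρ p` are thus closed under the walk; they contain `q` and
      -- miss `ρ q`.
      In : Fin n → Set
      In y = pos p < pos y × pos y ≤ pos (ρ p)
      closed : ∀ y → In y → In (glued (q ∷ L) y)
      closed y (lo , hi) with y ≟ ρ p
      ... | yes refl = subst In (cong τ (sym (trans (pairing-uncut {q ∷ L} (uncut-ρ p-uncut)) (ρρ p))))
              (subst (λ m → pos p < m × m ≤ pos (ρ p)) (sym (pos-τ p (≤-<-trans (<-trans p<q q<ρp) (pos< (ρ p)))))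
                (n<1+n _ , <-trans p<q q<ρp))
      ... | no ne = subst In (cong τ (sym (pairing-total {q ∷ L} (tot₁ y (λ { refl → <-irrefl refl lo }) ne))))
              (subst (λ m → pos p < m × m ≤ pos (ρ p)) (sym (pos-τ y (≤-<-trans y<ρp (pos< (ρ p)))))
                (<-trans lo (n<1+n _) , y<ρp))
        where
        y<ρp : pos y < pos (ρ p)
        y<ρp = ≤∧≢⇒< hi (ne ∘ pos-inj)
      q≁ρq : ¬ Orb (glued (q ∷ L)) q (ρ q)
      q≁ρq o = <⇒≱ ρp<ρq (proj₂ (orb-closed In closed (p<q , <⇒≤ q<ρp) o))
      -- Restoring the pair of `p` gives at most two cycles, and restoring that of `q` then joins
      -- two of them.
      count-L : numOrbits n (glued L) ≤ 1
      count-L = ≤-pred (≤-trans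
        (≤-reflexive (sym (merge (glued-inj (q ∷ L)) (glued-inj L) (swapped-sym (toggle q-uncut)) q≁ρq)))
        (≤-trans (numOrbits-swapped-≤ (glued-inj (q ∷ L)) (glued-inj (p ∷ q ∷ L)) (toggle p-uncut)) (s≤s (≤-reflexive count-all))))

-- stk y lists, innermost first, the first halves of the ρ-pairs enclosing y in the cyclic order of τ.
record Stack {n} (τ ρ : Fin n → Fin n) : Set where
  field
    stk : Fin n → List (Fin n)

  Neutral : Fin n → Set
  Neutral y = ρ y ≡ y × stk (τ y) ≡ stk y
  Push : Fin n → Set
  Push y = stk (τ y) ≡ y ∷ stk y × stk (ρ y) ≡ y ∷ stk y
  Pop : Fin n → Set
  Pop y = stk y ≡ ρ y ∷ stk (τ y)

  field
    kind   : ∀ y → Neutral y ⊎ Push y ⊎ Pop y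
    level  : ∀ y → stk (τ (ρ y)) ≡ stk y
    nested : ∀ {y b s} → stk y ≡ b ∷ s → stk b ≡ s

module StackProps {n} {τ ρ : Fin n → Fin n} (S : Stack τ ρ) where
  open Stack S
  open DecMem (_≟_ {n}) using (_∈?_)

  -- By `nested`, the stack of an entry is the part of the stack below it.
  ∈⇒shorter : ∀ {y b} → b ∈ stk y → length (stk b) < length (stk y)
  ∈⇒shorter {y} m = go (stk y) refl m
    where
    go : ∀ s {y b} → stk y ≡ s → b ∈ s → length (stk b) < length s
    go (a ∷ s) e (here refl) = ≤-reflexive (cong (suc ∘ length) (nested e))
    go (a ∷ s) e (there m) = <-trans (go s (nested e) m) (n<1+n _)

  y∉stk : ∀ {y} → y ∉ stk y
  y∉stk m = <-irrefl refl (∈⇒shorter m)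

  -- A step of `τ` adds to the stack at most the point it starts from, so `o` can only appear by
  -- being passed.
  push-between : (h : ℕ → Fin n) → (∀ j → h (suc j) ≡ τ (h j)) → ∀ {o i} j → i ≤ j →
    o ∉ stk (h i) → o ∈ stk (h j) → ∃ λ k → i ≤ k × k < j × h k ≡ o
  push-between h hs {o} {i} j i≤j o∉ o∈ with i ℕP.≟ j
  ... | yes refl = contradiction o∈ o∉
  push-between h hs {o} {i} zero z≤n o∉ o∈ | no ne = contradiction refl ne
  push-between h hs {o} {i} (suc j) i≤j o∉ o∈ | no ne with o ∈? stk (h j)
  ... | yes o∈′ = let (k , a , b , c) = push-between h hs j i≤j′ o∉ o∈′ in k , a , <-trans b (n<1+n j) , c
    where i≤j′ = ≤-pred (≤∧≢⇒< i≤j ne)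
  ... | no o∉′ with kind (h j)
  ...   | inj₁ (_ , e) = contradiction (subst (o ∈_) (trans (cong stk (hs j)) e) o∈) o∉′
  ...   | inj₂ (inj₁ (e , _)) with subst (o ∈_) (trans (cong stk (hs j)) e) o∈
  ...     | here e′ = j , ≤-pred (≤∧≢⇒< i≤j ne) , n<1+n j , sym e′
  ...     | there m = contradiction m o∉′
  push-between h hs {o} {i} (suc j) i≤j o∉ o∈ | no ne | no o∉′ | inj₂ (inj₂ e) =
    contradiction (subst (o ∈_) (sym e) (there (subst (λ z → o ∈ stk z) (hs j) o∈))) o∉′

  -- The only step that removes `o` starts at its partner `ρ o`.
  pop-between : (∀ x → ρ (ρ x) ≡ x) → (h : ℕ → Fin n) → (∀ j → h (suc j) ≡ τ (h j)) → ∀ {o i} j → i ≤ j →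
    o ∈ stk (h i) → o ∉ stk (h j) → ∃ λ k → i ≤ k × k < j × h k ≡ ρ o
  pop-between ρρ h hs {o} {i} j i≤j o∈ o∉ with i ℕP.≟ j
  ... | yes refl = contradiction o∈ o∉
  pop-between ρρ h hs {o} {i} zero z≤n o∈ o∉ | no ne = contradiction refl ne
  pop-between ρρ h hs {o} {i} (suc j) i≤j o∈ o∉ | no ne with o ∈? stk (h j)
  ... | no o∉′ = let (k , a , b , c) = pop-between ρρ h hs j i≤j′ o∈ o∉′ in k , a , <-trans b (n<1+n j) , c
    where i≤j′ = ≤-pred (≤∧≢⇒< i≤j ne)
  ... | yes o∈′ with kind (h j)
  ...   | inj₁ (_ , e) = contradiction (subst (o ∈_) (sym (trans (cong stk (hs j)) e)) o∈′) o∉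
  ...   | inj₂ (inj₁ (e , _)) = contradiction (subst (o ∈_) (sym (trans (cong stk (hs j)) e)) (there o∈′)) o∉
  ...   | inj₂ (inj₂ e) with subst (o ∈_) e o∈′
  ...     | here e′ = j , ≤-pred (≤∧≢⇒< i≤j ne) , n<1+n j , trans (sym (ρρ (h j))) (cong ρ (sym e′))
  ...     | there m = contradiction (subst (λ z → o ∈ stk z) (sym (hs j)) m) o∉

  module Count (τ-inj : Inj τ) (ρρ : ∀ x → ρ (ρ x) ≡ x) where
    open Toggle τ ρ τ-inj ρρ public

    push-ρ-not-push : ∀ {b} → Push b → ¬ Push (ρ b)
    push-ρ-not-push {b} (_ , p) (_ , q) = <⇒≱ (≤-reflexive (cong length (sym p)))
      (≤-trans (n≤1+n _) (≤-reflexive (trans (cong length (sym q)) (cong (length ∘ stk) (ρρ b)))))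

    indep : ∀ {D} → (∀ {b} → b ∈ D → Push b) → Indep D
    indep h m m′ = push-ρ-not-push (h m) (h m′)

    -- As long as the pair of `b` is not cut, the points enclosed by `b` form a union of cycles: an
    -- intact pair keeps the stack, and a cut one changes it only by its own entry. This union
    -- contains `ρ b` but not `b`, so cutting the pair merges two different cycles.
    module Separate {D b} (D-push : ∀ {x} → x ∈ D → Push x) (b-push : Push b) (¬c : ¬ Cut D b) where
      closed : ∀ y → b ∈ stk y → b ∈ stk (glued D y)
      closed y m with cut? D y
      ... | no _ = subst (b ∈_) (sym (level y)) m
      ... | yes c with kind y
      ...   | inj₁ (_ , e) = subst (b ∈_) (sym e) m
      ...   | inj₂ (inj₁ (e , _)) = subst (b ∈_) (sym e) (there m)
      ...   | inj₂ (inj₂ e) with subst (b ∈_) e m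
      ...     | there m′ = m′
      ...     | here refl = contradiction (subst (Cut D) refl (cut-ρ c)) ¬c

      b≁ρb : ¬ Orb (glued D) b (ρ b)
      b≁ρb o = y∉stk (orb-closed (λ y → b ∈ stk y) closed (subst (b ∈_) (sym (proj₂ b-push)) (here refl)) (orb-sym (glued-inj D) o))

    Pushes : List (Fin n) → Set
    Pushes D = ∀ {x} → x ∈ D → Push x

    -- Nesting turns the estimate of `numOrbits-glued-≤` into an equality: every cut removes exactly
    -- one cycle.
    numOrbits-glued : ∀ D → Unique D → Pushes D → numOrbits n (glued []) ≡ length D + numOrbits n (glued D)
    numOrbits-glued [] u h = refl
    numOrbits-glued (b ∷ D) u@(_ ∷ u′) h = trans (numOrbits-glued D u′ (h ∘ there))
      (trans (cong (length D +_) (merge (glued-inj D) (glued-inj (b ∷ D)) (toggle ¬c)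
        (Separate.b≁ρb (h ∘ there) (h (here refl)) ¬c))) (+-suc (length D) _))
      where ¬c = head-uncut u (indep h)

    -- Cutting only merges cycles, so points once together stay together, and the two ends of a cut
    -- pair come to lie on one cycle. This shows that a contour is a single cycle before any
    -- enumeration of it is available.
    glued-⊆ : ∀ D → Unique D → Pushes D →
      (∀ {x y} → Orb (glued []) x y → Orb (glued D) x y) × (∀ {b} → b ∈ D → Orb (glued D) (ρ b) b)
    glued-⊆ [] u h = id , λ ()
    glued-⊆ (b ∷ D) u@(_ ∷ u′) h with glued-⊆ D u′ (h ∘ there)
    ... | sub , prs = (λ o → lift (sub o)) , λ { (here refl) → ba ; (there m) → lift (prs m) }
      where
      ¬c = head-uncut u (indep h)
      ba = orb-b-a (glued-inj D) (glued-inj (b ∷ D)) (toggle ¬c) (Separate.b≁ρb (h ∘ there) (h (here refl)) ¬c)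
      lift : ∀ {x y} → Orb (glued D) x y → Orb (glued (b ∷ D)) x y
      lift = orb-f⊆f′ (glued-inj D) (glued-inj (b ∷ D)) (toggle ¬c) ba

  -- Walk from y towards z along τ, jumping over each enclosed pair.
  same-stk⇒orb : (∀ x → ρ (ρ x) ≡ x) → ∀ {z} → (∀ {y} → Pop y → stk y ≡ stk z → y ≡ z) →
    ∀ m y → iter τ m y ≡ z → stk y ≡ stk z → Orb (λ x → τ (ρ x)) y z
  same-stk⇒orb ρρ {z} h = <-rec (λ m → ∀ y → iter τ m y ≡ z → stk y ≡ stk z → Orb (λ x → τ (ρ x)) y z) go
    where
    go : ∀ m → (∀ {k} → k < m → ∀ y → iter τ k y ≡ z → stk y ≡ stk z → Orb (λ x → τ (ρ x)) y z) →
      ∀ y → iter τ m y ≡ z → stk y ≡ stk z → Orb (λ x → τ (ρ x)) y z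
    go zero rec y e s = 0 , e
    go (suc m) rec y e s with kind y
    ... | inj₁ (f , e′) = orb-trans (1 , cong τ f) (rec (n<1+n m) (τ y) (trans (iter-suc τ m y) e) (trans e′ s))
    -- By `h`, the walk leaves the level of `z` downwards only at `z` itself.
    ... | inj₂ (inj₂ p) = subst (Orb _ y) (h p s) orb-refl
    -- `y` is on the stack right after `y` but not at `z`, so its partner is passed on the way, and
    -- jumping to it shortens the walk.
    ... | inj₂ (inj₁ (e′ , _))
      with pop-between ρρ (λ k → iter τ k (τ y)) (λ _ → refl) {o = y} {i = 0} m z≤n
             (subst (y ∈_) (sym e′) (here refl))
             (λ q → y∉stk (subst (y ∈_) (trans (cong stk (trans (iter-suc τ m y) e)) (sym s)) q))
    ...   | k , _ , k<m , ek = orb-trans orb-step (rec (s≤s (m∸n≤m m (suc k))) (τ (ρ y)) arrive (trans (level y) s))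
      where
      arrive : iter τ (m ∸ suc k) (τ (ρ y)) ≡ z
      arrive = begin
        iter τ (m ∸ suc k) (τ (ρ y)) ≡⟨ cong (λ x → iter τ (m ∸ suc k) (τ x)) (sym ek) ⟩
        iter τ (m ∸ suc k) (iter τ (suc k) (τ y)) ≡⟨ sym (iter-+ τ (m ∸ suc k) (suc k) (τ y)) ⟩
        iter τ (m ∸ suc k + suc k) (τ y) ≡⟨ cong (λ l → iter τ l (τ y)) (m∸n+n≡m k<m) ⟩
        iter τ m (τ y) ≡⟨ iter-suc τ m y ⟩
        τ (iter τ m y) ≡⟨ e ⟩
        z ∎
        where open ≡-Reasoning

-- Uniqueness of openings

col-≢⇒flip : ∀ {c d} → c ≢ d → c ≡ flipC d
col-≢⇒flip {black} {black} h = contradiction refl h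
col-≢⇒flip {black} {white} h = refl
col-≢⇒flip {white} {black} h = refl
col-≢⇒flip {white} {white} h = contradiction refl h

record MapLaws (M : CMap) : Set where
  open CMap M
  field
    σ-inj : Inj σ
    αα    : ∀ x → α (α x) ≡ x
    α≢    : ∀ x → α x ≢ x
    col-σ : ∀ x → col (σ x) ≡ col x
    col-α : ∀ x → col (α x) ≡ flipC (col x)

  α-inj : Inj α
  α-inj {x} {y} e = trans (sym (αα x)) (trans (cong α e) (αα y))

  φ : Fin size → Fin size
  φ h = σ (α h)

  φ-inj : Inj φ
  φ-inj e = α-inj (σ-inj e)

mapLaws : ∀ M → IsRBPMap (edgeMap M) → MapLaws M
mapLaws M ((g , gσ , _) , αα , α≢ , _ , _ , cσ , cα) = record
  { σ-inj = λ {x} {y} e → trans (sym (gσ x)) (trans (cong g e) (gσ y))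
  ; αα = αα ; α≢ = α≢ ; col-σ = cσ ; col-α = λ x → col-≢⇒flip (cα x) }

-- τ is the contour walk of the map cut open at the edges marked by st: a stem is passed without crossing its edge.
module Contour (M : CMap) (st : Fin (CMap.size M) → Bool) where
  open CMap M

  stemMate : Fin size → Fin size
  stemMate h = if st h then α h else h

  treeMate : Fin size → Fin size
  treeMate h = if st h then h else α h

  τ : Fin size → Fin size
  τ h = σ (treeMate h)

  reach-iter : ∀ x k → Reach σ α x (iter τ k x)
  reach-iter x zero = here
  reach-iter x (suc k) = step (iter τ k x) (reach-iter x k)
    where
    step : ∀ y → Reach σ α x y → Reach σ α x (τ y)
    step y r with st y
    ... | true = viaσ r
    ... | false = viaσ (viaα r)

  module _ (st-α : ∀ h → st (α h) ≡ st h) (αα : ∀ x → α (α x) ≡ x) where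
    stemMate-inv : ∀ h → stemMate (stemMate h) ≡ h
    stemMate-inv h with st h in e
    ... | true rewrite trans (st-α h) e = αα h
    ... | false rewrite e = refl

    treeMate-inv : ∀ h → treeMate (treeMate h) ≡ h
    treeMate-inv h with st h in e
    ... | false rewrite trans (st-α h) e = αα h
    ... | true rewrite e = refl

    τ-stemMate : ∀ h → τ (stemMate h) ≡ σ (α h)
    τ-stemMate h with st h in e
    ... | true rewrite trans (st-α h) e = refl
    ... | false rewrite e = refl

    τ-treeMate : ∀ h → τ (treeMate h) ≡ σ h
    τ-treeMate h = cong σ (treeMate-inv h)

    τ-inj : Inj σ → Inj τ
    τ-inj σ-inj {x} {y} e = trans (sym (treeMate-inv x)) (trans (cong treeMate (σ-inj e)) (treeMate-inv y))

-- The characterisation of the openings of closures that makes them unique; ℓ h is the height of the face containing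
-- corner h. An edge with ends b (black) and w (white) is tight when ℓ w = ℓ b + 1; good says that a tight edge that is
-- not cut is met first at its white end.
record Layout (M : CMap) : Set where
  open CMap M
  field
    st : Fin size → Bool
    ℓ  : Fin size → ℕ
  open Contour M st
  field
    enum : Enum τ root
  open Enum enum
  field
    st-α     : ∀ h → st (α h) ≡ st h
    ℓ-φ      : ∀ h → ℓ (σ (α h)) ≡ ℓ h
    ℓ-outer  : ℓ outer ≡ 0
    ℓ-zero   : ∀ {y} → ℓ y ≡ 0 → Orb (λ h → σ (α h)) y outer
    ℓ-bound  : ∀ {w} → col w ≡ white → ℓ w ≤ suc (ℓ (α w))
    ℓ-stem   : ∀ {w} → col w ≡ white → st w ≡ true → ℓ w ≡ suc (ℓ (α w))
    ℓ-face   : ∀ {y} → ℓ y ≢ 0 → ∃ λ w → Orb (λ h → σ (α h)) y w × col w ≡ white × st w ≡ true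
    one-stem : ∀ {w w′} → col w ≡ white → st w ≡ true → col w′ ≡ white → st w′ ≡ true →
               Orb (λ h → σ (α h)) w w′ → w ≡ w′
    good     : ∀ {b} → col b ≡ black → st b ≡ false → ℓ (α b) ≡ suc (ℓ b) → pos (α b) < pos b
    -- From a corner of the face of `w` the contour gets down to a lower face only by passing `w`:
    -- the stem that encloses the face has to be closed first.
    enclosed : ∀ {w x y} → col w ≡ white → st w ≡ true → Orb (λ h → σ (α h)) w x → ℓ y < ℓ w →
               pos x < pos y → pos x ≤ pos w

module LayoutUnique {M : CMap} (laws : MapLaws M) where
  open CMap M
  open MapLaws laws

  col-α-of : ∀ {x c} → col x ≡ c → col (α x) ≡ flipC c
  col-α-of e = trans (col-α _) (cong flipC e)

  ℓ-orb : (O : Layout M) → ∀ {x y} → Orb φ x y → Layout.ℓ O x ≡ Layout.ℓ O y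
  ℓ-orb O = orb-invariant (Layout.ℓ O) (Layout.ℓ-φ O)

  -- Descending along the stems of `O′` reaches the outer face in as many steps as the height in
  -- `O′`, and by `ℓ-bound` the height in `O` drops by at most one at each. Both heights are thus
  -- the same directed distance.
  ℓ-≤ : (O O′ : Layout M) → ∀ m y → Layout.ℓ O′ y ≡ m → Layout.ℓ O y ≤ m
  ℓ-≤ O O′ zero y e = ≤-reflexive (trans (ℓ-orb O (Layout.ℓ-zero O′ e)) (Layout.ℓ-outer O))
  ℓ-≤ O O′ (suc m) y e with Layout.ℓ-face O′ {y} (λ e₀ → 0≢1+n (trans (sym e₀) e))
  ... | w , o , cw , sw = begin
    ℓ y ≡⟨ ℓ-orb O o ⟩
    ℓ w ≤⟨ ℓ-bound cw ⟩
    suc (ℓ (α w)) ≤⟨ s≤s (ℓ-≤ O O′ m (α w) (suc-injective (trans (sym (Layout.ℓ-stem O′ cw sw)) (trans (sym (ℓ-orb O′ o)) e)))) ⟩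
    suc m ∎
    where
    open ≤-Reasoning
    open Layout O

  ℓ-unique : (O O′ : Layout M) → ∀ y → Layout.ℓ O y ≡ Layout.ℓ O′ y
  ℓ-unique O O′ y = ≤-antisym (ℓ-≤ O O′ _ y refl) (ℓ-≤ O′ O _ y refl)

  module Differ (O O′ : Layout M) where
    open Layout O
    open Enum enum
    private
      module O′ = Layout O′
      module E′ = Enum O′.enum

    Agree : ℕ → Set
    Agree j = ∀ y → pos y < j ⊎ E′.pos y < j → st y ≡ O′.st y

    -- If `x` is black, its edge is tight and kept by `O′`, so `O′` has already met the white end,
    -- where the two cuts still agree. If `x` is white, its face has a stem `x′` in `O′`. Either `O`
    -- cuts `x′` too, against `one-stem`, or `O` keeps it and meets it first at `x′`; then
    -- `enclosed` puts `x′` before `x`, where the cuts agree.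
    no-first-difference : ∀ x → E′.pos x ≡ pos x → Agree (pos x) → st x ≡ true → O′.st x ≡ false → ⊥
    no-first-difference x px agree sx sx′ with col x in cx
    ... | black = contradiction (trans (sym (trans (O′.st-α x) sx′)) (trans (sym (agree (α x) (inj₂ early))) (trans (st-α x) sx))) λ ()
      where
      early : E′.pos (α x) < pos x
      early = subst (E′.pos (α x) <_) px (O′.good cx sx′
        (trans (sym (ℓ-unique O O′ (α x))) (trans (ℓ-stem (col-α-of cx) (trans (st-α x) sx))
          (cong suc (trans (cong ℓ (αα x)) (ℓ-unique O O′ x))))))
    ... | white with O′.ℓ-face {x} (λ e₀ → 0≢1+n (trans (sym e₀) (trans (sym (ℓ-unique O O′ x)) (ℓ-stem cx sx))))
    ...   | x′ , o , cx′ , s′ with st x′ in sx₁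
    ...     | true = case trans (sym s′) (trans (cong O′.st (sym (one-stem cx sx cx′ sx₁ o))) sx′) of λ ()
    ...     | false = case trans (sym sx₁) (trans (agree x′ (inj₁ before)) s′) of λ ()
      where
      tight : ℓ x′ ≡ suc (ℓ (α x′))
      tight = trans (ℓ-unique O O′ x′) (trans (O′.ℓ-stem cx′ s′) (cong suc (sym (ℓ-unique O O′ (α x′)))))
      x′-first : pos x′ < pos (α x′)
      x′-first = subst (λ z → pos z < pos (α x′)) (αα x′)
        (good (col-α-of cx′) (trans (st-α x′) sx₁) (trans (cong ℓ (αα x′)) tight))
      before : pos x′ < pos x
      before = ≤∧≢⇒< (enclosed cx sx o (≤-reflexive (sym (trans (ℓ-orb O o) tight))) x′-first)
        λ e → case trans (sym s′) (trans (cong O′.st (pos-inj e)) sx′) of λ ()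

  layout-unique : (O O′ : Layout M) → ∀ x → Layout.st O x ≡ Layout.st O′ x
  layout-unique O O′ x = subst (λ z → st z ≡ O′.st z) (iter-pos x) (agree-at (pos x) (pos< x))
    where
    open Layout O
    open Enum enum
    module O′ = Layout O′
    module E′ = Enum O′.enum
    module C = Contour M st
    module C′ = Contour M O′.st
    h h′ : ℕ → Fin size
    h j = iter C.τ j root
    h′ j = iter C′.τ j root
    same-h : ∀ j → (∀ i → i < j → st (h i) ≡ O′.st (h i)) → h j ≡ h′ j
    same-h zero f = refl
    same-h (suc j) f = trans (cong (λ b → σ (if b then h j else α (h j))) (f j (n<1+n j)))
      (cong C′.τ (same-h j (λ i lt → f i (<-trans lt (n<1+n j)))))
    agree-at : ∀ j → j < size → st (h j) ≡ O′.st (h j)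
    agree-at = <-rec (λ j → j < size → st (h j) ≡ O′.st (h j)) λ j rec j< → step j j< λ i lt → rec lt (<-trans lt j<)
      where
      step : ∀ j → j < size → (∀ i → i < j → st (h i) ≡ O′.st (h i)) → st (h j) ≡ O′.st (h j)
      step j j< prev = decide (st x₀) (O′.st x₀) refl refl
        where
        x₀ = h j
        hh : ∀ {i} → i ≤ j → h i ≡ h′ i
        hh {i} i≤j = same-h i (λ k lt → prev k (<-≤-trans lt i≤j))
        pos-x₀ : pos x₀ ≡ j
        pos-x₀ = pos-iter j<
        pos′-x₀ : E′.pos x₀ ≡ j
        pos′-x₀ = trans (cong E′.pos (hh ≤-refl)) (E′.pos-iter j<)
        agree : ∀ y → pos y < j ⊎ E′.pos y < j → st y ≡ O′.st y
        agree y (inj₁ lt) = subst (λ z → st z ≡ O′.st z) (iter-pos y) (prev _ lt)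
        agree y (inj₂ lt) = subst (λ z → st z ≡ O′.st z) (trans (hh (<⇒≤ lt)) (E′.iter-pos y)) (prev _ lt)
        decide : ∀ a b → st x₀ ≡ a → O′.st x₀ ≡ b → st x₀ ≡ O′.st x₀
        decide true true p q = trans p (sym q)
        decide false false p q = trans p (sym q)
        decide true false p q = ⊥-elim (Differ.no-first-difference O O′ x₀ (trans pos′-x₀ (sym pos-x₀))
          (λ y m → agree y (subst (λ k → pos y < k ⊎ E′.pos y < k) pos-x₀ m)) p q)
        decide false true p q = ⊥-elim (Differ.no-first-difference O′ O x₀ (trans pos-x₀ (sym pos′-x₀))
          (λ y m → sym (agree y (Data.Sum.swap (subst (λ k → E′.pos y < k ⊎ pos y < k) pos′-x₀ m)))) q p)

-- Transport of layouts along isomorphisms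

module _ {M N : CMap} (iso : CIso M N) where
  private
    module M = CMap M
    module N = CMap N
    π = proj₁ iso
    π⁻ = proj₁ (proj₁ (proj₂ iso))
    π⁻π = proj₁ (proj₂ (proj₁ (proj₂ iso)))
    ππ⁻ = proj₂ (proj₂ (proj₁ (proj₂ iso)))
    π-σ = proj₁ (proj₂ (proj₂ iso))
    π-α = proj₁ (proj₂ (proj₂ (proj₂ iso)))
    π-root = proj₁ (proj₂ (proj₂ (proj₂ (proj₂ iso))))
    π-outer = proj₁ (proj₂ (proj₂ (proj₂ (proj₂ (proj₂ iso)))))
    π-col = proj₂ (proj₂ (proj₂ (proj₂ (proj₂ (proj₂ iso)))))

  iso-inj : ∀ {x y} → π x ≡ π y → x ≡ y
  iso-inj {x} {y} e = trans (sym (π⁻π x)) (trans (cong π⁻ e) (π⁻π y))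

  iso-size : M.size ≡ N.size
  iso-size = ≤-antisym (injective⇒≤ {f = π} iso-inj)
    (injective⇒≤ {f = π⁻} λ {x} {y} e → trans (sym (ππ⁻ x)) (trans (cong π e) (ππ⁻ y)))

  iso-iter : {f : Fin M.size → Fin M.size} {g : Fin N.size → Fin N.size} → (∀ x → π (f x) ≡ g (π x)) →
    ∀ k x → π (iter f k x) ≡ iter g k (π x)
  iso-iter h zero x = refl
  iso-iter {g = g} h (suc k) x = trans (h _) (cong g (iso-iter h k x))

  iso-φ : ∀ x → π (M.σ (M.α x)) ≡ N.σ (N.α (π x))
  iso-φ x = trans (π-σ _) (cong N.σ (π-α x))

  iso-orb⁺ : ∀ {x y} → Orb (λ h → M.σ (M.α h)) x y → Orb (λ h → N.σ (N.α h)) (π x) (π y)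
  iso-orb⁺ {x} (k , e) = k , trans (sym (iso-iter iso-φ k x)) (cong π e)

  iso-orb⁻ : ∀ {x y} → Orb (λ h → N.σ (N.α h)) (π x) (π y) → Orb (λ h → M.σ (M.α h)) x y
  iso-orb⁻ {x} (k , e) = k , iso-inj (trans (iso-iter iso-φ k x) e)

  -- Uniqueness compares two layouts of one map, so the layout of the target is brought back to the
  -- source.
  pull-layout : MapLaws N → Layout N → Layout M
  pull-layout laws O = record
    { st = st ∘ π ; ℓ = ℓ ∘ π
    ; enum = record
      { pos = pos ∘ π
      ; pos< = λ y → subst (pos (π y) <_) (sym iso-size) (pos< (π y))
      ; iter-pos = λ y → iso-inj (trans (π-h (pos (π y))) (iter-pos (π y)))
      ; pos-iter = λ {j} lt → trans (cong pos (π-h j)) (pos-iter (subst (j <_) iso-size lt))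
      ; iter-n = iso-inj (trans (π-h M.size) (trans (cong (λ m → iter C.τ m N.root) iso-size) (trans iter-n (sym π-root)))) }
    ; st-α = λ h → trans (cong st (π-α h)) (st-α (π h))
    ; ℓ-φ = λ h → trans (cong ℓ (iso-φ h)) (ℓ-φ (π h))
    -- An isomorphism respects `outer` only up to its face, on which the height is constant.
    ; ℓ-outer = trans (orb-invariant ℓ ℓ-φ π-outer) ℓ-outer
    ; ℓ-zero = λ e → iso-orb⁻ (orb-trans (ℓ-zero e) (orb-sym (MapLaws.φ-inj laws) π-outer))
    ; ℓ-bound = λ {w} cw → subst (λ z → ℓ (π w) ≤ suc (ℓ z)) (sym (π-α w)) (ℓ-bound (trans (π-col w) cw))
    ; ℓ-stem = λ {w} cw sw → trans (ℓ-stem (trans (π-col w) cw) sw) (cong (suc ∘ ℓ) (sym (π-α w)))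
    ; ℓ-face = λ {y} ne → let (w , o , cw , sw) = ℓ-face ne in
        π⁻ w , iso-orb⁻ (subst (Orb _ (π y)) (sym (ππ⁻ w)) o) ,
        trans (sym (π-col (π⁻ w))) (trans (cong N.col (ππ⁻ w)) cw) , trans (cong st (ππ⁻ w)) sw
    ; one-stem = λ {w} {w′} cw sw cw′ sw′ o →
        iso-inj (one-stem (trans (π-col w) cw) sw (trans (π-col w′) cw′) sw′ (iso-orb⁺ o))
    ; good = λ {b} cb sb t → subst (λ z → pos z < pos (π b)) (sym (π-α b))
        (good (trans (π-col b) cb) sb (trans (cong ℓ (sym (π-α b))) t))
    ; enclosed = λ {w} cw sw o lt p → enclosed (trans (π-col w) cw) sw (iso-orb⁺ o) lt p }
    where
    open Layout O
    open Enum enum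
    module C = Contour N st
    module C′ = Contour M (st ∘ π)
    π-τ : ∀ x → π (C′.τ x) ≡ C.τ (π x)
    π-τ x with st (π x)
    ... | true = π-σ x
    ... | false = iso-φ x
    π-h : ∀ j → π (iter C′.τ j M.root) ≡ iter C.τ j N.root
    π-h j = trans (iso-iter π-τ j M.root) (cong (iter C.τ j) π-root)

-- Face stacks and Euler's formula

-- Where `Layout` keeps only heights, this records the stacks themselves: `stk y` lists, innermost
-- first, the black ends of the stems that enclose the corner `y`. Closures and dual trees both
-- produce this form; counting faces and rebuilding the tree consume it.
record Opened (M : CMap) : Set where
  open CMap M
  field
    st  : Fin size → Bool
    stk : Fin size → List (Fin size)
  open Contour M st
  field
    st-α        : ∀ h → st (α h) ≡ st h
    neutral     : ∀ {y} → st y ≡ false → stk (τ y) ≡ stk y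
    push        : ∀ {y} → st y ≡ true → col y ≡ black → stk (τ y) ≡ y ∷ stk y × stk (α y) ≡ y ∷ stk y
    pop         : ∀ {y} → st y ≡ true → col y ≡ white → stk y ≡ α y ∷ stk (τ y)
    level       : ∀ y → stk (σ (α y)) ≡ stk y
    nested      : ∀ {y b s} → stk y ≡ b ∷ s → stk b ≡ s
    outer-empty : stk outer ≡ []
    top         : ∀ {y b s} → stk y ≡ b ∷ s → st b ≡ true × col b ≡ black
    bound       : ∀ {w} → col w ≡ white → length (stk w) ≤ suc (length (stk (α w)))

Good : (M : CMap) (O : Opened M) → Enum (Contour.τ M (Opened.st O)) (CMap.root M) → Set
Good M O E = ∀ {b} → col b ≡ black → st b ≡ false → length (stk (α b)) ≡ suc (length (stk b)) → pos (α b) < pos b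
  where
  open CMap M
  open Opened O
  open Enum E

Bool-false : ∀ {b} → b ≢ true → b ≡ false
Bool-false {false} h = refl
Bool-false {true} h = contradiction refl h

_≟C_ : (c d : Color) → Dec (c ≡ d)
black ≟C black = yes refl
black ≟C white = no λ ()
white ≟C black = no λ ()
white ≟C white = yes refl

_≟B_ : (c d : Bool) → Dec (c ≡ d)
_≟B_ = Data.Bool._≟_

color-cases : ∀ c → c ≡ black ⊎ c ≡ white
color-cases black = inj₁ refl
color-cases white = inj₂ refl

bool-cases : ∀ b → b ≡ true ⊎ b ≡ false
bool-cases true = inj₁ refl
bool-cases false = inj₂ refl

flipC-flipC : ∀ c → flipC (flipC c) ≡ c
flipC-flipC black = refl
flipC-flipC white = refl

module OpenedProps {M : CMap} (laws : MapLaws M) (O : Opened M) where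
  open CMap M
  open MapLaws laws
  open Opened O
  open Contour M st public

  col-α-of : ∀ {x c} → col x ≡ c → col (α x) ≡ flipC c
  col-α-of e = trans (col-α _) (cong flipC e)

  ρ : Fin size → Fin size
  ρ = stemMate

  ρρ : ∀ x → ρ (ρ x) ≡ x
  ρρ = stemMate-inv st-α αα

  τ-inj′ : Inj τ
  τ-inj′ = τ-inj st-α αα σ-inj

  ρ-stem : ∀ {y} → st y ≡ true → ρ y ≡ α y
  ρ-stem e rewrite e = refl

  ρ-tree : ∀ {y} → st y ≡ false → ρ y ≡ y
  ρ-tree e rewrite e = refl

  stack : Stack τ stemMate
  stack = record
    { stk = stk
    ; kind = kind
    ; level = λ y → trans (cong stk (τ-stemMate st-α αα y)) (level y)
    ; nested = nested }
    where
    kind : ∀ y → (ρ y ≡ y × stk (τ y) ≡ stk y) ⊎ (stk (τ y) ≡ y ∷ stk y × stk (ρ y) ≡ y ∷ stk y) ⊎ (stk y ≡ ρ y ∷ stk (τ y))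
    kind y with bool-cases (st y) | color-cases (col y)
    ... | inj₂ e | _ = inj₁ (ρ-tree e , neutral e)
    ... | inj₁ e | inj₁ c = inj₂ (inj₁ (proj₁ (push e c) , trans (cong stk (ρ-stem e)) (proj₂ (push e c))))
    ... | inj₁ e | inj₂ c = inj₂ (inj₂ (trans (pop e c) (cong (_∷ stk (τ y)) (sym (ρ-stem e)))))

  open Stack stack using (Push; Pop) public
  open StackProps stack public

  push-of : ∀ {y} → st y ≡ true → col y ≡ black → Push y
  push-of e c = proj₁ (push e c) , trans (cong stk (ρ-stem e)) (proj₂ (push e c))

  level-orb : ∀ {x y} → Orb φ x y → stk x ≡ stk y
  level-orb = orb-invariant stk level

  white-stk : ∀ {w} → st w ≡ true → col w ≡ white → stk w ≡ α w ∷ stk (α w)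
  white-stk {w} sw cw = trans (cong stk (sym (αα w))) (proj₂ (push (trans (st-α w) sw) (col-α-of cw)))

  private
    stem? : ∀ y → Dec (st y ≡ true × col y ≡ black)
    stem? y = (st y ≟B true) ×-dec (col y ≟C black)

  stemReps : List (Fin size)
  stemReps = filter stem? (allFin size)

  stemReps-unique : Unique stemReps
  stemReps-unique = UniqueP.filter⁺ stem? (UniqueP.allFin⁺ size)

  ∈-stemReps : ∀ {y} → st y ≡ true → col y ≡ black → y ∈ stemReps
  ∈-stemReps e c = ∈-filter⁺ stem? (∈-allFin _) (e , c)

  ∈-stemReps⁻ : ∀ {y} → y ∈ stemReps → st y ≡ true × col y ≡ black
  ∈-stemReps⁻ m = proj₂ (∈-filter⁻ stem? {xs = allFin size} m)

  stemReps-cover : ∀ {y} → st y ≡ true → y ∈ stemReps ⊎ α y ∈ stemReps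
  stemReps-cover {y} e with color-cases (col y)
  ... | inj₁ c = inj₁ (∈-stemReps e c)
  ... | inj₂ c = inj₂ (∈-stemReps (trans (st-α y) e) (col-α-of c))

  open Count τ-inj′ ρρ using (Total; Pushes; glued; glued-inj; pairing-total; pairing-uncut; numOrbits-glued; glued-⊆)

  stemReps-total : Total stemReps
  stemReps-total y with bool-cases (st y)
  ... | inj₂ e = inj₁ (ρ-tree e)
  ... | inj₁ e with stemReps-cover e
  ...   | inj₁ m = inj₂ (inj₁ m)
  ...   | inj₂ m = inj₂ (inj₂ (subst (_∈ stemReps) (sym (ρ-stem e)) m))

  stemReps-pushes : Pushes stemReps
  stemReps-pushes m = push-of (proj₁ (∈-stemReps⁻ m)) (proj₂ (∈-stemReps⁻ m))

  φ-glued : ∀ x → φ x ≡ glued [] x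
  φ-glued x = trans (sym (τ-stemMate st-α αα x)) (cong τ (sym (pairing-uncut {[]} λ { (inj₁ ()) ; (inj₂ ()) })))

  τ-glued : ∀ x → glued stemReps x ≡ τ x
  τ-glued x = cong τ (pairing-total {stemReps} (stemReps-total x))

  numOrbits-φ-τ : numOrbits size φ ≡ length stemReps + numOrbits size τ
  numOrbits-φ-τ = trans (numOrbits-cong φ-inj φ-glued) (trans (numOrbits-glued stemReps stemReps-unique stemReps-pushes)
    (cong (length stemReps +_) (numOrbits-cong (glued-inj stemReps) τ-glued)))

  orb-φ⊆τ : ∀ {x y} → Orb φ x y → Orb τ x y
  orb-φ⊆τ (k , e) = orb-lift {f = glued stemReps} {g = τ} (λ x → 1 , sym (τ-glued x))
    (proj₁ (glued-⊆ stemReps stemReps-unique stemReps-pushes) (k , trans (sym (iter-cong φ-glued k _)) e))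

  -- Cutting an edge joins the faces on its two sides; `w` is a corner of the upper one and `α w` of
  -- the lower one.
  orb-τ-stem : ∀ {w} → st w ≡ true → col w ≡ white → Orb τ w (α w)
  orb-τ-stem {w} sw cw = subst (λ z → Orb τ z (α w)) (trans (ρ-stem s′) (αα w)) (orb-lift {f = glued stemReps} {g = τ} (λ x → 1 , sym (τ-glued x))
      (proj₂ (glued-⊆ stemReps stemReps-unique stemReps-pushes) (∈-stemReps s′ (col-α-of cw))))
    where s′ = trans (st-α w) sw

module EnumProps {M : CMap} (laws : MapLaws M) (O : Opened M) (enum : Enum (Contour.τ M (Opened.st O)) (CMap.root M)) where
  open CMap M
  open MapLaws laws
  open Opened O
  open OpenedProps laws O public
  open Enum enum

  h : ℕ → Fin size
  h j = iter τ j root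

  push-pos : ∀ {o x y} → pos x ≤ pos y → o ∉ stk x → o ∈ stk y → pos x ≤ pos o × pos o < pos y
  push-pos {o} {x} {y} le o∉ o∈ with push-between h (λ _ → refl) {o} {pos x} (pos y) le
    (subst (λ z → o ∉ stk z) (sym (iter-pos x)) o∉) (subst (λ z → o ∈ stk z) (sym (iter-pos y)) o∈)
  ... | k , a , b , refl = subst (λ m → pos x ≤ m × m < pos y) (sym (pos-iter (<-trans b (pos< y)))) (a , b)

  pop-pos : ∀ {o x y} → pos x ≤ pos y → o ∈ stk x → o ∉ stk y → pos x ≤ pos (ρ o) × pos (ρ o) < pos y
  pop-pos {o} {x} {y} le o∈ o∉ with pop-between ρρ h (λ _ → refl) {o} {pos x} (pos y) le
    (subst (λ z → o ∈ stk z) (sym (iter-pos x)) o∈) (subst (λ z → o ∉ stk z) (sym (iter-pos y)) o∉)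
  ... | k , a , b , e = subst (λ m → pos x ≤ m × m < pos y)
          (sym (trans (cong pos (sym e)) (pos-iter (<-trans b (pos< y))))) (a , b)

  τ-orb : ∀ x y → Orb τ x y
  τ-orb x y = orb-trans (orb-sym τ-inj′ (reach x)) (reach y)

  -- The stack determines the face. The condition `only` holds for the empty stack because a pop has
  -- a nonempty one, and for a stack with top `b` because a pop has its own partner on top.
  orb-of-same-stk : ∀ {y z} → (∀ {p} → Pop p → stk p ≡ stk z → p ≡ z) → stk y ≡ stk z → Orb φ y z
  orb-of-same-stk {y} {z} only e with τ-orb y z
  ... | m , r with same-stk⇒orb ρρ only m y r e
  ...   | k , q = k , trans (iter-cong (λ x → sym (τ-stemMate st-α αα x)) k y) q

  empty⇒outer : ∀ {y} → stk y ≡ [] → Orb φ y outer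
  empty⇒outer e = orb-of-same-stk
    (λ p e′ → case trans (sym p) (trans e′ outer-empty) of λ ()) (trans e (sym outer-empty))

  top-orb : ∀ {y b s} → stk y ≡ b ∷ s → Orb φ y (α b)
  top-orb {y} {b} {s} e = orb-of-same-stk only (trans e (sym stk-αb))
    where
    sb = proj₁ (top e)
    stk-αb : stk (α b) ≡ b ∷ s
    stk-αb = trans (proj₂ (push sb (proj₂ (top e)))) (cong (b ∷_) (nested e))
    only : ∀ {p} → Pop p → stk p ≡ stk (α b) → p ≡ α b
    only {p} q e′ = trans (sym (ρρ p)) (trans (cong ρ (∷-injectiveˡ (trans (sym q) (trans e′ stk-αb)))) (ρ-stem sb))

  layout : Good M O enum → Layout M
  layout good = record
    { st = st ; ℓ = length ∘ stk ; enum = enum ; st-α = st-α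
    ; ℓ-φ = λ y → cong length (level y)
    ; ℓ-outer = cong length outer-empty
    ; ℓ-zero = λ {y} e → empty⇒outer (length-0 (stk y) e)
    ; ℓ-bound = bound
    ; ℓ-stem = λ cw sw → cong length (white-stk sw cw)
    ; ℓ-face = λ {y} ne → face y (stk y) refl ne
    ; one-stem = λ {w} {w′} cw sw cw′ sw′ o →
        α-inj (∷-injectiveˡ (trans (sym (white-stk sw cw)) (trans (level-orb o) (white-stk sw′ cw′))))
    ; good = good
    -- At `x` the stem `α w` is on the stack, at `y` the stack is too short to contain it; it is
    -- popped in between, at `w`.
    ; enclosed = λ {w} {x} {y} cw sw o lt p → subst (λ z → pos x ≤ pos z)
        (trans (ρ-stem (trans (st-α w) sw)) (αα w))
        (proj₁ (pop-pos {α w} {x} {y} (<⇒≤ p)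
          (subst (α w ∈_) (trans (sym (white-stk sw cw)) (level-orb o)) (here refl))
          (λ m → <⇒≱ (∈⇒shorter m) (≤-pred (subst (length (stk y) <_) (cong length (white-stk sw cw)) lt))))) }
    where
    length-0 : ∀ {A : Set} (xs : List A) → length xs ≡ 0 → xs ≡ []
    length-0 [] e = refl
    face : ∀ y s → stk y ≡ s → length (stk y) ≢ 0 → ∃ λ w → Orb φ y w × col w ≡ white × st w ≡ true
    face y [] e ne = contradiction (cong length e) ne
    face y (b ∷ s) e ne = α b , top-orb e , col-α-of (proj₂ (top e)) , trans (st-α b) (proj₁ (top e))

  private
    tree? : ∀ y → Dec (st y ≡ false × pos y < pos (α y))
    tree? y = (st y ≟B false) ×-dec (pos y <? pos (α y))

  treeReps : List (Fin size)
  treeReps = filter tree? (allFin size)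

  treeReps-unique : Unique treeReps
  treeReps-unique = UniqueP.filter⁺ tree? (UniqueP.allFin⁺ size)

  ∈-treeReps : ∀ {y} → st y ≡ false → pos y < pos (α y) → y ∈ treeReps
  ∈-treeReps e lt = ∈-filter⁺ tree? (∈-allFin _) (e , lt)

  ∈-treeReps⁻ : ∀ {y} → y ∈ treeReps → st y ≡ false × pos y < pos (α y)
  ∈-treeReps⁻ m = proj₂ (∈-filter⁻ tree? {xs = allFin size} m)

  treeReps-cover : ∀ {y} → st y ≡ false → y ∈ treeReps ⊎ α y ∈ treeReps
  treeReps-cover {y} e with <-cmp (pos y) (pos (α y))
  ... | tri< lt _ _ = inj₁ (∈-treeReps e lt)
  ... | tri≈ _ eq _ = contradiction (sym (pos-inj eq)) (α≢ y)
  ... | tri> _ _ gt = inj₂ (∈-treeReps (trans (st-α y) e) (subst (λ z → pos (α y) < pos z) (sym (αα y)) gt))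

  halfEdges : size ≡ length (stemReps ++ treeReps) + length (stemReps ++ treeReps)
  halfEdges = half-count α αα (stemReps ++ treeReps)
    (UniqueP.++⁺ stemReps-unique treeReps-unique λ (p , q) → clash refl p q) cover excl
    where
    clash : ∀ {x y} → st x ≡ st y → x ∈ stemReps → y ∈ treeReps → ⊥
    clash e p q = case trans (sym (proj₁ (∈-stemReps⁻ p))) (trans e (proj₁ (∈-treeReps⁻ q))) of λ ()
    cover : ∀ x → x ∈ stemReps ++ treeReps ⊎ α x ∈ stemReps ++ treeReps
    cover x with bool-cases (st x)
    ... | inj₁ e = Data.Sum.map ∈-++⁺ˡ ∈-++⁺ˡ (stemReps-cover e)
    ... | inj₂ e = Data.Sum.map (∈-++⁺ʳ stemReps) (∈-++⁺ʳ stemReps) (treeReps-cover e)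
    excl : ∀ {x} → x ∈ stemReps ++ treeReps → α x ∉ stemReps ++ treeReps
    excl {x} p q with ∈-++⁻ stemReps p | ∈-++⁻ stemReps q
    ... | inj₁ a | inj₁ b = case trans (sym (col-α-of (proj₂ (∈-stemReps⁻ a)))) (proj₂ (∈-stemReps⁻ b)) of λ ()
    ... | inj₁ a | inj₂ b = clash (sym (st-α x)) a b
    ... | inj₂ a | inj₁ b = clash (st-α x) b a
    ... | inj₂ a | inj₂ b = <-asym (proj₂ (∈-treeReps⁻ a))
            (subst (λ z → pos (α x) < pos z) (αα x) (proj₂ (∈-treeReps⁻ b)))

  numOrbits-τ : numOrbits size τ ≡ 1
  numOrbits-τ = numOrbits-transitive τ-inj′ root reach

  numFaces : numOrbits size φ ≡ suc (length stemReps)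
  numFaces = trans numOrbits-φ-τ (trans (cong (length stemReps +_) numOrbits-τ) (+-comm (length stemReps) 1))

  treeMate-tree : ∀ {y} → st y ≡ false → treeMate y ≡ α y
  treeMate-tree e rewrite e = refl

  treeMate-stem : ∀ {y} → st y ≡ true → treeMate y ≡ y
  treeMate-stem e rewrite e = refl

  module TreeToggle = Toggle τ treeMate τ-inj′ (treeMate-inv st-α αα)

  glued-tree : ∀ x → σ x ≡ TreeToggle.glued [] x
  glued-tree x = trans (sym (τ-treeMate st-α αα x)) (cong τ (sym (TreeToggle.pairing-uncut {[]} λ { (inj₁ ()) ; (inj₂ ()) })))

  treeReps-indep : TreeToggle.Indep treeReps
  treeReps-indep {b} p q = <-asym (proj₂ (∈-treeReps⁻ p))
    (subst (λ z → pos (α b) < pos z) (αα b) (proj₂ (∈-treeReps⁻ (subst (_∈ treeReps) (treeMate-tree (proj₁ (∈-treeReps⁻ p))) q))))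

  treeReps-total : TreeToggle.Total treeReps
  treeReps-total y with bool-cases (st y)
  ... | inj₁ e = inj₁ (treeMate-stem e)
  ... | inj₂ e with treeReps-cover e
  ...   | inj₁ m = inj₂ (inj₁ m)
  ...   | inj₂ m = inj₂ (inj₂ (subst (_∈ treeReps) (sym (treeMate-tree e)) m))

  private
    -- With `a` stems and `b` tree edges, E = a + b and F = a + 1, so V - E + F = 2 becomes V = b +
    -- 1. The equation is doubled because `size` counts half-edges.
    euler-arith : ∀ V a b → 2 * V + 2 * suc a ≡ (a + b) + (a + b) + 4 → V ≡ suc b
    euler-arith V a b e = *-cancelˡ-≡ V (suc b) 2 (+-cancelʳ-≡ (2 * suc a) (2 * V) (2 * suc b) (trans e (lemma a b)))
      where
      lemma : ∀ a b → (a + b) + (a + b) + 4 ≡ 2 * suc b + 2 * suc a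
      lemma = solve-∀
    euler-arith⁻ : ∀ a b → 2 * suc b + 2 * suc a ≡ (a + b) + (a + b) + 4
    euler-arith⁻ = solve-∀
    size≡ : size ≡ (length stemReps + length treeReps) + (length stemReps + length treeReps)
    size≡ = trans halfEdges (cong₂ _+_ (length-++ stemReps) (length-++ stemReps))

  Euler : Set
  Euler = 2 * numOrbits size σ + 2 * numOrbits size φ ≡ size + 4

  euler⇒numVertices : Euler → numOrbits size σ ≡ suc (length treeReps)
  euler⇒numVertices e = euler-arith _ (length stemReps) (length treeReps)
    (trans (cong (λ m → 2 * numOrbits size σ + 2 * m) (sym numFaces)) (trans e (cong (_+ 4) size≡)))

  numVertices⇒euler : numOrbits size σ ≡ suc (length treeReps) → Euler
  numVertices⇒euler e = trans (cong₂ (λ a b → 2 * a + 2 * b) e numFaces)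
    (trans (euler-arith⁻ (length stemReps) (length treeReps)) (cong (_+ 4) (sym size≡)))

  -- Euler's formula gives one vertex more than there are tree edges, whereas a crossing forces
  -- fewer vertices than tree edges.
  noncrossing : Euler → ∀ {p q} → st p ≡ false → st q ≡ false →
    pos p < pos q → pos q < pos (α p) → pos (α p) < pos (α q) → ⊥
  noncrossing e {p} {q} sp sq p<q q<αp αp<αq = <-irrefl refl (begin-strict
    length treeReps <⟨ n<1+n _ ⟩
    suc (length treeReps) ≡⟨ sym (euler⇒numVertices e) ⟩
    numOrbits size σ ≡⟨ numOrbits-cong σ-inj glued-tree ⟩
    numOrbits size (TreeToggle.glued []) <⟨ TreeToggle.Crossing.crossing-loses enum treeReps treeReps-unique treeReps-indep treeReps-total
        (∈-treeReps sp (<-trans p<q q<αp)) (∈-treeReps sq (<-trans q<αp αp<αq)) p<q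
        (subst (λ z → pos q < pos z) (sym (treeMate-tree sp)) q<αp)
        (subst₂ (λ y z → pos y < pos z) (sym (treeMate-tree sp)) (sym (treeMate-tree sq)) αp<αq) ⟩
    length treeReps ∎)
    where open ≤-Reasoning

  -- The converse, for closures: each of the nested tree edges splits off exactly one vertex from
  -- the contour when it is reglued.
  tree-stack⇒euler : (S : Stack τ treeMate) → (∀ {y} → st y ≡ false → pos y < pos (α y) → Stack.Push S y) → Euler
  tree-stack⇒euler S pushes = numVertices⇒euler (begin
    numOrbits size σ ≡⟨ numOrbits-cong σ-inj glued-tree ⟩
    numOrbits size (glued []) ≡⟨ numOrbits-glued treeReps treeReps-unique
                                                            (λ m → pushes (proj₁ (∈-treeReps⁻ m)) (proj₂ (∈-treeReps⁻ m))) ⟩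
    length treeReps + numOrbits size (glued treeReps) ≡⟨ cong (length treeReps +_) (trans (numOrbits-cong (glued-inj treeReps)
                                                            (λ x → cong τ (pairing-total {treeReps} (treeReps-total x)))) numOrbits-τ) ⟩
    length treeReps + 1 ≡⟨ +-comm (length treeReps) 1 ⟩
    suc (length treeReps) ∎)
    where
    open StackProps.Count S τ-inj′ (treeMate-inv st-α αα)
    open ≡-Reasoning

-- Existence of a good opening

module Distance {M : CMap} (laws : MapLaws M) (connected : ∀ x y → Reach (CMap.σ M) (CMap.α M) x y) where
  open CMap M
  open MapLaws laws

  private
    col-α-of : ∀ {x c} → col x ≡ c → col (α x) ≡ flipC c
    col-α-of e = trans (col-α _) (cong flipC e)

  -- Directed dual distance at most `k` to the outer face: a step crosses an edge from the corner at
  -- its white end to the face of the corner at its black end.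
  Within : ℕ → Fin size → Set
  Within zero y = Orb φ y outer
  Within (suc k) y = Within k y ⊎ ∃ λ w → Orb φ y w × col w ≡ white × Within k (α w)

  within? : ∀ k y → Dec (Within k y)
  within? zero y = orb? φ-inj y outer
  within? (suc k) y = within? k y ⊎-dec any? (λ w → orb? φ-inj y w ×-dec ((col w ≟C white) ×-dec within? k (α w)))

  within-orb : ∀ k {x y} → Orb φ x y → Within k y → Within k x
  within-orb zero o q = orb-trans o q
  within-orb (suc k) o (inj₁ q) = inj₁ (within-orb k o q)
  within-orb (suc k) o (inj₂ (w , o′ , c , q)) = inj₂ (w , orb-trans o o′ , c , q)

  Near : Fin size → Set
  Near y = ∃ λ k → Within k y

  near-orb : ∀ {x y} → Orb φ x y → Near y → Near x
  near-orb o (k , q) = k , within-orb k o q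

  near-white : ∀ {w} → col w ≡ white → Near (α w) → Near w
  near-white {w} c (k , q) = suc k , inj₂ (w , orb-refl , c , q)

  φα : ∀ y → φ (α y) ≡ σ y
  φα y = cong σ (αα y)

  near-σ⁻ : ∀ {w} → col w ≡ white → Near (σ w) → Near w
  near-σ⁻ {w} c q = near-white c (near-orb (1 , φα w) q)

  near-σ⁻* : ∀ k {w} → col w ≡ white → Near (iter σ k w) → Near w
  near-σ⁻* zero c q = q
  near-σ⁻* (suc k) {w} c q = near-σ⁻* k c (near-σ⁻ (trans (sym (orb-invariant col col-σ (k , refl))) c) q)

  -- Dual edges turn in one direction around each white vertex, so they can be followed backwards by going round it.
  near-σ-white : ∀ {w} → col w ≡ white → Near w → Near (σ w)
  near-σ-white {w} c q with orb-sym σ-inj (orb-step {f = σ} {w})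
  ... | k , e = near-σ⁻* k (trans (col-σ w) c) (subst Near (sym e) q)

  near-α : ∀ {y} → Near y → Near (α y)
  near-α {y} q with color-cases (col y)
  ... | inj₁ c = near-white (col-α-of c) (subst Near (sym (αα y)) q)
  ... | inj₂ c = near-orb (1 , φα y) (near-σ-white c q)

  near-σ : ∀ {y} → Near y → Near (σ y)
  near-σ {y} q with color-cases (col y)
  ... | inj₂ c = near-σ-white c q
  ... | inj₁ c = near-orb (orb-sym φ-inj (1 , φα y)) (near-α q)

  near : ∀ y → Near y
  near y = go (connected outer y)
    where
    go : ∀ {y} → Reach σ α outer y → Near y
    go here = 0 , orb-refl
    go (viaσ r) = near-σ (go r)
    go (viaα r) = near-α (go r)

  Least : Fin size → Set
  Least y = ∃ λ m → Within m y × (∀ k → Within k y → m ≤ k)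

  within-mono : ∀ {j k y} → j ≤ k → Within j y → Within k y
  within-mono {j} {k} le q = go (≤⇒≤′ le) q
    where
    go : ∀ {j k y} → j Data.Nat.≤′ k → Within j y → Within k y
    go (Data.Nat.≤′-reflexive refl) q = q
    go (Data.Nat.≤′-step le) q = inj₁ (go le q)

  least : ∀ k {y} → Within k y → Least y
  least zero q = 0 , q , λ _ _ → z≤n
  least (suc k) {y} q with within? k y
  ... | yes p = least k p
  ... | no ¬p = suc k , q , λ j p → ≮⇒≥ λ lt → ¬p (within-mono (≤-pred lt) p)

  ℓ : Fin size → ℕ
  ℓ y = proj₁ (least _ (proj₂ (near y)))

  ℓ-within : ∀ y → Within (ℓ y) y
  ℓ-within y = proj₁ (proj₂ (least _ (proj₂ (near y))))

  ℓ-≤ : ∀ {k y} → Within k y → ℓ y ≤ k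
  ℓ-≤ {k} {y} = proj₂ (proj₂ (least _ (proj₂ (near y)))) k

  ℓ-orb : ∀ {x y} → Orb φ x y → ℓ x ≡ ℓ y
  ℓ-orb o = ≤-antisym (ℓ-≤ (within-orb _ o (ℓ-within _))) (ℓ-≤ (within-orb _ (orb-sym φ-inj o) (ℓ-within _)))

  ℓ-outer : ℓ outer ≡ 0
  ℓ-outer = n≤0⇒n≡0 (ℓ-≤ {0} orb-refl)

  ℓ-zero : ∀ {y} → ℓ y ≡ 0 → Orb φ y outer
  ℓ-zero {y} e = subst (λ k → Within k y) e (ℓ-within y)

  ℓ-bound : ∀ {w} → col w ≡ white → ℓ w ≤ suc (ℓ (α w))
  ℓ-bound {w} c = ℓ-≤ {suc (ℓ (α w))} (inj₂ (w , orb-refl , c , ℓ-within (α w)))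

  Tight : Fin size → Set
  Tight w = col w ≡ white × ℓ w ≡ suc (ℓ (α w))

  tight-edge : ∀ y → ℓ y ≢ 0 → ∃ λ w → Orb φ y w × Tight w
  tight-edge y ne with ℓ y in e | ℓ-within y
  ... | zero | _ = contradiction refl ne
  ... | suc m | inj₁ q = contradiction (subst (_≤ m) e (ℓ-≤ q)) (<⇒≱ (n<1+n m))
  ... | suc m | inj₂ (w , o , c , q) = w , o , c , trans ℓw (cong suc (≤-antisym
          (≤-pred (subst (_≤ suc (ℓ (α w))) ℓw (ℓ-bound c))) (ℓ-≤ q)))
    where
    ℓw : ℓ w ≡ suc m
    ℓw = trans (sym (ℓ-orb o)) e

  -- A geodesic spanning tree of the dual: one tight edge for each face but the outer one. The
  -- preference with respect to the root is not imposed yet.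
  record Cut : Set where
    field
      st    : Fin size → Bool
      st-α  : ∀ y → st (α y) ≡ st y
      tight : ∀ {w} → col w ≡ white → st w ≡ true → ℓ w ≡ suc (ℓ (α w))
      exist : ∀ y → ℓ y ≢ 0 → ∃ λ w → Orb φ y w × col w ≡ white × st w ≡ true
      one   : ∀ {w w′} → col w ≡ white → st w ≡ true → col w′ ≡ white → st w′ ≡ true → Orb φ w w′ → w ≡ w′

  module InitialCut where
    pick : Fin size → Fin size
    pick y with ℓ y ℕP.≟ 0
    ... | yes _ = y
    ... | no ne = proj₁ (tight-edge y ne)

    pick-spec : ∀ y → ℓ y ≢ 0 → Orb φ y (pick y) × Tight (pick y)
    pick-spec y ne with ℓ y ℕP.≟ 0
    ... | yes e = contradiction e ne
    ... | no ne′ = proj₂ (tight-edge y ne′)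

    -- `pick` chooses a tight edge for a corner; evaluating it at the least corner of the face makes
    -- the choice depend on the face alone.
    canon : Fin size → Fin size
    canon y = proj₁ (orbRep φ-inj y)

    canon-orb : ∀ y → Orb φ y (canon y)
    canon-orb y = proj₁ (proj₂ (orbRep φ-inj y))

    Chosen : Fin size → Set
    Chosen w = ℓ w ≢ 0 × w ≡ pick (canon w)

    chosen? : ∀ w → Dec (Chosen w)
    chosen? w = ¬? (ℓ w ℕP.≟ 0) ×-dec (w ≟ pick (canon w))

    chosen-tight : ∀ {w} → Chosen w → Tight w
    chosen-tight {w} (ne , e) = subst Tight (sym e)
      (proj₂ (pick-spec (canon w) (λ z → ne (trans (ℓ-orb (canon-orb w)) z))))

    edge? : ∀ y → Dec (Chosen y ⊎ Chosen (α y))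
    edge? y = chosen? y ⊎-dec chosen? (α y)

    st : Fin size → Bool
    st y = does (edge? y)

    does⁻ : ∀ {A : Set} (d : Dec A) → does d ≡ true → A
    does⁻ (yes a) e = a

    st-white : ∀ {w} → col w ≡ white → st w ≡ true → Chosen w
    st-white {w} c e with does⁻ (edge? w) e
    ... | inj₁ p = p
    ... | inj₂ p = case trans (sym (proj₁ (chosen-tight p))) (col-α-of c) of λ ()

    initial : Cut
    initial = record
      { st = st
      ; st-α = λ y → st-sym (edge? (α y)) (edge? y) (flip y) (flip⁻ y)
      ; tight = λ c e → proj₂ (chosen-tight (st-white c e))
      ; exist = λ y ne → let ne′ = λ z → ne (trans (ℓ-orb (canon-orb y)) z)
                             (o , t) = pick-spec (canon y) ne′
                             oy = orb-trans (canon-orb y) o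
                         in pick (canon y) , oy , proj₁ t ,
                            dec-true (edge? _) (inj₁ ((λ z → ne (trans (ℓ-orb oy) z)) , cong pick (orbRep-cong φ-inj oy)))
      ; one = λ c e c′ e′ o → trans (proj₂ (st-white c e)) (trans (cong pick (orbRep-cong φ-inj o)) (sym (proj₂ (st-white c′ e′)))) }
      where
      st-sym : ∀ {A B : Set} (a : Dec A) (b : Dec B) → (A → B) → (B → A) → does a ≡ does b
      st-sym a (yes y) f g = dec-true a (g y)
      st-sym a (no ¬y) f g = dec-false a (¬y ∘ f)
      flip : ∀ y → Chosen (α y) ⊎ Chosen (α (α y)) → Chosen y ⊎ Chosen (α y)
      flip y (inj₁ p) = inj₂ p
      flip y (inj₂ p) = inj₁ (subst Chosen (αα y) p)
      flip⁻ : ∀ y → Chosen y ⊎ Chosen (α y) → Chosen (α y) ⊎ Chosen (α (α y))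
      flip⁻ y (inj₁ p) = inj₂ (subst Chosen (sym (αα y)) p)
      flip⁻ y (inj₂ p) = inj₁ p

  module FromCut (C : Cut) where
    open Cut C
    open Contour M st

    stemOf : Fin size → Fin size
    stemOf y with ℓ y ℕP.≟ 0
    ... | yes _ = y
    ... | no ne = proj₁ (exist y ne)

    stemOf-spec : ∀ y → ℓ y ≢ 0 → Orb φ y (stemOf y) × col (stemOf y) ≡ white × st (stemOf y) ≡ true
    stemOf-spec y ne with ℓ y ℕP.≟ 0
    ... | yes e = contradiction e ne
    ... | no ne′ = proj₂ (exist y ne′)

    stemOf-unique : ∀ {y w} → Orb φ y w → col w ≡ white → st w ≡ true → stemOf y ≡ w
    stemOf-unique {y} {w} o c e with stemOf-spec y (λ z → 0≢1+n (trans (sym z) (trans (ℓ-orb o) (tight c e))))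
    ... | o′ , c′ , e′ = one c′ e′ c e (orb-trans (orb-sym φ-inj o′) o)

    stemOf-ℓ : ∀ {y k} → ℓ y ≡ suc k → ℓ (α (stemOf y)) ≡ k
    stemOf-ℓ {y} e with stemOf-spec y (λ z → 0≢1+n (trans (sym z) e))
    ... | o , c , s = suc-injective (trans (sym (tight c s)) (trans (sym (ℓ-orb o)) e))

    -- The stack read off the dual tree: the black ends of the stems crossed on the way from the
    -- face of `y` down to the outer face. The number is meant to be the height, which is the exact
    -- count of steps.
    stkFrom : ℕ → Fin size → List (Fin size)
    stkFrom zero y = []
    stkFrom (suc k) y = α (stemOf y) ∷ stkFrom k (α (stemOf y))

    stk : Fin size → List (Fin size)
    stk y = stkFrom (ℓ y) y

    length-stkFrom : ∀ k y → length (stkFrom k y) ≡ k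
    length-stkFrom zero y = refl
    length-stkFrom (suc k) y = cong suc (length-stkFrom k _)

    stk-orb : ∀ {x y} → Orb φ x y → stk x ≡ stk y
    stk-orb {x} {y} o = trans (go (ℓ x) refl) (cong (λ k → stkFrom k y) (ℓ-orb o))
      where
      go : ∀ k → ℓ x ≡ k → stkFrom k x ≡ stkFrom k y
      go zero e = refl
      go (suc k) e with stemOf-spec y (λ z → 0≢1+n (trans (sym z) (trans (sym (ℓ-orb o)) e)))
      ... | o′ , c , s = cong (λ z → α z ∷ stkFrom k (α z)) (stemOf-unique (orb-trans o o′) c s)

    stk-white : ∀ {w} → st w ≡ true → col w ≡ white → stk w ≡ α w ∷ stk (α w)
    stk-white {w} s c = trans (cong (λ k → stkFrom k w) (tight c s))
      (cong (λ z → α z ∷ stkFrom (ℓ (α w)) (α z)) (stemOf-unique orb-refl c s))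

    stk-push : ∀ {b} → st b ≡ true → col b ≡ black → stk (α b) ≡ b ∷ stk b
    stk-push {b} s c = trans (stk-white (trans (st-α b) s) (col-α-of c)) (cong (λ z → z ∷ stk z) (αα b))

    τ-tree : ∀ {y} → st y ≡ false → τ y ≡ σ (α y)
    τ-tree e rewrite e = refl

    τ-stem : ∀ {y} → st y ≡ true → τ y ≡ σ y
    τ-stem e rewrite e = refl

    stk-σ : ∀ y → stk (σ y) ≡ stk (α y)
    stk-σ y = sym (stk-orb (1 , φα y))

    uncons : ∀ {y b s} k → ℓ y ≡ k → stkFrom k y ≡ b ∷ s → stk b ≡ s × st b ≡ true × col b ≡ black
    uncons {y} (suc k) e refl with stemOf-spec y (λ z → 0≢1+n (trans (sym z) e))
    ... | o , c , s = cong (λ m → stkFrom m (α (stemOf y))) (stemOf-ℓ e) , trans (st-α _) s , col-α-of c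

    opened : Opened M
    opened = record
      { st = st ; stk = stk ; st-α = st-α
      ; neutral = λ {y} e → trans (cong stk (τ-tree e)) (sym (stk-orb (1 , refl)))
      ; push = λ {y} s c → trans (cong stk (τ-stem s)) (trans (stk-σ y) (stk-push s c)) , stk-push s c
      ; pop = λ {y} s c → trans (stk-white s c) (cong (α y ∷_) (sym (trans (cong stk (τ-stem s)) (stk-σ y))))
      ; level = λ y → sym (stk-orb (1 , refl))
      ; nested = λ {y} e → proj₁ (uncons (ℓ y) refl e)
      ; outer-empty = cong (λ k → stkFrom k outer) ℓ-outer
      ; top = λ {y} e → proj₂ (uncons (ℓ y) refl e)
      ; bound = λ {w} c → subst₂ (λ a b → a ≤ suc b) (sym (length-stkFrom (ℓ w) w)) (sym (length-stkFrom (ℓ (α w)) (α w))) (ℓ-bound c) }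

    open OpenedProps laws opened using (orb-φ⊆τ; orb-τ-stem; τ-inj′)

    -- Cutting a stem merges each face with the next lower one, so along the dual tree all faces are
    -- merged into one cycle.
    to-outer : ∀ k y → ℓ y ≡ k → Orb τ y outer
    to-outer zero y e = orb-φ⊆τ (ℓ-zero e)
    to-outer (suc k) y e with stemOf-spec y (λ z → 0≢1+n (trans (sym z) e))
    ... | o , c , s = orb-trans (orb-φ⊆τ o) (orb-trans (orb-τ-stem s c) (to-outer k _ (stemOf-ℓ e)))

    enum : Enum τ root
    enum = cyclic-enum τ-inj′ root λ y → orb-trans (to-outer _ root refl) (orb-sym τ-inj′ (to-outer _ y refl))

    open EnumProps laws opened enum using (push-pos; ∈⇒shorter)
    open Enum enum

    Bad : Fin size → Set
    Bad b = col b ≡ black × st b ≡ false × ℓ (α b) ≡ suc (ℓ b) × pos b < pos (α b)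

    bad? : ∀ b → Dec (Bad b)
    bad? b = (col b ≟C black) ×-dec ((st b ≟B false) ×-dec ((ℓ (α b) ℕP.≟ suc (ℓ b)) ×-dec (pos b <? pos (α b))))

    no-bad⇒good : (∀ b → ¬ Bad b) → Good M opened enum
    no-bad⇒good h {b} c s e = ≤∧≢⇒< (≮⇒≥ λ lt → h b (c , s ,
        trans (sym (length-stkFrom _ (α b))) (trans e (cong suc (length-stkFrom _ b))) , lt))
      λ p → α≢ b (pos-inj p)

    -- Cut the bad edge {b, w} instead of the stem {x, o} of the face of w. The contour meets b or x before it meets
    -- w or o, and there the new cut is the preferred one.
    module Flip {b : Fin size} (bad : Bad b) where
      w x o : Fin size
      w = α b
      x = stemOf w
      o = α x
      cb = proj₁ bad
      sb = proj₁ (proj₂ bad)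
      ℓw = proj₁ (proj₂ (proj₂ bad))
      b<w = proj₂ (proj₂ (proj₂ bad))
      cw : col w ≡ white
      cw = col-α-of cb
      sw : st w ≡ false
      sw = trans (st-α b) sb
      αw : α w ≡ b
      αw = αα b
      x-spec = stemOf-spec w (λ z → 0≢1+n (trans (sym z) ℓw))
      wx = proj₁ x-spec
      cx = proj₁ (proj₂ x-spec)
      sx = proj₂ (proj₂ x-spec)
      co : col o ≡ black
      co = col-α-of cx
      αo : α o ≡ x
      αo = αα x
      differ-col : ∀ {y z} → col y ≡ black → col z ≡ white → y ≢ z
      differ-col cy cz refl = case trans (sym cy) cz of λ ()
      x≢w : x ≢ w
      x≢w e = case trans (sym sx) (trans (cong st e) sw) of λ ()
      o≢b : o ≢ b
      o≢b e = x≢w (trans (sym αo) (cong α e))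

      on? : ∀ y → Dec (y ≡ b ⊎ y ≡ w)
      on? y = (y ≟ b) ⊎-dec (y ≟ w)
      off? : ∀ y → Dec (y ≡ x ⊎ y ≡ o)
      off? y = (y ≟ x) ⊎-dec (y ≟ o)

      st′ : Fin size → Bool
      st′ y with on? y
      ... | yes _ = true
      ... | no _ with off? y
      ...   | yes _ = false
      ...   | no _ = st y

      st′-on : ∀ {y} → y ≡ b ⊎ y ≡ w → st′ y ≡ true
      st′-on {y} p with on? y
      ... | yes _ = refl
      ... | no q = contradiction p q

      st′-off : ∀ {y} → y ≡ x ⊎ y ≡ o → st′ y ≡ false
      st′-off {y} p with on? y
      ... | yes (inj₁ e) = case p of λ { (inj₁ e′) → contradiction (trans (sym e) e′) (differ-col cb cx) ; (inj₂ e′) → contradiction (trans (sym e′) e) o≢b }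
      ... | yes (inj₂ e) = case p of λ { (inj₁ e′) → contradiction (trans (sym e′) e) x≢w ; (inj₂ e′) → contradiction (trans (sym e′) e) (differ-col co cw) }
      ... | no _ with off? y
      ...   | yes _ = refl
      ...   | no q = contradiction p q

      st′-else : ∀ {y} → ¬ (y ≡ b ⊎ y ≡ w) → ¬ (y ≡ x ⊎ y ≡ o) → st′ y ≡ st y
      st′-else {y} p q with on? y
      ... | yes r = contradiction r p
      ... | no _ with off? y
      ...   | yes r = contradiction r q
      ...   | no _ = refl

      on-α : ∀ {y} → α y ≡ b ⊎ α y ≡ w → y ≡ b ⊎ y ≡ w
      on-α {y} (inj₁ e) = inj₂ (trans (sym (αα y)) (cong α e))
      on-α {y} (inj₂ e) = inj₁ (α-inj e)

      off-α : ∀ {y} → α y ≡ x ⊎ α y ≡ o → y ≡ x ⊎ y ≡ o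
      off-α {y} (inj₁ e) = inj₂ (trans (sym (αα y)) (cong α e))
      off-α {y} (inj₂ e) = inj₁ (α-inj e)

      st′-α : ∀ y → st′ (α y) ≡ st′ y
      st′-α y = go (on? (α y)) (off? (α y))
        where
        go : Dec (α y ≡ b ⊎ α y ≡ w) → Dec (α y ≡ x ⊎ α y ≡ o) → st′ (α y) ≡ st′ y
        go (yes p) _ = trans (st′-on p) (sym (st′-on (on-α p)))
        go (no _) (yes q) = trans (st′-off q) (sym (st′-off (off-α q)))
        go (no p) (no q) = trans (st′-else p q) (trans (st-α y) (sym (st′-else
          (λ r → p (on-α (subst (λ z → z ≡ b ⊎ z ≡ w) (sym (αα y)) r)))
          (λ r → q (off-α (subst (λ z → z ≡ x ⊎ z ≡ o) (sym (αα y)) r))))))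

      white-st′ : ∀ {v} → col v ≡ white → st′ v ≡ true → v ≡ w ⊎ (st v ≡ true × v ≢ x)
      white-st′ {v} c s = go (on? v) (off? v)
        where
        go : Dec (v ≡ b ⊎ v ≡ w) → Dec (v ≡ x ⊎ v ≡ o) → v ≡ w ⊎ (st v ≡ true × v ≢ x)
        go (yes (inj₁ e)) _ = contradiction (sym e) (differ-col cb c)
        go (yes (inj₂ e)) _ = inj₁ e
        go (no _) (yes q) = case trans (sym s) (st′-off q) of λ ()
        go (no p) (no q) = inj₂ (trans (sym (st′-else p q)) s , q ∘ inj₁)

      flipped : Cut
      flipped = record { st = st′ ; st-α = st′-α ; tight = tight′ ; exist = exist′ ; one = one′ }
        where
        tight′ : ∀ {v} → col v ≡ white → st′ v ≡ true → ℓ v ≡ suc (ℓ (α v))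
        tight′ c s with white-st′ c s
        ... | inj₁ refl = trans ℓw (cong (suc ∘ ℓ) (sym αw))
        ... | inj₂ (s′ , _) = tight c s′
        exist′ : ∀ y → ℓ y ≢ 0 → ∃ λ v → Orb φ y v × col v ≡ white × st′ v ≡ true
        exist′ y ne with exist y ne
        ... | v , ov , cv , sv with v ≟ x
        ...   | yes refl = w , orb-trans ov (orb-sym φ-inj wx) , cw , st′-on (inj₂ refl)
        ...   | no v≢x = v , ov , cv , trans (st′-else
                  (λ { (inj₁ refl) → differ-col cb cv refl ; (inj₂ refl) → case trans (sym sv) sw of λ () })
                  (λ { (inj₁ e) → v≢x e ; (inj₂ refl) → differ-col co cv refl })) sv
        one′ : ∀ {u v} → col u ≡ white → st′ u ≡ true → col v ≡ white → st′ v ≡ true → Orb φ u v → u ≡ v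
        one′ cu su cv sv uv with white-st′ cu su | white-st′ cv sv
        ... | inj₁ refl | inj₁ refl = refl
        ... | inj₁ refl | inj₂ (s , ne) = contradiction (one cv s cx sx (orb-trans (orb-sym φ-inj uv) wx)) ne
        ... | inj₂ (s , ne) | inj₁ refl = contradiction (one cu s cx sx (orb-trans uv wx)) ne
        ... | inj₂ (s , _) | inj₂ (s′ , _) = one cu s cv s′ uv

      o∈stk-w : o ∈ stk w
      o∈stk-w = subst (o ∈_) (sym (trans (stk-orb wx) (stk-white sx cx))) (here refl)

      -- `o` and `b` lie at the same height, whereas an entry of a stack lies strictly lower than
      -- the corner it encloses.
      o∉stk-b : o ∉ stk b
      o∉stk-b m = <-irrefl ℓo≡ℓb (subst₂ _<_ (length-stkFrom _ o) (length-stkFrom _ b) (∈⇒shorter m))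
        where
        ℓo≡ℓb : ℓ o ≡ ℓ b
        ℓo≡ℓb = suc-injective (trans (sym (tight cx sx)) (trans (sym (ℓ-orb wx)) ℓw))

      -- `o` is not open at `b` but is open at `w`, so it is opened between them. Of the four
      -- half-edges that change their status, the first one passed is therefore `b` or `x`.
      b<o : pos b < pos o
      b<o = ≤∧≢⇒< (proj₁ (push-pos {o} {b} {w} (<⇒≤ b<w) o∉stk-b o∈stk-w)) (λ e → o≢b (sym (pos-inj e)))

      unchanged : ∀ {y} → pos y < pos b → pos y < pos x → st y ≡ st′ y
      unchanged {y} yb yx = sym (st′-else
        (λ { (inj₁ refl) → <-irrefl refl yb ; (inj₂ refl) → <-asym yb b<w })
        (λ { (inj₁ refl) → <-irrefl refl yx ; (inj₂ refl) → <-asym yb b<o }))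

  -- The bit is 0 where the contour prefers the kind of half-edge that it sees: stems at black ends, tree edges at white ends.
  bit : Color → Bool → ℕ
  bit black true = 0
  bit black false = 1
  bit white true = 1
  bit white false = 0

  bit≤1 : ∀ c s → bit c s ≤ 1
  bit≤1 black true = z≤n
  bit≤1 black false = ≤-refl
  bit≤1 white true = ≤-refl
  bit≤1 white false = z≤n

  module Code (st : Fin size → Bool) where
    open Contour M st using (τ)

    -- The lexicographic order as binary notation, the first half-edge giving the leading digit.
    -- Beyond the first change the two contours run apart, which does no harm since a leading digit
    -- outweighs all later ones together.
    code : ℕ → Fin size → ℕ
    code zero y = 0
    code (suc k) y = bit (col y) (st y) * 2 ^ k + code k (τ y)

    code< : ∀ k y → code k y < 2 ^ k
    code< zero y = s≤s z≤n
    code< (suc k) y = begin-strict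
      bit (col y) (st y) * 2 ^ k + code k (τ y) <⟨ +-monoʳ-< _ (code< k (τ y)) ⟩
      bit (col y) (st y) * 2 ^ k + 2 ^ k ≤⟨ +-monoˡ-≤ (2 ^ k) (*-monoˡ-≤ (2 ^ k) (bit≤1 (col y) (st y))) ⟩
      1 * 2 ^ k + 2 ^ k ≡⟨ lemma (2 ^ k) ⟩
      2 ^ suc k ∎
      where
      open ≤-Reasoning
      lemma : ∀ a → 1 * a + a ≡ 2 * a
      lemma = solve-∀

  code-decreases : ∀ st st′ j k y → j < k →
    (∀ i → i < j → st (iter (Contour.τ M st) i y) ≡ st′ (iter (Contour.τ M st) i y)) →
    (let z = iter (Contour.τ M st) j y in bit (col z) (st z) ≡ 1 × bit (col z) (st′ z) ≡ 0) →
    Code.code st′ k y < Code.code st k y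
  code-decreases st st′ zero (suc k) y lt h (p , q) = begin-strict
    bit (col y) (st′ y) * 2 ^ k + Code.code st′ k (Contour.τ M st′ y) ≡⟨ cong (λ b → b * 2 ^ k + Code.code st′ k (Contour.τ M st′ y)) q ⟩
    Code.code st′ k (Contour.τ M st′ y) <⟨ Code.code< st′ k _ ⟩
    2 ^ k ≡⟨ sym (*-identityˡ (2 ^ k)) ⟩
    1 * 2 ^ k ≤⟨ m≤m+n (1 * 2 ^ k) _ ⟩
    1 * 2 ^ k + Code.code st k (Contour.τ M st y) ≡⟨ cong (λ b → b * 2 ^ k + Code.code st k (Contour.τ M st y)) (sym p) ⟩
    bit (col y) (st y) * 2 ^ k + Code.code st k (Contour.τ M st y) ∎
    where open ≤-Reasoning
  code-decreases st st′ (suc j) (suc k) y (s≤s lt) h pq = begin-strict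
    bit (col y) (st′ y) * 2 ^ k + Code.code st′ k (Contour.τ M st′ y) ≡⟨ cong₂ (λ s z → bit (col y) s * 2 ^ k + Code.code st′ k z) (sym same) τ-same ⟩
    bit (col y) (st y) * 2 ^ k + Code.code st′ k (τ y) <⟨ +-monoʳ-< (bit (col y) (st y) * 2 ^ k) (code-decreases st st′ j k (τ y) lt
        (λ i lt → subst (λ z → st z ≡ st′ z) (sym (iter-suc τ i y)) (h (suc i) (s≤s lt)))
        (subst (λ z → bit (col z) (st z) ≡ 1 × bit (col z) (st′ z) ≡ 0) (sym (iter-suc τ j y)) pq)) ⟩
    bit (col y) (st y) * 2 ^ k + Code.code st k (τ y) ∎
    where
    open ≤-Reasoning
    open Contour M st using (τ)
    same : st y ≡ st′ y
    same = h 0 (s≤s z≤n)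
    τ-same : Contour.τ M st′ y ≡ τ y
    τ-same = cong (λ s → σ (if s then y else α y)) (sym same)

  measure : Cut → ℕ
  measure C = Code.code (Cut.st C) size root

  module _ (C : Cut) where
    open Cut C
    open FromCut C
    open Enum enum

    flip-decreases : ∀ {b} (bad : Bad b) → measure (Flip.flipped bad) < measure C
    flip-decreases {b} bad = go (<-cmp (pos b) (pos x))
      where
      x = Flip.x bad
      go : Tri (pos b < pos x) (pos b ≡ pos x) (pos x < pos b) → measure (Flip.flipped bad) < measure C
      -- At the black `b` a tree edge becomes a stem; in the last case a stem becomes a tree edge at
      -- the white `x`. Either way the bit falls from 1 to 0.
      go (tri< b<x _ _) = code-decreases st (Flip.st′ bad) (pos b) size root (pos< b)
            (λ i i< → let e = pos-iter (<-trans i< (pos< b)) in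
              Flip.unchanged bad (subst (_< pos b) (sym e) i<) (subst (_< pos (Flip.x bad)) (sym e) (<-trans i< b<x)))
            (subst (λ z → bit (col z) (st z) ≡ 1 × bit (col z) (Flip.st′ bad z) ≡ 0) (sym (iter-pos b))
              (cong₂ bit (Flip.cb bad) (Flip.sb bad) , cong₂ bit (Flip.cb bad) (Flip.st′-on bad (inj₁ refl))))
      go (tri≈ _ e _) = contradiction (pos-inj e) (Flip.differ-col bad (Flip.cb bad) (Flip.cx bad))
      go (tri> _ _ x<b) = code-decreases st (Flip.st′ bad) (pos x) size root (pos< x)
            (λ i i< → let e = pos-iter (<-trans i< (pos< x)) in
              Flip.unchanged bad (subst (_< pos b) (sym e) (<-trans i< x<b)) (subst (_< pos x) (sym e) i<))
            (subst (λ z → bit (col z) (st z) ≡ 1 × bit (col z) (Flip.st′ bad z) ≡ 0) (sym (iter-pos x))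
              (cong₂ bit (Flip.cx bad) (Flip.sx bad) , cong₂ bit (Flip.cx bad) (Flip.st′-off bad (inj₁ refl))))

  GoodCut : Set
  GoodCut = ∃ λ C → Good M (FromCut.opened C) (FromCut.enum C)

  descend : ∀ m C → measure C ≡ m → GoodCut
  descend = <-rec (λ m → ∀ C → measure C ≡ m → GoodCut) step
    where
    step : ∀ m → (∀ {k} → k < m → ∀ C → measure C ≡ k → GoodCut) → ∀ C → measure C ≡ m → GoodCut
    step m rec C e = go (any? (FromCut.bad? C))
      where
      go : Dec (∃ (FromCut.Bad C)) → GoodCut
      go (yes (b , bad)) = rec (subst (_ <_) e (flip-decreases C bad)) (FromCut.Flip.flipped C bad) refl
      go (no ¬bad) = C , FromCut.no-bad⇒good C λ b bad → ¬bad (b , bad)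

  good-opening : ∃ λ O → ∃ λ E → Good M O E
  good-opening = let (C , g) = descend _ InitialCut.initial refl in FromCut.opened C , FromCut.enum C , g

-- Contour words

-- `dn` and `up` stand for the first and the second passage of a tree edge.
data Letter : Set where
  opn cls dn up : Letter

word : List Item → List Letter
word [] = []
word (opening ∷ is) = opn ∷ word is
word (closing ∷ is) = cls ∷ word is
word (child (node js) ∷ is) = dn ∷ (word js ++ (up ∷ word is))

-- Letters beyond the end of the word read as up, the letter that ends a list of items.
at : List Letter → ℕ → Letter
at [] _ = up
at (l ∷ w) zero = l
at (l ∷ w) (suc j) = at w j

-- The contour labels p, p + 1, …, q - 1 spell the items; m is the tree mate of a label, and m x = x for a stem.
data Reads (ty : ℕ → Letter) (m : ℕ → ℕ) : ℕ → List Item → ℕ → Set where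
  done   : ∀ {p} → Reads ty m p [] p
  open′  : ∀ {p is q} → ty p ≡ opn → m p ≡ p → Reads ty m (suc p) is q → Reads ty m p (opening ∷ is) q
  close′ : ∀ {p is q} → ty p ≡ cls → m p ≡ p → Reads ty m (suc p) is q → Reads ty m p (closing ∷ is) q
  branch : ∀ {p js u is q} → ty p ≡ dn → m p ≡ u → Reads ty m (suc p) js u → ty u ≡ up → m u ≡ p →
           Reads ty m (suc u) is q → Reads ty m p (child (node js) ∷ is) q

Stem : Letter → Set
Stem l = l ≡ opn ⊎ l ≡ cls

TreeL : Letter → Set
TreeL l = l ≡ dn ⊎ l ≡ up

module _ {ty : ℕ → Letter} {m : ℕ → ℕ} where

  reads-≤ : ∀ {p is q} → Reads ty m p is q → p ≤ q
  reads-≤ done = ≤-refl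
  reads-≤ (open′ _ _ r) = ≤-trans (n≤1+n _) (reads-≤ r)
  reads-≤ (close′ _ _ r) = ≤-trans (n≤1+n _) (reads-≤ r)
  reads-≤ (branch _ _ r _ _ r′) = ≤-trans (n≤1+n _) (≤-trans (reads-≤ r) (≤-trans (n≤1+n _) (reads-≤ r′)))

  reads-next : ∀ {p is q} c → Reads ty m p is q → Out.next (walkItems c is p) ≡ q
  reads-next c done = refl
  reads-next c (open′ _ _ r) = reads-next c r
  reads-next c (close′ _ _ r) = reads-next c r
  reads-next c (branch _ _ r _ _ r′) with refl ← reads-next (flipC c) r = reads-next c r′

  reads-spell : ∀ {p is q} → Reads ty m p is q → ∀ i → p + i < q → at (word is) i ≡ ty (p + i)
  reads-length : ∀ {p is q} → Reads ty m p is q → p + length (word is) ≡ q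
  reads-length done = +-identityʳ _
  reads-length (open′ _ _ r) = trans (+-suc _ _) (reads-length r)
  reads-length (close′ _ _ r) = trans (+-suc _ _) (reads-length r)
  reads-length {p} (branch {js = js} {u} {is} _ _ r _ _ r′) = begin
    p + suc (length (word js ++ (up ∷ word is))) ≡⟨ +-suc p _ ⟩
    suc p + length (word js ++ (up ∷ word is)) ≡⟨ cong (suc p +_) (length-++ (word js)) ⟩
    suc p + (length (word js) + suc (length (word is))) ≡⟨ sym (+-assoc (suc p) (length (word js)) _) ⟩
    suc p + length (word js) + suc (length (word is)) ≡⟨ cong (_+ suc (length (word is))) (reads-length r) ⟩
    u + suc (length (word is)) ≡⟨ +-suc u _ ⟩
    suc u + length (word is) ≡⟨ reads-length r′ ⟩
    _ ∎
    where open ≡-Reasoning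

  reads-spell {p} done i lt = contradiction lt (≤⇒≯ (m≤m+n p i))
  reads-spell {p} (open′ t _ r) zero lt = sym (trans (cong ty (+-identityʳ p)) t)
  reads-spell {p} {q = q} (open′ t _ r) (suc i) lt = trans (reads-spell r i (subst (_< q) (+-suc p i) lt)) (cong ty (sym (+-suc p i)))
  reads-spell {p} (close′ t _ r) zero lt = sym (trans (cong ty (+-identityʳ p)) t)
  reads-spell {p} {q = q} (close′ t _ r) (suc i) lt = trans (reads-spell r i (subst (_< q) (+-suc p i) lt)) (cong ty (sym (+-suc p i)))
  reads-spell {p} (branch t _ r _ _ r′) zero lt = sym (trans (cong ty (+-identityʳ p)) t)
  reads-spell {p} {q = q} (branch {js = js} {u} {is} t _ r t′ _ r′) (suc i) lt with i <? length (word js)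
  ... | yes i< = trans (at-++ˡ (word js) i<) (trans (reads-spell r i (subst (suc p + i <_) (reads-length r) (+-monoʳ-< (suc p) i<)))
          (cong ty (sym (+-suc p i))))
    where
    at-++ˡ : ∀ w {w′ i} → i < length w → at (w ++ w′) i ≡ at w i
    at-++ˡ (l ∷ w) {i = zero} lt = refl
    at-++ˡ (l ∷ w) {i = suc i} (s≤s lt) = at-++ˡ w lt
  ... | no i≮ with i ∸ length (word js) | m+[n∸m]≡n (≮⇒≥ i≮)
  ...   | k | refl = trans (at-++ʳ (word js) k) (trans (rest k (subst (_< q) pos≡ lt)) (cong ty (sym pos≡)))
    where
    at-++ʳ : ∀ w {w′} k → at (w ++ w′) (length w + k) ≡ at w′ k
    at-++ʳ [] k = refl
    at-++ʳ (l ∷ w) k = at-++ʳ w k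
    pos≡ : p + suc (length (word js) + k) ≡ u + k
    pos≡ = trans (+-suc p _) (trans (sym (+-assoc (suc p) (length (word js)) k)) (cong (_+ k) (reads-length r)))
    rest : ∀ k → u + k < q → at (up ∷ word is) k ≡ ty (u + k)
    rest zero lt = sym (trans (cong ty (+-identityʳ u)) t′)
    rest (suc k) lt = trans (reads-spell r′ k (subst (_< q) (+-suc u k) lt)) (cong ty (sym (+-suc u k)))

  -- Inversion of `Reads` at a single label, together with the part of the reading enclosed by its
  -- tree edge. Later arguments about one label then need no induction on the tree.
  data At (q x : ℕ) : Set where
    stem  : Stem (ty x) → m x ≡ x → At q x
    down  : ∀ js → ty x ≡ dn → Reads ty m (suc x) js (m x) → ty (m x) ≡ up → m (m x) ≡ x → m x < q → At q x
    upward : ∀ js → ty x ≡ up → Reads ty m (suc (m x)) js x → ty (m x) ≡ dn → m (m x) ≡ x → At q x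

  at-weaken : ∀ {q q′ x} → q ≤ q′ → At q x → At q′ x
  at-weaken le (stem a b) = stem a b
  at-weaken le (down js a b c d lt) = down js a b c d (<-≤-trans lt le)
  at-weaken le (upward js a b c d) = upward js a b c d

  reads-at : ∀ {p is q} → Reads ty m p is q → ∀ x → p ≤ x → x < q → At q x
  reads-at done x p≤x x<q = contradiction x<q (≤⇒≯ p≤x)
  reads-at {p} (open′ t e r) x p≤x x<q with p ℕP.≟ x
  ... | yes refl = stem (inj₁ t) e
  ... | no ne = reads-at r x (≤∧≢⇒< p≤x ne) x<q
  reads-at {p} (close′ t e r) x p≤x x<q with p ℕP.≟ x
  ... | yes refl = stem (inj₂ t) e
  ... | no ne = reads-at r x (≤∧≢⇒< p≤x ne) x<q
  reads-at {p} (branch {js = js} {u} t refl r t′ e′ r′) x p≤x x<q with p ℕP.≟ x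
  ... | yes refl = down js t r t′ e′ (reads-≤ r′)
  ... | no ne with <-cmp x u
  ...   | tri< lt _ _ = at-weaken (≤-trans (n≤1+n _) (reads-≤ r′)) (reads-at r x (≤∧≢⇒< p≤x ne) lt)
  ...   | tri≈ _ refl _ = upward js t′ (subst (λ z → Reads ty m (suc z) js (m p)) (sym e′) r)
                            (trans (cong ty e′) t) (cong m e′)
  ...   | tri> _ _ gt = reads-at r′ x gt x<q

-- The letters alone determine the items: each letter selects the constructor, and `up` ends a list.
reads-unique : ∀ {ty m m′ p is is′ q q′} → Reads ty m p is q → ty q ≡ up → Reads ty m′ p is′ q′ → ty q′ ≡ up →
  is ≡ is′ × q ≡ q′
reads-unique done t done t′ = refl , refl
reads-unique done t (open′ a _ _) t′ = case trans (sym t) a of λ ()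
reads-unique done t (close′ a _ _) t′ = case trans (sym t) a of λ ()
reads-unique done t (branch a _ _ _ _ _) t′ = case trans (sym t) a of λ ()
reads-unique (open′ a _ r) t done t′ = case trans (sym t′) a of λ ()
reads-unique (open′ a _ r) t (open′ _ _ r′) t′ with reads-unique r t r′ t′
... | refl , e = refl , e
reads-unique (open′ a _ r) t (close′ b _ r′) t′ = case trans (sym a) b of λ ()
reads-unique (open′ a _ r) t (branch b _ _ _ _ _) t′ = case trans (sym a) b of λ ()
reads-unique (close′ a _ r) t done t′ = case trans (sym t′) a of λ ()
reads-unique (close′ a _ r) t (open′ b _ r′) t′ = case trans (sym a) b of λ ()
reads-unique (close′ a _ r) t (close′ b _ r′) t′ with reads-unique r t r′ t′
... | refl , e = refl , e
reads-unique (close′ a _ r) t (branch b _ _ _ _ _) t′ = case trans (sym a) b of λ ()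
reads-unique (branch a _ _ _ _ _) t done t′ = case trans (sym t′) a of λ ()
reads-unique (branch a _ _ _ _ _) t (open′ b _ _) t′ = case trans (sym a) b of λ ()
reads-unique (branch a _ _ _ _ _) t (close′ b _ _) t′ = case trans (sym a) b of λ ()
reads-unique (branch a _ r b _ s) t (branch a′ _ r′ b′ _ s′) t′ with reads-unique r b r′ b′
... | refl , refl with reads-unique s t s′ t′
...   | refl , e = refl , e

reads-cong : ∀ {ty ty′ m p is q} → (∀ x → x < q → ty x ≡ ty′ x) → Reads ty m p is q → Reads ty′ m p is q
reads-cong h done = done
reads-cong h (open′ a b r) = open′ (trans (sym (h _ (reads-≤ r))) a) b (reads-cong h r)
reads-cong h (close′ a b r) = close′ (trans (sym (h _ (reads-≤ r))) a) b (reads-cong h r)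
reads-cong h (branch a b r c d s) = branch (trans (sym (h _ (<-≤-trans (reads-≤ r) (≤-trans (n≤1+n _) (reads-≤ s))))) a) b
  (reads-cong (λ x lt → h x (<-≤-trans lt (≤-trans (n≤1+n _) (reads-≤ s)))) r)
  (trans (sym (h _ (reads-≤ s))) c) d (reads-cong h s)

Readable : (ℕ → Letter) → ℕ → List Letter → Set
Readable ty p [] = ⊤
Readable ty p (l ∷ w) = ty p ≡ l × Readable ty (suc p) w

readable-++ : ∀ {ty} p w {w′} → Readable ty p (w ++ w′) → Readable ty p w × Readable ty (p + length w) w′
readable-++ {ty} p [] {w′} r = tt , subst (λ z → Readable ty z w′) (sym (+-identityʳ p)) r
readable-++ {ty} p (l ∷ w) {w′} (e , r) with readable-++ (suc p) w r
... | a , b = (e , a) , subst (λ z → Readable ty z w′) (sym (+-suc p (length w))) b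

readable-at : ∀ w ty p → (∀ i → ty (p + i) ≡ at w i) → Readable ty p w
readable-at [] ty p h = tt
readable-at (l ∷ w) ty p h = trans (cong ty (sym (+-identityʳ p))) (h 0) ,
  readable-at w ty (suc p) (λ i → trans (cong ty (sym (+-suc p i))) (h (suc i)))

mate : List Item → ℕ → ℕ → ℕ
mate [] p x = x
mate (opening ∷ is) p x = mate is (suc p) x
mate (closing ∷ is) p x = mate is (suc p) x
mate (child (node js) ∷ is) p x with suc p + length (word js)
... | u = if x ≡ᵇ p then u else if x ≡ᵇ u then p else if x <ᵇ u then mate js (suc p) x else mate is (suc u) x

mate-below : ∀ is p {x} → x < p → mate is p x ≡ x
mate-below [] p lt = refl
mate-below (opening ∷ is) p lt = mate-below is (suc p) (<-trans lt (n<1+n p))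
mate-below (closing ∷ is) p lt = mate-below is (suc p) (<-trans lt (n<1+n p))
mate-below (child (node js) ∷ is) p {x} lt with x ≡ᵇ p in e₁
... | true = contradiction (≡ᵇ⇒≡ x p (Equivalence.from T-≡ e₁)) (<⇒≢ lt)
... | false with x ≡ᵇ (suc p + length (word js)) in e₂
...   | true = contradiction (≡ᵇ⇒≡ x _ (Equivalence.from T-≡ e₂)) (<⇒≢ (<-≤-trans lt (≤-trans (n≤1+n p) (m≤m+n (suc p) _))))
...   | false with x <ᵇ (suc p + length (word js)) in e₃
...     | true = mate-below js (suc p) (<-trans lt (n<1+n p))
...     | false = contradiction (Equivalence.to T-≡ (<⇒<ᵇ (<-≤-trans lt (≤-trans (n≤1+n p) (m≤m+n (suc p) (length (word js))))))) λ e → case trans (sym e) e₃ of λ ()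

≡ᵇ-refl : ∀ x → (x ≡ᵇ x) ≡ true
≡ᵇ-refl x = Equivalence.to T-≡ (≡⇒≡ᵇ x x refl)

≡ᵇ-≢ : ∀ {x y} → x ≢ y → (x ≡ᵇ y) ≡ false
≡ᵇ-≢ {x} {y} ne with x ≡ᵇ y in e
... | true = contradiction (≡ᵇ⇒≡ x y (Equivalence.from T-≡ e)) ne
... | false = refl

<ᵇ-true : ∀ {x y} → x < y → (x <ᵇ y) ≡ true
<ᵇ-true lt = Equivalence.to T-≡ (<⇒<ᵇ lt)

<ᵇ-false : ∀ {x y} → ¬ x < y → (x <ᵇ y) ≡ false
<ᵇ-false {x} {y} nl with x <ᵇ y in e
... | true = contradiction (<ᵇ⇒< x y (Equivalence.from T-≡ e)) nl
... | false = refl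

readable⇒reads : ∀ {ty m} is p → Readable ty p (word is) →
  (∀ x → p ≤ x → x < p + length (word is) → m x ≡ mate is p x) → Reads ty m p is (p + length (word is))
readable⇒reads {ty} {m} [] p r h = subst (Reads ty m p []) (sym (+-identityʳ p)) done
readable⇒reads {ty} {m} (opening ∷ is) p (t , r) h rewrite +-suc p (length (word is)) =
  open′ t (trans (h p ≤-refl (s≤s (m≤m+n p _))) (mate-below is (suc p) ≤-refl))
    (readable⇒reads is (suc p) r λ x a b → h x (≤-trans (n≤1+n p) a) b)
readable⇒reads {ty} {m} (closing ∷ is) p (t , r) h rewrite +-suc p (length (word is)) =
  close′ t (trans (h p ≤-refl (s≤s (m≤m+n p _))) (mate-below is (suc p) ≤-refl))
    (readable⇒reads is (suc p) r λ x a b → h x (≤-trans (n≤1+n p) a) b)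
readable⇒reads {ty} {m} (child (node js) ∷ is) p (t , r) h with readable-++ (suc p) (word js) r
... | rj , t′ , ri = subst (Reads ty m p (child (node js) ∷ is)) (sym end≡)
    (branch t at-p (readable⇒reads js (suc p) rj inside) t′ at-u (readable⇒reads is (suc u) ri outside))
  where
  u = suc p + length (word js)
  end≡ : p + suc (length (word js ++ (up ∷ word is))) ≡ suc u + length (word is)
  end≡ = trans (+-suc p _) (trans (cong (suc p +_) (length-++ (word js))) (trans (sym (+-assoc (suc p) (length (word js)) _)) (+-suc u _)))
  p<u : p < u
  p<u = m≤m+n (suc p) _
  u< : u < suc u + length (word is)
  u< = m≤m+n (suc u) _
  get : ∀ x → p ≤ x → x < suc u + length (word is) → m x ≡ mate (child (node js) ∷ is) p x
  get x a b = h x a (subst (x <_) (sym end≡) b)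
  at-p : m p ≡ u
  at-p = trans (get p ≤-refl (<-trans p<u u<)) lem
    where lem : mate (child (node js) ∷ is) p p ≡ u
          lem rewrite ≡ᵇ-refl p = refl
  at-u : m u ≡ p
  at-u = trans (get u (<⇒≤ p<u) u<) lem
    where lem : mate (child (node js) ∷ is) p u ≡ p
          lem rewrite ≡ᵇ-≢ (<⇒≢ p<u ∘ sym) | ≡ᵇ-refl u = refl
  inside : ∀ x → suc p ≤ x → x < u → m x ≡ mate js (suc p) x
  inside x a b = trans (get x (<⇒≤ a) (<-trans b u<)) lem
    where lem : mate (child (node js) ∷ is) p x ≡ mate js (suc p) x
          lem rewrite ≡ᵇ-≢ (<⇒≢ a ∘ sym) | ≡ᵇ-≢ (<⇒≢ b) | <ᵇ-true b = refl
  outside : ∀ x → suc u ≤ x → x < suc u + length (word is) → m x ≡ mate is (suc u) x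
  outside x a b = trans (get x (<⇒≤ (<-trans p<u a)) b) lem
    where lem : mate (child (node js) ∷ is) p x ≡ mate is (suc u) x
          lem rewrite ≡ᵇ-≢ (<⇒≢ (<-trans p<u a) ∘ sym) | ≡ᵇ-≢ (<⇒≢ a ∘ sym) | <ᵇ-false (<⇒≯ a) = refl

-- A tree reads its own word. The contour of a map is read in the same form, so one construction of
-- the closure serves both directions of the bijection.
items-read : ∀ is → Reads (at (word is)) (mate is 0) 0 is (length (word is))
items-read is = readable⇒reads is 0 (readable-at (word is) (at (word is)) 0 (λ _ → refl)) (λ _ _ _ → refl)

at-end : ∀ w → at w (length w) ≡ up
at-end [] = refl
at-end (l ∷ w) = at-end w

-- Charges, colours and stacks along the contour

ℤ-cancelʳ-≤ : ∀ z x y → x ℤ.+ z ℤ.≤ y ℤ.+ z → x ℤ.≤ y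
ℤ-cancelʳ-≤ z x y le = subst₂ ℤ._≤_ (back x) (back y) (ℤP.+-monoˡ-≤ (ℤ.- z) le)
  where
  back : ∀ w → (w ℤ.+ z) ℤ.+ ℤ.- z ≡ w
  back w = trans (ℤP.+-assoc w z (ℤ.- z)) (trans (cong (λ v → w ℤ.+ v) (ℤP.+-inverseʳ z)) (ℤP.+-identityʳ w))

gain : Letter → ℤ
gain opn = -[1+ 0 ]
gain cls = ℤ.+ 1
gain dn = ℤ.+ 0
gain up = ℤ.+ 0

stepC : Letter → Color → Color
stepC opn c = c
stepC cls c = c
stepC dn c = flipC c
stepC up c = flipC c

colorAt : (ℕ → Letter) → Color → ℕ → Color
colorAt ty c zero = c
colorAt ty c (suc j) = stepC (ty j) (colorAt ty c j)

module _ {ty : ℕ → Letter} {m : ℕ → ℕ} where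

  -- `f` is a height that falls by `gain` at each letter, so the charge of a stretch of the contour
  -- is its total fall. Tree letters have gain 0, which lets the sum run through subtrees.
  charge-telescopes : (f : ℕ → ℤ) → ∀ {p is q} → Reads ty m p is q →
    (∀ j → j < q → gain (ty j) ℤ.+ f (suc j) ≡ f j) → chargeItems is ℤ.+ f q ≡ f p
  charge-telescopes f done h = ℤP.+-identityˡ _
  charge-telescopes f {p} (open′ {is = is} {q} t _ r) h = begin
    (-[1+ 0 ] ℤ.+ chargeItems is) ℤ.+ f q ≡⟨ ℤP.+-assoc -[1+ 0 ] (chargeItems is) (f q) ⟩
    -[1+ 0 ] ℤ.+ (chargeItems is ℤ.+ f q) ≡⟨ cong₂ ℤ._+_ (cong gain (sym t)) (charge-telescopes f r h) ⟩
    gain (ty p) ℤ.+ f (suc p) ≡⟨ h p (reads-≤ r) ⟩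
    f p ∎
    where open ≡-Reasoning
  charge-telescopes f {p} (close′ {is = is} {q} t _ r) h = begin
    (ℤ.+ 1 ℤ.+ chargeItems is) ℤ.+ f q ≡⟨ ℤP.+-assoc (ℤ.+ 1) (chargeItems is) (f q) ⟩
    ℤ.+ 1 ℤ.+ (chargeItems is ℤ.+ f q) ≡⟨ cong₂ ℤ._+_ (cong gain (sym t)) (charge-telescopes f r h) ⟩
    gain (ty p) ℤ.+ f (suc p) ≡⟨ h p (reads-≤ r) ⟩
    f p ∎
    where open ≡-Reasoning
  charge-telescopes f {p} (branch {js = js} {u} {is} {q} t _ r t′ _ r′) h = begin
    (chargeItems js ℤ.+ chargeItems is) ℤ.+ f q ≡⟨ ℤP.+-assoc (chargeItems js) (chargeItems is) (f q) ⟩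
    chargeItems js ℤ.+ (chargeItems is ℤ.+ f q) ≡⟨ cong (λ z → chargeItems js ℤ.+ z) (charge-telescopes f r′ h) ⟩
    chargeItems js ℤ.+ f (suc u) ≡⟨ cong (λ z → chargeItems js ℤ.+ z) (skip u t′ (reads-≤ r′)) ⟩
    chargeItems js ℤ.+ f u ≡⟨ charge-telescopes f r (λ j lt → h j (<-≤-trans lt (≤-trans (n≤1+n u) (reads-≤ r′)))) ⟩
    f (suc p) ≡⟨ sym (ℤP.+-identityˡ _) ⟩
    ℤ.+ 0 ℤ.+ f (suc p) ≡⟨ cong (λ l → gain l ℤ.+ f (suc p)) (sym t) ⟩
    gain (ty p) ℤ.+ f (suc p) ≡⟨ h p (<-≤-trans (reads-≤ r) (≤-trans (n≤1+n u) (reads-≤ r′))) ⟩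
    f p ∎
    where
    open ≡-Reasoning
    skip : ∀ u → ty u ≡ up → u < q → f (suc u) ≡ f u
    skip u e lt = trans (sym (ℤP.+-identityˡ _)) (trans (cong (λ l → gain l ℤ.+ f (suc u)) (sym e)) (h u lt))

  module _ (c : Color) where
    private
      cw = colorAt ty c

    reads-color : ∀ {p is q} → Reads ty m p is q → cw q ≡ cw p
    reads-color done = refl
    reads-color {p} (open′ t _ r) = trans (reads-color r) (cong (λ l → stepC l (cw p)) t)
    reads-color {p} (close′ t _ r) = trans (reads-color r) (cong (λ l → stepC l (cw p)) t)
    reads-color {p} (branch {u = u} t _ r t′ _ r′) = begin
      _ ≡⟨ reads-color r′ ⟩
      stepC (ty u) (cw u) ≡⟨ cong₂ stepC t′ (trans (reads-color r) (cong (λ l → stepC l (cw p)) t)) ⟩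
      flipC (flipC (cw p)) ≡⟨ flipC-flipC (cw p) ⟩
      cw p ∎
      where open ≡-Reasoning

    color-dn : ∀ {p} → ty p ≡ dn → cw (suc p) ≡ flipC (cw p)
    color-dn {p} t = cong (λ l → stepC l (cw p)) t

    color-up : ∀ {u} → ty u ≡ up → cw (suc u) ≡ flipC (cw u)
    color-up {u} t = cong (λ l → stepC l (cw u)) t

    color-stem : ∀ {x} → Stem (ty x) → cw (suc x) ≡ cw x
    color-stem {x} (inj₁ t) = cong (λ l → stepC l (cw x)) t
    color-stem {x} (inj₂ t) = cong (λ l → stepC l (cw x)) t

    color-past : ∀ {p js u is q} → ty p ≡ dn → Reads ty m (suc p) js u → ty u ≡ up → Reads ty m (suc u) is q → cw (suc u) ≡ cw p
    color-past {p} t r t′ r′ = trans (color-up t′) (trans (cong flipC (trans (reads-color r) (color-dn t))) (flipC-flipC _))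

    module _ (L : ℕ → ℕ) where

      -- The conditions of well-chargedness at a single label, with L j the number of open stems before j.
      Local : ℕ → Set
      Local x = (ty x ≡ opn → cw x ≡ black) × (ty x ≡ cls → cw x ≡ white) ×
        (ty x ≡ dn → (cw x ≡ white → L x ≤ suc (L (m x))) × (cw x ≡ black → L (m x) ≤ L x))

      Steps : ℕ → Set
      Steps q = ∀ j → j < q → gain (ty j) ℤ.+ ℤ.+ L (suc j) ≡ ℤ.+ L j

      private
        child-charge : ∀ {p js u} → ty p ≡ dn → Reads ty m (suc p) js u → (∀ j → j < suc u → gain (ty j) ℤ.+ ℤ.+ L (suc j) ≡ ℤ.+ L j) →
          chargeItems js ℤ.+ ℤ.+ L u ≡ ℤ.+ L p
        child-charge {p} t r h = trans (charge-telescopes (λ j → ℤ.+ L j) r (λ j lt → h j (<-trans lt (n<1+n _))))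
          (trans (sym (ℤP.+-identityˡ _)) (trans (cong (λ l → gain l ℤ.+ ℤ.+ L (suc p)) (sym t)) (h p (≤-trans (reads-≤ r) (n≤1+n _)))))

        WCNonRoot⇒ : ∀ c {js} → WCNonRoot c (node js) → WCItems c js
        WCNonRoot⇒ black (_ , w) = w
        WCNonRoot⇒ white (_ , w) = w

      -- By `child-charge` the charge of the subtree behind a tree edge first passed at `x` is `L x`
      -- minus `L (m x)`. Bounds on charges thus become inequalities between the heights on the two
      -- sides of the edge.
      wc⇒local : ∀ {p is q} → Reads ty m p is q → Steps q → WCItems (cw p) is → ∀ x → p ≤ x → x < q → Local x
      wc⇒local done st w x p≤x x<q = contradiction x<q (≤⇒≯ p≤x)
      wc⇒local {p} (open′ {is = is} t e r) st w x p≤x x<q with p ℕP.≟ x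
      ... | no ne = wc⇒local r st (subst (λ c → WCItems c is) (sym (color-stem (inj₁ t))) (proj₂ (go (cw p) refl w))) x (≤∧≢⇒< p≤x ne) x<q
        where
        go : ∀ c → cw p ≡ c → WCItems c (opening ∷ is) → cw p ≡ black × WCItems c is
        go black e w = e , w
      ... | yes refl = (λ _ → proj₁ (go (cw p) refl w)) , (λ t′ → case trans (sym t) t′ of λ ()) , λ t′ → case trans (sym t) t′ of λ ()
        where
        go : ∀ c → cw p ≡ c → WCItems c (opening ∷ is) → cw p ≡ black × WCItems c is
        go black e w = e , w
      wc⇒local {p} (close′ {is = is} t e r) st w x p≤x x<q with p ℕP.≟ x
      ... | no ne = wc⇒local r st (subst (λ c → WCItems c is) (sym (color-stem (inj₂ t))) (proj₂ (go (cw p) refl w))) x (≤∧≢⇒< p≤x ne) x<q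
        where
        go : ∀ c → cw p ≡ c → WCItems c (closing ∷ is) → cw p ≡ white × WCItems c is
        go white e w = e , w
      ... | yes refl = (λ t′ → case trans (sym t) t′ of λ ()) , (λ _ → proj₁ (go (cw p) refl w)) , λ t′ → case trans (sym t) t′ of λ ()
        where
        go : ∀ c → cw p ≡ c → WCItems c (closing ∷ is) → cw p ≡ white × WCItems c is
        go white e w = e , w
      wc⇒local {p} {q = q} (branch {js = js} {u} {is} t e r t′ e′ r′) st (wj , wi) x p≤x x<q with p ℕP.≟ x
      ... | yes refl = (λ t″ → case trans (sym t) t″ of λ ()) , (λ t″ → case trans (sym t) t″ of λ ()) ,
              λ _ → (λ cp → subst (λ z → L p ≤ suc (L z)) (sym e) (at-white cp (subst (λ c → WCNonRoot (flipC c) (node js)) cp wj))) ,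
                    (λ cp → subst (λ z → L z ≤ L p) (sym e) (at-black cp (subst (λ c → WCNonRoot (flipC c) (node js)) cp wj)))
        where
        bal = child-charge t r λ j lt → st j (<-≤-trans lt (reads-≤ r′))
        at-white : cw p ≡ white → WCNonRoot black (node js) → L p ≤ suc (L u)
        at-white _ (le , _) = ℤP.drop‿+≤+ (subst (ℤ._≤ ℤ.+ suc (L u)) bal (ℤP.+-monoˡ-≤ (ℤ.+ L u) le))
        at-black : cw p ≡ black → WCNonRoot white (node js) → L u ≤ L p
        at-black _ (le , _) = ℤP.drop‿+≤+ (subst₂ ℤ._≤_ (ℤP.+-identityˡ (ℤ.+ L u)) bal (ℤP.+-monoˡ-≤ (ℤ.+ L u) le))
      ... | no ne with <-cmp x u
      ...   | tri< lt _ _ = wc⇒local r (λ j lt → st j (<-≤-trans lt (≤-trans (n≤1+n u) (reads-≤ r′))))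
                (subst (λ c → WCItems c js) (sym (color-dn t)) (WCNonRoot⇒ (flipC (cw p)) wj)) x (≤∧≢⇒< p≤x ne) lt
      ...   | tri≈ _ refl _ = (λ t″ → case trans (sym t′) t″ of λ ()) , (λ t″ → case trans (sym t′) t″ of λ ()) , λ t″ → case trans (sym t′) t″ of λ ()
      ...   | tri> _ _ gt = wc⇒local r′ st (subst (λ c → WCItems c is) (sym (color-past t r t′ r′)) wi) x gt x<q

      local⇒wc : ∀ {p is q} → Reads ty m p is q → Steps q → (∀ x → p ≤ x → x < q → Local x) → WCItems (cw p) is
      local⇒wc done st h = tt
      local⇒wc {p} (open′ {is = is} t e r) st h = subst (λ c → WCItems c (opening ∷ is)) (sym cp)
        (subst (λ c → WCItems c is) (trans (color-stem (inj₁ t)) cp) (local⇒wc r st (λ x a b → h x (≤-trans (n≤1+n p) a) b)))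
        where cp = proj₁ (h p ≤-refl (reads-≤ r)) t
      local⇒wc {p} (close′ {is = is} t e r) st h = subst (λ c → WCItems c (closing ∷ is)) (sym cp)
        (subst (λ c → WCItems c is) (trans (color-stem (inj₂ t)) cp) (local⇒wc r st (λ x a b → h x (≤-trans (n≤1+n p) a) b)))
        where cp = proj₁ (proj₂ (h p ≤-refl (reads-≤ r))) t
      local⇒wc {p} {q = q} (branch {js = js} {u} {is} t refl r t′ e′ r′) st h =
        go (cw p) refl (subst (λ c → WCItems c js) (color-dn t) (local⇒wc r (λ j lt → st j (<-≤-trans lt u≤q)) (λ x a b → h x (<⇒≤ a) (<-≤-trans b u≤q)))) ,
        subst (λ c → WCItems c is) (color-past t r t′ r′) (local⇒wc r′ st λ x a b → h x (<⇒≤ (<-trans (reads-≤ r) a)) b)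
        where
        u≤q : u ≤ q
        u≤q = ≤-trans (n≤1+n u) (reads-≤ r′)
        bal = child-charge t r λ j lt → st j (<-≤-trans lt (reads-≤ r′))
        loc = proj₂ (proj₂ (h p ≤-refl (<-≤-trans (reads-≤ r) u≤q))) t
        go : ∀ c → cw p ≡ c → WCItems (flipC c) js → WCNonRoot (flipC c) (node js)
        go black cp w = ℤ-cancelʳ-≤ (ℤ.+ L u) (ℤ.+ 0) (chargeItems js)
          (subst₂ ℤ._≤_ (sym (ℤP.+-identityˡ (ℤ.+ L u))) (sym bal) (ℤ.+≤+ (proj₂ loc cp))) , w
        go white cp w = ℤ-cancelʳ-≤ (ℤ.+ L u) (chargeItems js) (ℤ.+ 1)
          (subst (ℤ._≤ ℤ.+ suc (L u)) (sym bal) (ℤ.+≤+ (proj₁ loc cp))) , w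

stepR : Letter → ℕ → List ℕ → List ℕ
stepR opn j s = j ∷ s
stepR cls j s = drop 1 s
stepR dn j s = s
stepR up j s = s

stepU : Letter → List ℕ → ℕ → ℕ
stepU cls [] u = suc u
stepU _ _ u = u

stepT : Letter → ℕ → List ℕ → List ℕ
stepT dn j s = j ∷ s
stepT up j s = drop 1 s
stepT opn j s = s
stepT cls j s = s

-- The stack of open stems when the contour is read from label 0 with an empty stack, the number of closing stems
-- met with an empty stack, and the stack of tree edges leading to the current vertex.
stemStack : (ℕ → Letter) → ℕ → List ℕ
stemStack ty zero = []
stemStack ty (suc j) = stepR (ty j) j (stemStack ty j)

unmatched : (ℕ → Letter) → ℕ → ℕ
unmatched ty zero = 0
unmatched ty (suc j) = stepU (ty j) (stemStack ty j) (unmatched ty j)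

treeStack : (ℕ → Letter) → ℕ → List ℕ
treeStack ty zero = []
treeStack ty (suc j) = stepT (ty j) j (treeStack ty j)

reads-treeStack : ∀ {ty m p is q} → Reads ty m p is q → treeStack ty q ≡ treeStack ty p
reads-treeStack done = refl
reads-treeStack {ty} {p = p} (open′ t _ r) = trans (reads-treeStack r) (cong (λ l → stepT l p (treeStack ty p)) t)
reads-treeStack {ty} {p = p} (close′ t _ r) = trans (reads-treeStack r) (cong (λ l → stepT l p (treeStack ty p)) t)
reads-treeStack {ty} {p = p} (branch {u = u} t _ r t′ _ r′) = trans (reads-treeStack r′)
  (cong₂ (λ l s → stepT l u s) t′ (trans (reads-treeStack r) (cong (λ l → stepT l p (treeStack ty p)) t)))

treeStack-nested : ∀ ty j {l b s} → treeStack ty j ≡ l ++ b ∷ s → treeStack ty b ≡ s × b < j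
treeStack-nested ty zero {[]} ()
treeStack-nested ty zero {_ ∷ _} ()
treeStack-nested ty (suc j) {l} {b} {s} e = go (ty j) refl l e
  where
  keep : ∀ l → treeStack ty j ≡ l ++ b ∷ s → treeStack ty b ≡ s × b < suc j
  keep l e = let (a , lt) = treeStack-nested ty j {l} e in a , <-trans lt (n<1+n j)
  go : ∀ a → ty j ≡ a → ∀ l → stepT a j (treeStack ty j) ≡ l ++ b ∷ s → treeStack ty b ≡ s × b < suc j
  go opn _ l e = keep l e
  go cls _ l e = keep l e
  go dn _ [] refl = refl , n<1+n j
  go dn _ (x ∷ l) e = keep l (∷-injectiveʳ e)
  go up _ l e with treeStack ty j in q
  go up _ [] () | []
  go up _ (x ∷ l) () | []
  ... | a ∷ r = subst (λ z → treeStack ty b ≡ s × z) refl (let (p , lt) = treeStack-nested ty j {a ∷ l} (trans q (cong (a ∷_) e)) in p , <-trans lt (n<1+n j))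

-- While `b` stays open no closing stem finds the stack empty, so `unmatched` has not moved since
-- `b`. This is what keeps the cyclic stack nested across the root corner.
stemStack-nested : ∀ ty j {l b s} → stemStack ty j ≡ l ++ b ∷ s →
  stemStack ty b ≡ s × unmatched ty b ≡ unmatched ty j × b < j × ty b ≡ opn
stemStack-nested ty zero {[]} ()
stemStack-nested ty zero {_ ∷ _} ()
stemStack-nested ty (suc j) {l} {b} {s} e = go (ty j) refl l e
  where
  Goal : ℕ → Set
  Goal u = stemStack ty b ≡ s × unmatched ty b ≡ u × b < suc j × ty b ≡ opn
  keep : ∀ l → stemStack ty j ≡ l ++ b ∷ s → Goal (unmatched ty j)
  keep l e = let (p , q , lt , t) = stemStack-nested ty j {l} e in p , q , <-trans lt (n<1+n j) , t
  go : ∀ a → ty j ≡ a → ∀ l → stepR a j (stemStack ty j) ≡ l ++ b ∷ s → Goal (stepU a (stemStack ty j) (unmatched ty j))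
  go opn t [] refl = refl , refl , n<1+n j , t
  go opn _ (x ∷ l) e = keep l (∷-injectiveʳ e)
  go dn _ l e = keep l e
  go up _ l e = keep l e
  go cls _ l e with stemStack ty j in q
  go cls _ [] () | []
  go cls _ (x ∷ l) () | []
  ... | a ∷ r = let (p , q , lt , t) = stemStack-nested ty j {a ∷ l} (trans q (cong (a ∷_) e)) in p , q , <-trans lt (n<1+n j) , t

unmatched-mono : ∀ ty {i j} → i ≤ j → unmatched ty i ≤ unmatched ty j
unmatched-mono ty {i} {j} le = go (≤⇒≤′ le)
  where
  step≤ : ∀ l s u → u ≤ stepU l s u
  step≤ opn s u = ≤-refl
  step≤ dn s u = ≤-refl
  step≤ up s u = ≤-refl
  step≤ cls [] u = n≤1+n u
  step≤ cls (_ ∷ _) u = ≤-refl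
  go : ∀ {i j} → i Data.Nat.≤′ j → unmatched ty i ≤ unmatched ty j
  go (Data.Nat.≤′-reflexive refl) = ≤-refl
  go (Data.Nat.≤′-step {j} le) = ≤-trans (go le) (step≤ (ty j) (stemStack ty j) (unmatched ty j))

-- A closing stem on an empty stack leaves the stack as it is, and the counter takes up the
-- difference. For charge 0 there are therefore as many unmatched closing stems as stems left open.
stemStack-balance : ∀ ty j → gain (ty j) ℤ.+ (ℤ.+ length (stemStack ty (suc j)) ℤ.- ℤ.+ unmatched ty (suc j)) ≡
  ℤ.+ length (stemStack ty j) ℤ.- ℤ.+ unmatched ty j
stemStack-balance ty j = go (ty j) (stemStack ty j) (unmatched ty j)
  where
  assoc : ∀ a b c → a ℤ.+ (b ℤ.- c) ≡ (a ℤ.+ b) ℤ.- c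
  assoc a b c = sym (ℤP.+-assoc a b (ℤ.- c))
  go : ∀ l s u → gain l ℤ.+ (ℤ.+ length (stepR l j s) ℤ.- ℤ.+ stepU l s u) ≡ ℤ.+ length s ℤ.- ℤ.+ u
  go opn s u = assoc -[1+ 0 ] (ℤ.+ suc (length s)) (ℤ.+ u)
  go dn s u = ℤP.+-identityˡ _
  go up s u = ℤP.+-identityˡ _
  go cls (x ∷ s) u = assoc (ℤ.+ 1) (ℤ.+ length s) (ℤ.+ u)
  go cls [] zero = refl
  go cls [] (suc u) = refl

drop-∷ : ∀ {A : Set} k (xs : List A) {x r} → drop k xs ≡ x ∷ r → drop (suc k) xs ≡ r
drop-∷ zero (x ∷ xs) refl = refl
drop-∷ (suc k) (y ∷ xs) e = drop-∷ k xs e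

drop-head : ∀ {A : Set} k (xs : List A) → k < length xs → ∃ λ x → drop k xs ≡ x ∷ drop (suc k) xs
drop-head zero (x ∷ xs) lt = x , refl
drop-head (suc k) (x ∷ xs) (s≤s lt) = drop-head k xs lt

drop-split : ∀ {A : Set} k (xs : List A) {b s} → drop k xs ≡ b ∷ s → ∃ λ l → xs ≡ l ++ b ∷ s
drop-split zero xs e = [] , e
drop-split (suc k) (x ∷ xs) e = let (l , e′) = drop-split k xs e in x ∷ l , cong (x ∷_) e′

drop-length : ∀ {A : Set} (xs : List A) → drop (length xs) xs ≡ []
drop-length [] = refl
drop-length (x ∷ xs) = drop-length xs

-- The stack of open stems read cyclically: stems that stay open at the end of the contour are open at its beginning.
module Cyclic (ty : ℕ → Letter) (N : ℕ) (balanced : unmatched ty N ≡ length (stemStack ty N)) where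

  final : List ℕ
  final = stemStack ty N

  -- Below the stems opened since label 0 lie those left over from the previous turn; each unmatched
  -- closing stem has removed one of them from the top.
  cyc-stk : ℕ → List ℕ
  cyc-stk j = stemStack ty j ++ drop (unmatched ty j) final

  cyc-opn : ∀ {j} → ty j ≡ opn → cyc-stk (suc j) ≡ j ∷ cyc-stk j
  cyc-opn t rewrite t = refl

  cyc-tree : ∀ {j} → TreeL (ty j) → cyc-stk (suc j) ≡ cyc-stk j
  cyc-tree (inj₁ t) rewrite t = refl
  cyc-tree (inj₂ t) rewrite t = refl

  cyc-cls : ∀ {j} → j < N → ty j ≡ cls → ∃ λ o → cyc-stk j ≡ o ∷ cyc-stk (suc j)
  cyc-cls {j} lt t rewrite t with stemStack ty j in e
  ... | o ∷ r = o , refl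
  ... | [] = drop-head (unmatched ty j) final (subst (unmatched ty j <_) balanced (<-≤-trans grows (unmatched-mono ty lt)))
    where
    grows : unmatched ty j < unmatched ty (suc j)
    grows rewrite t | e = n<1+n _

  cyc-wrap : cyc-stk N ≡ cyc-stk 0
  cyc-wrap = trans (cong (λ k → final ++ drop k final) balanced) (trans (cong (final ++_) (drop-length final)) (++-identityʳ final))

  cyc-nested : ∀ {j b s} → j ≤ N → cyc-stk j ≡ b ∷ s → cyc-stk b ≡ s × b < N × ty b ≡ opn
  cyc-nested {j} {b} {s} j≤N e = go (stemStack ty j) refl e
    where
    go : ∀ r → stemStack ty j ≡ r → r ++ drop (unmatched ty j) final ≡ b ∷ s → cyc-stk b ≡ s × b < N × ty b ≡ opn
    go (x ∷ r) eq e with ∷-injective e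
    ... | refl , e′ with stemStack-nested ty j {[]} eq
    ...   | p , q , lt , t = trans (cong₂ (λ a u → a ++ drop u final) p q) e′ , <-≤-trans lt j≤N , t
    -- `b` was opened in the previous turn and stays open to its end, so all unmatched closing stems
    -- come before it: at `b` the leftovers are used up and its stack is the linear one.
    go [] eq e with drop-split (unmatched ty j) final e
    ... | l , e′ with stemStack-nested ty N {l} e′
    ...   | p , q , lt , t = trans (cong₂ (λ a u → a ++ drop u final) p (trans q balanced))
              (trans (cong (s ++_) (drop-length final)) (++-identityʳ s)) , lt , t

  -- Moving from a corner to the stem on top of its stack shortens the stack by one, so repeating
  -- this ends at the empty stack.
  cyc-empty : 0 < N → ∃ λ j → j < N × cyc-stk j ≡ []
  cyc-empty 0<N = go (cyc-stk 0) 0 0<N refl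
    where
    go : ∀ s j → j < N → cyc-stk j ≡ s → ∃ λ j → j < N × cyc-stk j ≡ []
    go [] j lt e = j , lt , e
    go (b ∷ s) j lt e = let (e′ , lt′ , _) = cyc-nested (<⇒≤ lt) e in go s b lt′ e′

  cyc-steps : ∀ j → j < N → gain (ty j) ℤ.+ ℤ.+ length (cyc-stk (suc j)) ≡ ℤ.+ length (cyc-stk j)
  cyc-steps j lt = go (ty j) refl
    where
    go : ∀ l → ty j ≡ l → gain l ℤ.+ ℤ.+ length (cyc-stk (suc j)) ≡ ℤ.+ length (cyc-stk j)
    go opn t = cong (λ s → -[1+ 0 ] ℤ.+ ℤ.+ length s) (cyc-opn t)
    go cls t = cong (λ s → ℤ.+ length s) (sym (proj₂ (cyc-cls lt t)))
    go dn t = cong (λ s → ℤ.+ length s) (cyc-tree (inj₁ t))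
    go up t = cong (λ s → ℤ.+ length s) (cyc-tree (inj₂ t))

-- Matching of stems

αℕ-found : ∀ ps L {x v} → All (λ ab → proj₁ ab ≡ x → proj₂ ab ≡ v) ps → x ∈ map proj₁ ps → αℕ (ps ++ L) x ≡ v
αℕ-found ((a , b) ∷ ps) L {x} (h ∷ hs) m with a ≡ᵇ x in e
... | true = h (≡ᵇ⇒≡ a x (Equivalence.from T-≡ e))
αℕ-found ((a , b) ∷ ps) L (h ∷ hs) (here refl) | false = contradiction (trans (sym e) (≡ᵇ-refl a)) λ ()
αℕ-found ((a , b) ∷ ps) L (h ∷ hs) (there m) | false = αℕ-found ps L hs m

αℕ-miss : ∀ ps L {x} → All (λ ab → proj₁ ab ≢ x) ps → αℕ (ps ++ L) x ≡ αℕ L x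
αℕ-miss [] L [] = refl
αℕ-miss ((a , b) ∷ ps) L (h ∷ hs) rewrite ≡ᵇ-≢ h = αℕ-miss ps L hs

αℕ-∈ : ∀ L {x} → x ∈ map proj₁ L → (x , αℕ L x) ∈ L
αℕ-∈ ((a , b) ∷ L) {x} m with a ≡ᵇ x in e
αℕ-∈ ((a , b) ∷ L) {x} m | true with ≡ᵇ⇒≡ a x (Equivalence.from T-≡ e)
... | refl = here refl
αℕ-∈ ((a , b) ∷ L) (here refl) | false = contradiction (trans (sym e) (≡ᵇ-refl a)) λ ()
αℕ-∈ ((a , b) ∷ L) (there m) | false = there (αℕ-∈ L m)

symPairs-∈⁻ : ∀ P {a b} → (a , b) ∈ symPairs P → (a , b) ∈ P ⊎ (b , a) ∈ P
symPairs-∈⁻ ((a , b) ∷ P) (here refl) = inj₁ (here refl)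
symPairs-∈⁻ ((a , b) ∷ P) (there (here refl)) = inj₂ (here refl)
symPairs-∈⁻ ((a , b) ∷ P) (there (there m)) = Data.Sum.map there there (symPairs-∈⁻ P m)

symPairs-keys : ∀ P {x} → x ∈ map proj₁ P ⊎ x ∈ map proj₂ P → x ∈ map proj₁ (symPairs P)
symPairs-keys ((a , b) ∷ P) (inj₁ (here e)) = here e
symPairs-keys ((a , b) ∷ P) (inj₁ (there m)) = there (there (symPairs-keys P (inj₁ m)))
symPairs-keys ((a , b) ∷ P) (inj₂ (here e)) = there (here e)
symPairs-keys ((a , b) ∷ P) (inj₂ (there m)) = there (there (symPairs-keys P (inj₂ m)))

module _ {ty : ℕ → Letter} {m : ℕ → ℕ} where

  Edge : ℕ × ℕ → Set
  Edge (a , b) = TreeL (ty a) × m a ≡ b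

  reads-alphas : ∀ c {p is q} → Reads ty m p is q → All Edge (Out.alphas (walkItems c is p))
  reads-alphas c done = []
  reads-alphas c (open′ _ _ r) = reads-alphas c r
  reads-alphas c (close′ _ _ r) = reads-alphas c r
  reads-alphas c (branch t e r t′ e′ r′) with refl ← reads-next (flipC c) r =
    (inj₁ t , e) ∷ (inj₂ t′ , e′) ∷ AllP.++⁺ (reads-alphas (flipC c) r) (reads-alphas c r′)

  tree-or-stem : ∀ {l} → Stem l → TreeL l → ⊥
  tree-or-stem (inj₁ refl) (inj₁ ())
  tree-or-stem (inj₁ refl) (inj₂ ())
  tree-or-stem (inj₂ refl) (inj₁ ())
  tree-or-stem (inj₂ refl) (inj₂ ())

  alphas-cover : ∀ c {p is q} → Reads ty m p is q → ∀ {x} → p ≤ x → x < q → TreeL (ty x) →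
    x ∈ map proj₁ (Out.alphas (walkItems c is p))
  alphas-cover c done p≤x x<q tr = contradiction x<q (≤⇒≯ p≤x)
  alphas-cover c {p} (open′ t _ r) {x} p≤x x<q tr with p ℕP.≟ x
  ... | yes refl = ⊥-elim (tree-or-stem (inj₁ t) tr)
  ... | no ne = alphas-cover c r (≤∧≢⇒< p≤x ne) x<q tr
  alphas-cover c {p} (close′ t _ r) {x} p≤x x<q tr with p ℕP.≟ x
  ... | yes refl = ⊥-elim (tree-or-stem (inj₂ t) tr)
  ... | no ne = alphas-cover c r (≤∧≢⇒< p≤x ne) x<q tr
  alphas-cover c {p} (branch {js = js} {u} {is} t e r t′ e′ r′) {x} p≤x x<q tr with refl ← reads-next (flipC c) r | p ℕP.≟ x
  ... | yes refl = here refl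
  ... | no ne with <-cmp x u
  ...   | tri≈ _ refl _ = there (here refl)
  ...   | tri< lt _ _ = there (there (subst (x ∈_) (sym (map-++ proj₁ (Out.alphas (walkItems (flipC c) js (suc p))) _))
            (∈-++⁺ˡ (alphas-cover (flipC c) r (≤∧≢⇒< p≤x ne) lt tr))))
  ...   | tri> _ _ gt = there (there (subst (x ∈_) (sym (map-++ proj₁ (Out.alphas (walkItems (flipC c) js (suc p))) _))
            (∈-++⁺ʳ _ (alphas-cover c r′ gt x<q tr))))

stemLetter : Bool → Letter
stemLetter true = opn
stemLetter false = cls

stemLetter-stem : ∀ b {l} → l ≡ stemLetter b → Stem l
stemLetter-stem true e = inj₁ e
stemLetter-stem false e = inj₂ e

stemLetter-inj : ∀ {b b′} → stemLetter b ≡ stemLetter b′ → b ≡ b′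
stemLetter-inj {true} {true} e = refl
stemLetter-inj {false} {false} e = refl

data Stems (ty : ℕ → Letter) : ℕ → List (ℕ × Bool) → ℕ → Set where
  nil   : ∀ {p} → Stems ty p [] p
  stemS : ∀ b {p s q} → ty p ≡ stemLetter b → Stems ty (suc p) s q → Stems ty p ((p , b) ∷ s) q
  treeS : ∀ {p s q} → TreeL (ty p) → Stems ty (suc p) s q → Stems ty p s q

stems-++ : ∀ {ty p s q s′ r} → Stems ty p s q → Stems ty q s′ r → Stems ty p (s ++ s′) r
stems-++ nil b = b
stems-++ (stemS f t a) b = stemS f t (stems-++ a b)
stems-++ (treeS t a) b = treeS t (stems-++ a b)

reads-stems : ∀ {ty m} c {p is q} → Reads ty m p is q → Stems ty p (Out.stems (walkItems c is p)) q
reads-stems c done = nil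
reads-stems c (open′ t _ r) = stemS true t (reads-stems c r)
reads-stems c (close′ t _ r) = stemS false t (reads-stems c r)
reads-stems c (branch t _ r t′ _ r′) with refl ← reads-next (flipC c) r =
  treeS (inj₁ t) (stems-++ (reads-stems (flipC c) r) (treeS (inj₂ t′) (reads-stems c r′)))

flagged : Bool → List (ℕ × Bool) → List ℕ
flagged b [] = []
flagged b ((x , b′) ∷ s) = if does (b ≟B b′) then x ∷ flagged b s else flagged b s

module _ {ty : ℕ → Letter} where

  stems-≤ : ∀ {p s q} → Stems ty p s q → p ≤ q
  stems-≤ nil = ≤-refl
  stems-≤ (stemS _ _ S) = ≤-trans (n≤1+n _) (stems-≤ S)
  stems-≤ (treeS _ S) = ≤-trans (n≤1+n _) (stems-≤ S)

  flagged-sound : ∀ b {p s q x} → Stems ty p s q → x ∈ flagged b s → p ≤ x × x < q × ty x ≡ stemLetter b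
  flagged-sound b (treeS t S) i = let (u , v , w) = flagged-sound b S i in <⇒≤ u , v , w
  flagged-sound b (stemS b′ t S) i with b ≟B b′
  flagged-sound b (stemS b′ t S) (here refl) | yes refl = ≤-refl , stems-≤ S , t
  flagged-sound b (stemS b′ t S) (there i) | yes refl = let (u , v , w) = flagged-sound b S i in <⇒≤ u , v , w
  flagged-sound b (stemS b′ t S) i | no _ = let (u , v , w) = flagged-sound b S i in <⇒≤ u , v , w

  flagged-complete : ∀ b {p s q x} → Stems ty p s q → p ≤ x → x < q → ty x ≡ stemLetter b → x ∈ flagged b s
  flagged-complete b nil u v t = contradiction v (≤⇒≯ u)
  flagged-complete b {p} {x = x} (stemS b′ t′ S) u v t with b ≟B b′ | p ℕP.≟ x
  ... | yes _ | yes refl = here refl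
  ... | yes _ | no ne = there (flagged-complete b S (≤∧≢⇒< u ne) v t)
  ... | no b≢ | yes refl = contradiction (stemLetter-inj (trans (sym t) t′)) b≢
  ... | no _ | no ne = flagged-complete b S (≤∧≢⇒< u ne) v t
  flagged-complete b {p} {x = x} (treeS t′ S) u v t with p ℕP.≟ x
  ... | yes refl = ⊥-elim (tree-or-stem {ty} {id} (stemLetter-stem b t) t′)
  ... | no ne = flagged-complete b S (≤∧≢⇒< u ne) v t

  flagged-unique : ∀ b {p s q} → Stems ty p s q → Unique (flagged b s)
  flagged-unique b nil = []
  flagged-unique b (treeS t S) = flagged-unique b S
  flagged-unique b (stemS b′ t S) with b ≟B b′
  ... | yes _ = All-tabulate (λ i e → <-irrefl e (proj₁ (flagged-sound b S i))) ∷ flagged-unique b S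
  ... | no _ = flagged-unique b S

-- Unmatched closing stems numbered by the counter. Zipping pairs the one numbered `k` with the
-- entry `k` places below the top of the final stack, which is the top of `cyc-stk` at that stem.
data Ordered (ty : ℕ → Letter) : ℕ → List ℕ → Set where
  []  : ∀ {k} → Ordered ty k []
  _∷_ : ∀ {k x xs} → ty x ≡ cls × stemStack ty x ≡ [] × unmatched ty x ≡ k → Ordered ty (suc k) xs → Ordered ty k (x ∷ xs)

ordered-snoc : ∀ {ty k xs x} → Ordered ty k xs → ty x ≡ cls × stemStack ty x ≡ [] × unmatched ty x ≡ k + length xs → Ordered ty k (xs ++ x ∷ [])
ordered-snoc {k = k} [] (a , b , c) = (a , b , trans c (+-identityʳ k)) ∷ []
ordered-snoc {k = k} {xs = _ ∷ xs} (h ∷ o) (a , b , c) = h ∷ ordered-snoc o (a , b , trans c (+-suc k (length xs)))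

Matched : (ℕ → Letter) → List (ℕ × ℕ) → Set
Matched ty acc = ∀ {o x} → (o , x) ∈ acc → ty x ≡ cls × ∃ λ r → stemStack ty x ≡ o ∷ r

MatchResult : (ℕ → Letter) → ℕ → List (ℕ × ℕ) × List ℕ × List ℕ → Set
MatchResult ty q (acc , st , uc) = st ≡ stemStack ty q × length uc ≡ unmatched ty q × Ordered ty 0 uc × Matched ty acc

matchGo-result : ∀ {ty p s q} → Stems ty p s q → ∀ st uc acc → st ≡ stemStack ty p → length uc ≡ unmatched ty p →
  Ordered ty 0 (reverse uc) → Matched ty acc → MatchResult ty q (matchGo s st uc acc)
matchGo-result nil st uc acc e u o h = e , trans (length-reverse uc) u , o , h
matchGo-result {ty} {p} (stemS true t S) st uc acc e u o h =
  matchGo-result S (p ∷ st) uc acc (trans (cong (p ∷_) e) (cong (λ l → stepR l p (stemStack ty p)) (sym t)))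
    (trans u (cong (λ l → stepU l (stemStack ty p) (unmatched ty p)) (sym t))) o h
matchGo-result {ty} {p} (stemS false t S) [] uc acc e u o h =
  matchGo-result S [] (p ∷ uc) acc (trans (cong (drop 1) e) (cong (λ l → stepR l p (stemStack ty p)) (sym t)))
    (trans (cong suc u) (cong₂ (λ l s → stepU l s (unmatched ty p)) (sym t) e))
    (subst (Ordered ty 0) (sym (unfold-reverse p uc)) (ordered-snoc o (t , sym e ,
      sym (trans (length-reverse uc) u)))) h
matchGo-result {ty} {p} (stemS false t S) (a ∷ st) uc acc e u o h =
  matchGo-result S st uc ((a , p) ∷ acc) (trans (cong (drop 1) e) (cong (λ l → stepR l p (stemStack ty p)) (sym t)))
    (trans u (cong₂ (λ l s → stepU l s (unmatched ty p)) (sym t) e)) o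
    λ { (here refl) → t , st , sym e ; (there i) → h i }
matchGo-result {ty} {p} (treeS t S) st uc acc e u o h = matchGo-result S st uc acc (trans e (keepR t)) (trans u (keepU t)) o h
  where
  keepR : TreeL (ty p) → stemStack ty p ≡ stemStack ty (suc p)
  keepR (inj₁ t) rewrite t = refl
  keepR (inj₂ t) rewrite t = refl
  keepU : TreeL (ty p) → unmatched ty p ≡ unmatched ty (suc p)
  keepU (inj₁ t) rewrite t = refl
  keepU (inj₂ t) rewrite t = refl

-- No opening stem is lost or duplicated by the matching. With `matchGo-seconds` and equal numbers
-- of leftovers, the pairs form a perfect matching of the stems.
matchGo-firsts : ∀ s st uc acc → let (acc′ , st′ , uc′) = matchGo s st uc acc in
  map proj₁ acc′ ++ st′ ↭ map proj₁ acc ++ st ++ flagged true s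
matchGo-firsts [] st uc acc = ++⁺ˡ (map proj₁ acc) (subst (st ↭_) (sym (++-identityʳ st)) ↭-refl)
matchGo-firsts ((x , true) ∷ s) st uc acc = ↭-trans (matchGo-firsts s (x ∷ st) uc acc) (++⁺ˡ (map proj₁ acc) (↭-sym (shift x st (flagged true s))))
matchGo-firsts ((x , false) ∷ s) [] uc acc = matchGo-firsts s [] (x ∷ uc) acc
matchGo-firsts ((x , false) ∷ s) (o ∷ st) uc acc = ↭-trans (matchGo-firsts s st uc ((o , x) ∷ acc)) (↭-sym (shift o (map proj₁ acc) (st ++ flagged true s)))

matchGo-seconds : ∀ s st uc acc → let (acc′ , st′ , uc′) = matchGo s st uc acc in
  map proj₂ acc′ ++ uc′ ↭ map proj₂ acc ++ reverse uc ++ flagged false s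
matchGo-seconds [] st uc acc = ++⁺ˡ (map proj₂ acc) (subst (reverse uc ↭_) (sym (++-identityʳ (reverse uc))) ↭-refl)
matchGo-seconds ((x , true) ∷ s) st uc acc = matchGo-seconds s (x ∷ st) uc acc
matchGo-seconds ((x , false) ∷ s) [] uc acc = ↭-trans (matchGo-seconds s [] (x ∷ uc) acc)
  (++⁺ˡ (map proj₂ acc) (subst (_↭ (reverse uc ++ x ∷ flagged false s))
    (trans (sym (++-assoc (reverse uc) (x ∷ []) (flagged false s))) (cong (_++ flagged false s) (sym (unfold-reverse x uc)))) ↭-refl))
matchGo-seconds ((x , false) ∷ s) (o ∷ st) uc acc = ↭-trans (matchGo-seconds s st uc ((o , x) ∷ acc))
  (↭-trans (↭-sym (shift x (map proj₂ acc) (reverse uc ++ flagged false s)))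
    (++⁺ˡ (map proj₂ acc) (↭-sym (shift x (reverse uc) (flagged false s)))))

zip-firsts : ∀ {A B : Set} (xs : List A) (ys : List B) → length xs ≡ length ys → map proj₁ (zip xs ys) ≡ xs
zip-firsts [] [] e = refl
zip-firsts (x ∷ xs) (y ∷ ys) e = cong (x ∷_) (zip-firsts xs ys (suc-injective e))

zip-seconds : ∀ {A B : Set} (xs : List A) (ys : List B) → length xs ≡ length ys → map proj₂ (zip xs ys) ≡ ys
zip-seconds [] [] e = refl
zip-seconds (x ∷ xs) (y ∷ ys) e = cong (y ∷_) (zip-seconds xs ys (suc-injective e))

zip-ordered : ∀ {ty k uc S} (F : List ℕ) → Ordered ty k uc → drop k F ≡ S → ∀ {o x} → (o , x) ∈ zip S uc →
  ty x ≡ cls × stemStack ty x ≡ [] × ∃ λ r → drop (unmatched ty x) F ≡ o ∷ r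
zip-ordered {S = []} F [] e ()
zip-ordered {S = a ∷ S} F [] e ()
zip-ordered {S = []} F (_ ∷ _) e ()
zip-ordered {k = k} {S = a ∷ S} F ((t , b , u) ∷ o) e (here refl) = t , b , S , trans (cong (λ k → drop k F) u) e
zip-ordered {k = k} {S = a ∷ S} F (_ ∷ o) e (there i) = zip-ordered F o (drop-∷ k F e) i

module StemPairs (ty : ℕ → Letter) (N : ℕ) (balanced : unmatched ty N ≡ length (stemStack ty N))
                 (s : List (ℕ × Bool)) (S : Stems ty 0 s N) where
  open Cyclic ty N balanced public

  pairs : List (ℕ × ℕ)
  pairs = cyclicMatching s

  private
    result : MatchResult ty N (matchGo s [] [] [])
    result = matchGo-result S [] [] [] refl refl [] λ ()

    acc = proj₁ (matchGo s [] [] [])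
    st = proj₁ (proj₂ (matchGo s [] [] []))
    uc = proj₂ (proj₂ (matchGo s [] [] []))

    same-length : length st ≡ length uc
    same-length = trans (cong length (proj₁ result)) (trans (sym balanced) (sym (proj₁ (proj₂ result))))

  pairs-firsts : map proj₁ pairs ↭ flagged true s
  pairs-firsts = subst (_↭ flagged true s) (sym (trans (map-++ proj₁ acc (zip st uc)) (cong (map proj₁ acc ++_) (zip-firsts st uc same-length))))
    (matchGo-firsts s [] [] [])

  pairs-seconds : map proj₂ pairs ↭ flagged false s
  pairs-seconds = subst (_↭ flagged false s) (sym (trans (map-++ proj₂ acc (zip st uc)) (cong (map proj₂ acc ++_) (zip-seconds st uc same-length))))
    (matchGo-seconds s [] [] [])

  -- Pairs matched linearly and pairs matched across the root corner are recognised alike, by the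
  -- top of the cyclic stack at the closing stem.
  pair-stk : ∀ {o x} → (o , x) ∈ pairs → ty x ≡ cls × ∃ λ r → cyc-stk x ≡ o ∷ r
  pair-stk {o} {x} i with ∈-++⁻ acc i
  ... | inj₁ j = let (t , r , e) = proj₂ (proj₂ (proj₂ result)) j in t , _ , cong (_++ drop (unmatched ty x) final) e
  ... | inj₂ j = let (t , e , r , e′) = zip-ordered st (proj₁ (proj₂ (proj₂ result))) refl j
                 in t , r , trans (cong (_++ drop (unmatched ty x) final) e) (trans (cong (drop (unmatched ty x)) (sym (proj₁ result))) e′)

  mateS : ℕ → ℕ
  mateS = αℕ (symPairs pairs)

  private
    seconds-< : ∀ {o x} → (o , x) ∈ pairs → x < N
    seconds-< i = proj₁ (proj₂ (flagged-sound false S (∈-resp-↭ pairs-seconds (∈-map⁺ proj₂ i))))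

    firsts-opn : ∀ {o x} → (o , x) ∈ pairs → ty o ≡ opn
    firsts-opn i = proj₂ (proj₂ (flagged-sound true S (∈-resp-↭ pairs-firsts (∈-map⁺ proj₁ i))))

    opn≢cls : ∀ {x} → ty x ≡ opn → ty x ≡ cls → ⊥
    opn≢cls a b = case trans (sym a) b of λ ()

    unique-second : ∀ (P : List (ℕ × ℕ)) → Unique (map proj₁ P) → ∀ {o x x′} → (o , x) ∈ P → (o , x′) ∈ P → x ≡ x′
    unique-second (_ ∷ P) u (here refl) (here refl) = refl
    unique-second (_ ∷ P) u (here refl) (there j) = contradiction (∈-map⁺ proj₁ j) (UniqueP.Unique[x∷xs]⇒x∉xs u)
    unique-second (_ ∷ P) u (there i) (here refl) = contradiction (∈-map⁺ proj₁ i) (UniqueP.Unique[x∷xs]⇒x∉xs u)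
    unique-second (_ ∷ P) (_ ∷ u) (there i) (there j) = unique-second P u i j

    firsts-unique : Unique (map proj₁ pairs)
    firsts-unique = PermS.Unique-resp-↭ (setoid ℕ) (↭⇒↭ₛ (↭-sym pairs-firsts)) (flagged-unique true S)

  mateS-opn : ∀ {o} → o < N → ty o ≡ opn → (o , mateS o) ∈ pairs
  mateS-opn {o} lt t with symPairs-∈⁻ pairs (αℕ-∈ (symPairs pairs)
    (symPairs-keys pairs (inj₁ (∈-resp-↭ (↭-sym pairs-firsts) (flagged-complete true S z≤n lt t)))))
  ... | inj₁ i = i
  ... | inj₂ i = ⊥-elim (opn≢cls t (proj₁ (pair-stk i)))

  mateS-cls : ∀ {x} → x < N → ty x ≡ cls → (mateS x , x) ∈ pairs
  mateS-cls {x} lt t with symPairs-∈⁻ pairs (αℕ-∈ (symPairs pairs)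
    (symPairs-keys pairs (inj₂ (∈-resp-↭ (↭-sym pairs-seconds) (flagged-complete false S z≤n lt t)))))
  ... | inj₂ i = i
  ... | inj₁ i = ⊥-elim (opn≢cls (firsts-opn i) t)

  record OpnFacts (o : ℕ) : Set where
    field
      mate<  : mateS o < N
      mate-ty : ty (mateS o) ≡ cls
      mate-mate : mateS (mateS o) ≡ o
      mate-stk : cyc-stk (mateS o) ≡ o ∷ cyc-stk o

  opn-facts : ∀ {o} → o < N → ty o ≡ opn → OpnFacts o
  opn-facts {o} lt t = record { mate< = x< ; mate-ty = proj₁ st-x ; mate-mate = back ; mate-stk = trans e (cong (o ∷_) (sym (proj₁ (cyc-nested (<⇒≤ x<) e)))) }
    where
    i = mateS-opn lt t
    x< = seconds-< i
    st-x = pair-stk i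
    e = proj₂ (proj₂ st-x)
    back : mateS (mateS o) ≡ o
    back = ∷-injectiveˡ (trans (sym (proj₂ (proj₂ (pair-stk (mateS-cls x< (proj₁ st-x)))))) e)

  record ClsFacts (x : ℕ) : Set where
    field
      mate<  : mateS x < N
      mate-ty : ty (mateS x) ≡ opn
      mate-mate : mateS (mateS x) ≡ x
      mate-stk : cyc-stk x ≡ mateS x ∷ cyc-stk (suc x)
      mate-stk′ : cyc-stk (mateS x) ≡ cyc-stk (suc x)

  cls-facts : ∀ {x} → x < N → ty x ≡ cls → ClsFacts x
  cls-facts {x} lt t = record { mate< = o< ; mate-ty = firsts-opn i ; mate-mate = unique-second pairs firsts-unique (mateS-opn o< (firsts-opn i)) i
      ; mate-stk = stk≡ ; mate-stk′ = proj₁ (cyc-nested (<⇒≤ lt) stk≡) }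
    where
    i = mateS-cls lt t
    e = proj₂ (proj₂ (pair-stk i))
    o< = proj₁ (proj₂ (cyc-nested (<⇒≤ lt) e))
    cl = cyc-cls lt t
    stk≡ : cyc-stk x ≡ mateS x ∷ cyc-stk (suc x)
    stk≡ = trans (proj₂ cl) (cong (_∷ cyc-stk (suc x)) (∷-injectiveˡ (trans (sym (proj₂ cl)) e)))

-- Rotations, depths and degrees

data Cyc (f : ℕ → ℕ) (y : ℕ) : List ℕ → Set where
  last : ∀ {a} → f a ≡ y → Cyc f y (a ∷ [])
  link : ∀ {a b r} → f a ≡ b → Cyc f y (b ∷ r) → Cyc f y (a ∷ b ∷ r)

nextCyc-lemma : (f : ℕ → ℕ) → ∀ y x (g : List ℕ → Maybe ℕ) →
  (∀ a → g (a ∷ []) ≡ (if a ≡ᵇ x then just y else nothing)) →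
  (∀ a b r → g (a ∷ b ∷ r) ≡ (if a ≡ᵇ x then just b else g (b ∷ r))) →
  ∀ l → Cyc f y l → x ∈ l → g l ≡ just (f x)
nextCyc-lemma f y x g g1 g2 (a ∷ []) (last e) (here refl) rewrite g1 a | Equivalence.to T-≡ (≡⇒≡ᵇ a a refl) = cong just (sym e)
nextCyc-lemma f y x g g1 g2 (a ∷ b ∷ r) (link e c) m with a ≡ᵇ x in q
... | true = trans (g2 a b r) (trans (cong (λ z → if z then just b else g (b ∷ r)) q) (cong just (trans (sym e) (cong f (≡ᵇ⇒≡ a x (Equivalence.from T-≡ q))))))
nextCyc-lemma f y x g g1 g2 (a ∷ b ∷ r) (link e c) (here refl) | false = contradiction (trans (sym q) (Equivalence.to T-≡ (≡⇒≡ᵇ a a refl))) λ ()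
nextCyc-lemma f y x g g1 g2 (a ∷ b ∷ r) (link e c) (there m) | false = trans (g2 a b r) (trans (cong (λ z → if z then just b else g (b ∷ r)) q) (nextCyc-lemma f y x g g1 g2 (b ∷ r) c m))

-- The recursion of nextCyc is local to its definition; the equation below solves the metavariable to it.
mutual
  nextCyc-go : ℕ → List ℕ → ℕ → List ℕ → Maybe ℕ
  nextCyc-go = _

  nextCyc-go≡ : ∀ y ys x → nextCyc (y ∷ ys) x ≡ nextCyc-go y ys x (y ∷ ys)
  nextCyc-go≡ y ys x with y ∷ ys
  ... | l = refl

nextCyc-just : (f : ℕ → ℕ) → ∀ y ys x → Cyc f y (y ∷ ys) → x ∈ y ∷ ys → nextCyc (y ∷ ys) x ≡ just (f x)
nextCyc-just f y ys x c m = trans (nextCyc-go≡ y ys x)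
  (nextCyc-lemma f y x (nextCyc-go y ys x) (λ _ → refl) (λ _ _ _ → refl) (y ∷ ys) c m)

nextCyc-miss : ∀ y x (g : List ℕ → Maybe ℕ) →
  (∀ a → g (a ∷ []) ≡ (if a ≡ᵇ x then just y else nothing)) →
  (∀ a b r → g (a ∷ b ∷ r) ≡ (if a ≡ᵇ x then just b else g (b ∷ r))) →
  ∀ a l → x ∉ a ∷ l → g (a ∷ l) ≡ nothing
nextCyc-miss y x g g1 g2 a [] h = trans (g1 a) (cong (λ z → if z then just y else nothing) (≡ᵇ-≢ (λ e → h (here (sym e)))))
nextCyc-miss y x g g1 g2 a (b ∷ l) h = trans (g2 a b l) (trans (cong (λ z → if z then just b else g (b ∷ l)) (≡ᵇ-≢ (λ e → h (here (sym e)))))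
  (nextCyc-miss y x g g1 g2 b l (h ∘ there)))

nextCyc-nothing : ∀ y ys x → x ∉ y ∷ ys → nextCyc (y ∷ ys) x ≡ nothing
nextCyc-nothing y ys x h = trans (nextCyc-go≡ y ys x) (nextCyc-miss y x (nextCyc-go y ys x) (λ _ → refl) (λ _ _ _ → refl) y ys h)

open DecMem ℕP._≟_ using () renaming (_∈?_ to _∈ℕ?_)

-- A listed rotation is a cycle of `f` of constant colour. As its labels increase, the first one is
-- the least of the vertex, the one that `isOrbitRep` selects.
record Rot (f : ℕ → ℕ) (C : ℕ → Color) (rc : List ℕ × Color) : Set where
  field
    first : ℕ
    rest  : List ℕ
    shape : proj₁ rc ≡ first ∷ rest
    cyc   : Cyc f first (proj₁ rc)
    color : All (λ x → C x ≡ proj₂ rc) (proj₁ rc)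
    incr  : AllPairs _<_ (proj₁ rc)

σℕ-just : ∀ r c rs x {y} → nextCyc r x ≡ just y → σℕ ((r , c) ∷ rs) x ≡ y
σℕ-just r c rs x e with nextCyc r x
σℕ-just r c rs x refl | just y = refl

σℕ-nothing : ∀ r c rs x → nextCyc r x ≡ nothing → σℕ ((r , c) ∷ rs) x ≡ σℕ rs x
σℕ-nothing r c rs x e with nextCyc r x
... | nothing = refl

σℕ-rots : ∀ {f C} rs → All (Rot f C) rs → ∀ {x} → x ∈ concat (map proj₁ rs) → σℕ rs x ≡ f x
σℕ-rots {f} ((r , c) ∷ rs) (R ∷ Rs) {x} i with x ∈ℕ? r
... | yes j = σℕ-just r c rs x (go (Rot.shape R) (Rot.cyc R) j)
  where
  go : ∀ {r y ys} → r ≡ y ∷ ys → Cyc f y r → x ∈ r → nextCyc r x ≡ just (f x)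
  go refl C j = nextCyc-just f _ _ x C j
... | no nj with ∈-++⁻ r i
...   | inj₁ j = contradiction j nj
...   | inj₂ j = trans (σℕ-nothing r c rs x (go (Rot.shape R) nj)) (σℕ-rots rs Rs j)
  where
  go : ∀ {r y ys} → r ≡ y ∷ ys → x ∉ r → nextCyc r x ≡ nothing
  go refl nj = nextCyc-nothing _ _ x nj

memB-∈ : ∀ {x} r → x ∈ r → memB x r ≡ true
memB-∈ {x} (y ∷ r) i with x ≡ᵇ y in e
... | true = refl
memB-∈ (y ∷ r) (here refl) | false = contradiction (trans (sym e) (≡ᵇ-refl y)) λ ()
memB-∈ (y ∷ r) (there i) | false = memB-∈ r i

memB-∉ : ∀ {x} r → x ∉ r → memB x r ≡ false
memB-∉ [] h = refl
memB-∉ {x} (y ∷ r) h rewrite ≡ᵇ-≢ {x} {y} (λ e → h (here e)) = memB-∉ r (h ∘ there)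

colℕ-rots : ∀ {f C d} rs → All (Rot f C) rs → ∀ {x} → x ∈ concat (map proj₁ rs) → colℕ d rs x ≡ C x
colℕ-rots ((r , c) ∷ rs) (R ∷ Rs) {x} i with x ∈ℕ? r
... | yes j rewrite memB-∈ r j = sym (All-lookup (Rot.color R) j)
... | no nj with ∈-++⁻ r i
...   | inj₁ j = contradiction j nj
...   | inj₂ j rewrite memB-∉ r nj = colℕ-rots rs Rs j

-- Labels of successive items around one vertex: after an item at `p` the contour is back at the
-- vertex at `suc (m p)`, having walked round the whole subtree if the item is a child.
data Chain (m : ℕ → ℕ) : ℕ → List ℕ → ℕ → Set where
  []  : ∀ {p} → Chain m p [] p
  _∷_ : ∀ {p L q} → p ≤ m p → Chain m (suc (m p)) L q → Chain m p (p ∷ L) q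

module _ {m : ℕ → ℕ} where

  chain-≤ : ∀ {p L q} → Chain m p L q → p ≤ q
  chain-≤ [] = ≤-refl
  chain-≤ (h ∷ ch) = ≤-trans (≤-trans h (n≤1+n _)) (chain-≤ ch)

  chain-bounds : ∀ {p L q} → Chain m p L q → All (λ x → p ≤ x × x < q) L
  chain-bounds [] = []
  chain-bounds (h ∷ ch) = (≤-refl , <-≤-trans (s≤s h) (chain-≤ ch)) ∷
    All-map (λ (a , b) → ≤-trans h (<⇒≤ a) , b) (chain-bounds ch)

  chain-incr : ∀ {p L q} → Chain m p L q → AllPairs _<_ L
  chain-incr [] = []
  chain-incr (h ∷ ch) = All-map (λ (a , b) → ≤-<-trans h a) (chain-bounds ch) ∷ chain-incr ch

  chain-head : ∀ {p L q} → Chain m p L q → ∃ λ y → ∃ λ ys → L ++ q ∷ [] ≡ y ∷ ys × y ≡ p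
  chain-head [] = _ , _ , refl , refl
  chain-head (h ∷ _) = _ , _ , refl , refl

  module _ {f : ℕ → ℕ} {N : ℕ} (f-suc : ∀ {x} → suc (m x) < N → f x ≡ suc (m x)) where

    chain-cyc : ∀ {a L q y} → Chain m a L q → q < N → f q ≡ y → Cyc f y (L ++ q ∷ [])
    chain-cyc [] lt e = last e
    chain-cyc (h ∷ []) lt e = link (f-suc lt) (last e)
    chain-cyc (h ∷ (h′ ∷ ch)) lt e = link (f-suc (≤-<-trans (chain-≤ (h′ ∷ ch)) lt)) (chain-cyc (h′ ∷ ch) lt e)

    chain-root : (∀ {x} → suc (m x) ≡ N → f x ≡ 0) → ∀ {a L} → Chain m a (a ∷ L) N → Cyc f 0 (a ∷ L)
    chain-root f0 (h ∷ []) = last (f0 refl)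
    chain-root f0 (h ∷ (h′ ∷ ch)) = link (f-suc (≤-trans (s≤s (≤-trans h′ ≤-refl)) (chain-≤ ch))) (chain-root f0 (h′ ∷ ch))

module _ {ty : ℕ → Letter} {m : ℕ → ℕ} where

  reads-labs : ∀ c {p is q} → Reads ty m p is q → Chain m p (Out.labs (walkItems c is p)) q
  reads-labs c done = []
  reads-labs c {p} (open′ {is = is} {q} t e r) = ≤-reflexive (sym e) ∷ subst (λ z → Chain m (suc z) _ q) (sym e) (reads-labs c r)
  reads-labs c {p} (close′ {is = is} {q} t e r) = ≤-reflexive (sym e) ∷ subst (λ z → Chain m (suc z) _ q) (sym e) (reads-labs c r)
  reads-labs c {p} (branch {q = q} t e r t′ e′ r′) with refl ← reads-next (flipC c) r =
    ≤-trans (<⇒≤ (reads-≤ r)) (≤-reflexive (sym e)) ∷ subst (λ z → Chain m (suc z) _ q) (sym e) (reads-labs c r′)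

  module _ (c₀ : Color) where
    private
      cw = colorAt ty c₀

    labs-color : ∀ c {p is q} → Reads ty m p is q → All (λ x → cw x ≡ cw p) (Out.labs (walkItems c is p))
    labs-color c done = []
    labs-color c {p} (open′ t e r) = refl ∷ All-map (λ h → trans h (color-stem {ty} {m} c₀ {p} (inj₁ t))) (labs-color c r)
    labs-color c {p} (close′ t e r) = refl ∷ All-map (λ h → trans h (color-stem {ty} {m} c₀ {p} (inj₂ t))) (labs-color c r)
    labs-color c (branch t e r t′ e′ r′) with refl ← reads-next (flipC c) r =
      refl ∷ All-map (λ h → trans h (color-past c₀ t r t′ r′)) (labs-color c r′)

    module _ {f : ℕ → ℕ} {N : ℕ} (f-suc : ∀ {x} → suc (m x) < N → f x ≡ suc (m x)) where

      reads-rots : ∀ {c p is q} → Reads ty m p is q → q ≤ N → c ≡ cw p → All (Rot f cw) (Out.rots (walkItems c is p))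
      reads-rots done le e = []
      reads-rots {c} {p} (open′ t _ r) le e = reads-rots r le (trans e (sym (color-stem {ty} {m} c₀ {p} (inj₁ t))))
      reads-rots {c} {p} (close′ t _ r) le e = reads-rots r le (trans e (sym (color-stem {ty} {m} c₀ {p} (inj₂ t))))
      reads-rots {c} {p} (branch {js = js} {u} {is} t e₁ r t′ e₂ r′) le e with refl ← reads-next (flipC c) r =
        record { first = proj₁ head ; rest = proj₁ (proj₂ head) ; shape = proj₁ (proj₂ (proj₂ head))
               ; cyc = subst (λ z → Cyc f z (L ++ u ∷ [])) (sym (proj₂ (proj₂ (proj₂ head)))) cyc′
               ; color = AllP.++⁺ (All-map (λ h → trans h col-child) (labs-color (flipC c) r)) (trans (reads-color c₀ r) col-child ∷ [])
               ; incr = AllPairsP.++⁺ (chain-incr ch) ([] ∷ []) (All-map (λ (_ , b) → b ∷ []) (chain-bounds ch)) }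
        ∷ AllP.++⁺ (reads-rots r (≤-trans (n≤1+n u) (≤-trans (reads-≤ r′) le)) (sym col-child))
                   (reads-rots r′ le (trans e (sym (color-past c₀ t r t′ r′))))
        where
        L = Out.labs (walkItems (flipC c) js (suc p))
        ch = reads-labs (flipC c) r
        col-child : cw (suc p) ≡ flipC c
        col-child = trans (color-dn {ty} {m} c₀ {p} t) (cong flipC (sym e))
        u<N : u < N
        u<N = ≤-trans (reads-≤ r′) le
        -- The half-edge `u` to the parent closes the rotation: `m u = p`, so `f` sends `u` to
        -- `suc p`, the first label at the child.
        cyc′ : Cyc f (suc p) (L ++ u ∷ [])
        cyc′ = chain-cyc {m} f-suc ch u<N (trans (f-suc (≤-<-trans (subst (λ z → suc z ≤ u) (sym e₂) (reads-≤ r)) u<N)) (cong suc e₂))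
        head = chain-head ch

data Interval : ℕ → List ℕ → ℕ → Set where
  []  : ∀ {p} → Interval p [] p
  _∷_ : ∀ p {xs q} → Interval (suc p) xs q → Interval p (p ∷ xs) q

interval-++ : ∀ {p xs u ys q} → Interval p xs u → Interval u ys q → Interval p (xs ++ ys) q
interval-++ [] J = J
interval-++ (p ∷ I) J = p ∷ interval-++ I J

interval-≤ : ∀ {p xs q} → Interval p xs q → p ≤ q
interval-≤ [] = ≤-refl
interval-≤ (p ∷ I) = ≤-trans (n≤1+n p) (interval-≤ I)

interval-∈ : ∀ {p xs q x} → Interval p xs q → p ≤ x → x < q → x ∈ xs
interval-∈ [] a b = contradiction b (≤⇒≯ a)
interval-∈ {x = x} (p ∷ I) a b with p ℕP.≟ x
... | yes refl = here refl
... | no ne = there (interval-∈ I (≤∧≢⇒< a ne) b)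

interval-bounds : ∀ {p xs q x} → Interval p xs q → x ∈ xs → p ≤ x × x < q
interval-bounds (p ∷ I) (here refl) = ≤-refl , interval-≤ I
interval-bounds (p ∷ I) (there i) = let (a , b) = interval-bounds I i in <⇒≤ a , b

interval-unique : ∀ {p xs q} → Interval p xs q → Unique xs
interval-unique [] = []
interval-unique (p ∷ I) = All-tabulate (λ i e → <-irrefl e (proj₁ (interval-bounds I i))) ∷ interval-unique I

orbitSize-lemma : ∀ {n} (f : Fin n → Fin n) (x : Fin n) (g : List ℕ → ℕ) →
  (∀ k ks → g (k ∷ ks) ≡ (if toℕ (iter f k x) ≡ᵇ toℕ x then k else g ks)) →
  ∀ {p ks q} → Interval p ks q → ∀ k → p ≤ k → k < q → iter f k x ≡ x → (∀ {j} → p ≤ j → j < k → iter f j x ≢ x) → g ks ≡ k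
orbitSize-lemma f x g g1 [] k a b e h = contradiction b (≤⇒≯ a)
orbitSize-lemma f x g g1 (_∷_ p {xs} I) k a b e h with toℕ (iter f p x) ≡ᵇ toℕ x in q
... | true = trans (trans (g1 p xs) (cong (λ z → if z then p else g xs) q)) (≤-antisym a (≮⇒≥ λ lt →
        h ≤-refl lt (toℕ-injective (≡ᵇ⇒≡ _ _ (Equivalence.from T-≡ q)))))
... | false = trans (trans (g1 p xs) (cong (λ z → if z then p else g xs) q)) (orbitSize-lemma f x g g1 I k
        (≤∧≢⇒< a (λ { refl → contradiction (trans (sym q) (trans (cong (λ z → toℕ z ≡ᵇ toℕ x) e) (≡ᵇ-refl (toℕ x)))) λ () })) b e
        (λ lt → h (<⇒≤ lt)))

-- The local `go` of `orbitSize` is captured by the same device as that of `nextCyc`.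
mutual
  orbitSize-go : ∀ n → (Fin n → Fin n) → Fin n → List ℕ → ℕ
  orbitSize-go = _

  orbitSize-go≡ : ∀ n (f : Fin n → Fin n) x → orbitSize n f x ≡ orbitSize-go n f x (map suc (upTo n))
  orbitSize-go≡ n f x with map suc (upTo n)
  ... | l = refl

interval-suc-upTo : ∀ (f : ℕ → ℕ) p n → (∀ i → suc (f i) ≡ p + i) → Interval p (map suc (applyUpTo f n)) (p + n)
interval-suc-upTo f p zero h = subst (Interval p []) (sym (+-identityʳ p)) []
interval-suc-upTo f p (suc n) h = subst₂ (λ a b → Interval p (a ∷ map suc (applyUpTo (f ∘ suc) n)) b)
  (sym (trans (h 0) (+-identityʳ p))) (sym (+-suc p n)) (p ∷ interval-suc-upTo (f ∘ suc) (suc p) n (λ i → trans (h (suc i)) (+-suc p i)))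

orbitSize-least : ∀ n (f : Fin n → Fin n) x k → 1 ≤ k → k ≤ n → iter f k x ≡ x →
  (∀ {j} → 1 ≤ j → j < k → iter f j x ≢ x) → orbitSize n f x ≡ k
orbitSize-least n f x k a b e h = trans (orbitSize-go≡ n f x)
  (orbitSize-lemma f x (orbitSize-go n f x) (λ _ _ → refl) (interval-suc-upTo id 1 n (λ _ → refl)) k a (s≤s b) e h)

rotLabels : List (List ℕ × Color) → List ℕ
rotLabels rs = concat (map proj₁ rs)

rotLabels-++ : ∀ rs rs′ → rotLabels (rs ++ rs′) ≡ rotLabels rs ++ rotLabels rs′
rotLabels-++ rs rs′ = trans (cong concat (map-++ proj₁ rs rs′)) (sym (concat-++ (map proj₁ rs) (map proj₁ rs′)))

private
  regroup : ∀ (A B C D : List ℕ) u {xs ys} → B ++ C ↭ xs → A ++ D ↭ ys →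
    A ++ ((B ++ u ∷ []) ++ (C ++ D)) ↭ xs ++ u ∷ ys
  regroup A B C D u {xs} {ys} P Q = ↭-trans (++⁺ˡ A step₁) (↭-trans (shift u A ((B ++ C) ++ D)) (↭-trans (prep u step₂) (↭-sym (shift u xs ys))))
    where
    step₁ : (B ++ u ∷ []) ++ (C ++ D) ↭ u ∷ ((B ++ C) ++ D)
    step₁ = subst₂ _↭_ (sym (++-assoc B (u ∷ []) (C ++ D))) (cong (u ∷_) (sym (++-assoc B C D))) (shift u B (C ++ D))
    step₂ : A ++ ((B ++ C) ++ D) ↭ xs ++ ys
    step₂ = ↭-trans (subst₂ _↭_ (++-assoc A (B ++ C) D) (++-assoc (B ++ C) A D) (++⁺ʳ D (++-comm A (B ++ C)))) (++⁺ P Q)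

-- Every label lies on exactly one vertex: the labels of a subtree, its parent half-edge `u` and the
-- labels of the later siblings reassemble to an interval.
walk-labels : ∀ {ty m} c {p is q} → Reads ty m p is q → let o = walkItems c is p in
  ∃ λ xs → Interval p xs q × Out.labs o ++ rotLabels (Out.rots o) ↭ xs
walk-labels c done = [] , [] , ↭-refl
walk-labels c {p} (open′ _ _ r) = let (xs , I , P) = walk-labels c r in p ∷ xs , p ∷ I , prep p P
walk-labels c {p} (close′ _ _ r) = let (xs , I , P) = walk-labels c r in p ∷ xs , p ∷ I , prep p P
walk-labels c {p} (branch {js = js} {u} {is} _ _ r _ _ r′) with refl ← reads-next (flipC c) r =
  let (xs , I , P) = walk-labels (flipC c) r
      (ys , J , Q) = walk-labels c r′
      ch = walkItems (flipC c) js (suc p)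
      o = walkItems c is (suc u)
  in p ∷ (xs ++ u ∷ ys) , p ∷ interval-++ I (u ∷ J) ,
     prep p (subst (λ z → Out.labs o ++ ((Out.labs ch ++ u ∷ []) ++ z) ↭ xs ++ u ∷ ys) (sym (rotLabels-++ (Out.rots ch) (Out.rots o)))
       (regroup (Out.labs o) (Out.labs ch) (rotLabels (Out.rots ch)) (rotLabels (Out.rots o)) u P Q))

-- Depths and the outer corner

depth-zero : ∀ {ty p s q j} → Stems ty p s q → j ≤ p → depth s j ≡ ℤ.+ 0
depth-zero nil le = refl
depth-zero {p = p} {j = j} (stemS _ _ S) le rewrite <ᵇ-false {p} {j} (≤⇒≯ le) = depth-zero S (≤-trans le (n≤1+n p))
depth-zero {p = p} (treeS _ S) le = depth-zero S (≤-trans le (n≤1+n p))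

stem-sign : Bool → ℤ
stem-sign b = if b then ℤ.+ 1 else -[1+ 0 ]

stem-sign-gain : ∀ b z → stem-sign b ℤ.+ (gain (stemLetter b) ℤ.+ z) ≡ z
stem-sign-gain true z = trans (sym (ℤP.+-assoc (ℤ.+ 1) -[1+ 0 ] z)) (ℤP.+-identityˡ z)
stem-sign-gain false z = trans (sym (ℤP.+-assoc -[1+ 0 ] (ℤ.+ 1) z)) (ℤP.+-identityˡ z)

tree-gain : ∀ {l} → TreeL l → gain l ≡ ℤ.+ 0
tree-gain (inj₁ refl) = refl
tree-gain (inj₂ refl) = refl

-- `depth` and `f` obey the same recurrence, so they differ by the constant `f p`. Corners of least
-- depth are therefore those of least height, although `depth` starts at 0 and ignores stems already
-- open at the root corner.
depth-stack : ∀ {ty p s q} (f : ℕ → ℤ) → Stems ty p s q → (∀ j → j < q → gain (ty j) ℤ.+ f (suc j) ≡ f j) →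
  ∀ {j} → p ≤ j → j ≤ q → depth s j ℤ.+ f p ≡ f j
depth-stack f nil h u v = trans (ℤP.+-identityˡ _) (cong f (≤-antisym u v))
depth-stack {p = p} f S₀@(stemS b {s = s} t S) h {j} u v with p ℕP.≟ j
... | yes refl = trans (cong (λ z → z ℤ.+ f p) (depth-zero S₀ ≤-refl)) (ℤP.+-identityˡ _)
... | no ne rewrite <ᵇ-true (≤∧≢⇒< u ne) = begin
  (stem-sign b ℤ.+ depth s j) ℤ.+ f p ≡⟨ cong (λ z → z ℤ.+ f p) (ℤP.+-comm (stem-sign b) (depth s j)) ⟩
  (depth s j ℤ.+ stem-sign b) ℤ.+ f p ≡⟨ ℤP.+-assoc (depth s j) (stem-sign b) (f p) ⟩
  depth s j ℤ.+ (stem-sign b ℤ.+ f p) ≡⟨ cong (λ z → depth s j ℤ.+ z) (trans (cong (λ z → stem-sign b ℤ.+ z)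
      (trans (sym (h p (stems-≤ S))) (cong (λ l → gain l ℤ.+ f (suc p)) t))) (stem-sign-gain b (f (suc p)))) ⟩
  depth s j ℤ.+ f (suc p) ≡⟨ depth-stack f S h (≤∧≢⇒< u ne) v ⟩
  f j ∎
  where open ≡-Reasoning
depth-stack {p = p} f S₀@(treeS {s = s} t S) h {j} u v with p ℕP.≟ j
... | yes refl = trans (cong (λ z → z ℤ.+ f p) (depth-zero S₀ ≤-refl)) (ℤP.+-identityˡ _)
... | no ne = trans (cong (λ z → depth s j ℤ.+ z) (sym (trans (sym (ℤP.+-identityˡ _))
    (trans (cong (λ g → g ℤ.+ f (suc p)) (sym (tree-gain t))) (h p (stems-≤ S)))))) (depth-stack f S h (≤∧≢⇒< u ne) v)

IsMin : (ℕ → ℤ) → List ℕ → ℕ × ℤ → Set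
IsMin g l (b , d) = d ≡ g b × (b ≡ 0 ⊎ b ∈ l) × (∀ {j} → j ∈ l → d ℤ.≤ g j)

foldr-min : (g : ℕ → ℤ) (step : ℕ → ℕ × ℤ → ℕ × ℤ) →
  (∀ j b d → step j (b , d) ≡ (if ⌊ g j ℤP.<? d ⌋ then (j , g j) else (b , d))) →
  ∀ l → IsMin g l (foldr step (0 , g 0) l)
foldr-min g step h [] = refl , inj₁ refl , λ ()
foldr-min g step h (j ∷ l) with foldr step (0 , g 0) l | foldr-min g step h l
... | b , d | e , w , min with g j ℤP.<? d | h j b d
...   | yes lt | q = subst (IsMin g (j ∷ l)) (sym q) (refl , inj₂ (here refl) , λ
          { (here refl) → ℤP.≤-refl ; (there i) → ℤP.<⇒≤ (ℤP.<-≤-trans lt (min i)) })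
...   | no nl | q = subst (IsMin g (j ∷ l)) (sym q) (e , Data.Sum.map₂ there w , λ
          { (here refl) → ℤP.≮⇒≥ nl ; (there i) → min i })

outerℕ-min : ∀ s n → outerℕ s (suc n) < suc n × (∀ j → j < suc n → depth s (outerℕ s (suc n)) ℤ.≤ depth s j)
outerℕ-min s n with foldr-min (depth s) _ (λ _ _ _ → refl) (reverse (upTo (suc n)))
... | e , w , min = bound w , λ j lt → subst (ℤ._≤ depth s j) e (min (reverse⁺ (∈-upTo⁺ lt)))
  where
  bound : ∀ {b} → b ≡ 0 ⊎ b ∈ reverse (upTo (suc n)) → b < suc n
  bound (inj₁ refl) = s≤s z≤n
  bound (inj₂ i) = ∈-upTo⁻ (reverse⁻ i)

-- Vertex degrees in the tree

vertexCount : ℕ → List (List ℕ × Color) → ℕ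
vertexCount k [] = 0
vertexCount k ((r , _) ∷ rs) = (if length r ≡ᵇ k then 1 else 0) + vertexCount k rs

vertexCount-++ : ∀ k rs rs′ → vertexCount k (rs ++ rs′) ≡ vertexCount k rs + vertexCount k rs′
vertexCount-++ k [] rs′ = refl
vertexCount-++ k ((r , _) ∷ rs) rs′ = trans (cong (_+_ (if length r ≡ᵇ k then 1 else 0)) (vertexCount-++ k rs rs′))
  (sym (+-assoc (if length r ≡ᵇ k then 1 else 0) _ _))

length-labs : ∀ c is p → length (Out.labs (walkItems c is p)) ≡ length is
length-labs c [] p = refl
length-labs c (opening ∷ is) p = cong suc (length-labs c is (suc p))
length-labs c (closing ∷ is) p = cong suc (length-labs c is (suc p))
length-labs c (child (node js) ∷ is) p = cong suc (length-labs c is _)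

degCount-walk : ∀ k c is p → degCountItems k is ≡ vertexCount k (Out.rots (walkItems c is p))
degCount-walk k c [] p = refl
degCount-walk k c (opening ∷ is) p = degCount-walk k c is (suc p)
degCount-walk k c (closing ∷ is) p = degCount-walk k c is (suc p)
degCount-walk k c (child (node js) ∷ is) p = begin
  a + degCountItems k js + degCountItems k is ≡⟨ +-assoc a _ _ ⟩
  a + (degCountItems k js + degCountItems k is) ≡⟨ cong₂ (λ l z → (if l ≡ᵇ k then 1 else 0) + z) (sym len)
      (trans (cong₂ _+_ (degCount-walk k (flipC c) js (suc p)) (degCount-walk k c is (suc (Out.next ch))))
             (sym (vertexCount-++ k (Out.rots ch) (Out.rots (walkItems c is (suc (Out.next ch))))))) ⟩
  vertexCount k (Out.rots (walkItems c (child (node js) ∷ is) p)) ∎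
  where
  open ≡-Reasoning
  a = if suc (length js) ≡ᵇ k then 1 else 0
  ch = walkItems (flipC c) js (suc p)
  len : length (Out.labs ch ++ Out.next ch ∷ []) ≡ suc (length js)
  len = trans (length-++ (Out.labs ch)) (trans (+-comm _ 1) (cong suc (length-labs (flipC c) js (suc p))))

-- The closure as a map

isStem : Letter → Bool
isStem opn = true
isStem cls = true
isStem dn = false
isStem up = false

stem-true : ∀ {l} → isStem l ≡ true → Stem l
stem-true {opn} e = inj₁ refl
stem-true {cls} e = inj₂ refl

stem-false : ∀ {l} → isStem l ≡ false → TreeL l
stem-false {dn} e = inj₁ refl
stem-false {up} e = inj₂ refl

true-stem : ∀ {l} → Stem l → isStem l ≡ true
true-stem (inj₁ refl) = refl
true-stem (inj₂ refl) = refl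

false-tree : ∀ {l} → TreeL l → isStem l ≡ false
false-tree (inj₁ refl) = refl
false-tree (inj₂ refl) = refl

letter-cases : ∀ l → Stem l ⊎ TreeL l
letter-cases opn = inj₁ (inj₁ refl)
letter-cases cls = inj₁ (inj₂ refl)
letter-cases dn = inj₂ (inj₁ refl)
letter-cases up = inj₂ (inj₂ refl)

toℕ-toFinOr : ∀ {N} (d : Fin N) v → v < N → toℕ (toFinOr d v) ≡ v
toℕ-toFinOr {N} d v lt with v <? N
... | yes p = toℕ-fromℕ< p
... | no np = contradiction lt np

inj⇒perm : ∀ {n} {f : Fin n → Fin n} → Inj f → IsPerm f
inj⇒perm {f = f} inj = (λ y → proj₁ (fin-surjective inj y)) , (λ x → inj (proj₂ (fin-surjective inj (f x)))) , λ y → proj₂ (fin-surjective inj y)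

flipC-≢ : ∀ {c} → flipC c ≢ c
flipC-≢ {black} ()
flipC-≢ {white} ()

-- Stated for any reading rather than for the word of the tree, so that it applies both to a given
-- tree and to the letters that `Parse` reads off a map. The length is `suc n` because a tree
-- without items closes to `vertexMap`.
module ClosureMap (c : Color) (is : List Item) {ty : ℕ → Letter} {m : ℕ → ℕ} {n : ℕ} (r : Reads ty m 0 is (suc n))
                  (charge0 : chargeItems is ≡ ℤ.+ 0) (wc : WCItems c is) where
  N : ℕ
  N = suc n

  walk : Out
  walk = walkItems c is 0

  M : CMap
  M = buildC c walk n

  open CMap M using (σ; α; root; outer; col)

  cw : ℕ → Color
  cw = colorAt ty c

  balanced : unmatched ty N ≡ length (stemStack ty N)
  balanced = sym (ℤP.+-injective (ℤP.i-j≡0⇒i≡j _ _ (trans (sym (ℤP.+-identityˡ _)) (trans (cong (λ z → z ℤ.+ f N) (sym charge0))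
    (charge-telescopes f r (λ j _ → stemStack-balance ty j))))))
    where
    f : ℕ → ℤ
    f j = ℤ.+ length (stemStack ty j) ℤ.- ℤ.+ unmatched ty j

  open StemPairs ty N balanced (Out.stems walk) (reads-stems c r) public

  ℓ : ℕ → ℕ
  ℓ j = length (cyc-stk j)

  local : ∀ x → x < N → Local {ty} {m} c ℓ x
  local x = wc⇒local c ℓ r cyc-steps wc x z≤n

  mates : ∀ x → x < N → At {ty} {m} N x
  mates x = reads-at r x z≤n

  m< : ∀ {x} → x < N → m x < N
  m< {x} lt with mates x lt
  ... | stem _ e = subst (_< N) (sym e) lt
  ... | down _ _ _ _ _ lt′ = lt′
  ... | upward _ _ r′ _ _ = <-trans (reads-≤ r′) lt

  mm : ∀ {x} → x < N → m (m x) ≡ x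
  mm {x} lt with mates x lt
  ... | stem _ e = trans (cong m e) e
  ... | down _ _ _ _ e _ = e
  ... | upward _ _ _ _ e = e

  m-stem : ∀ {x} → x < N → Stem (ty x) → m x ≡ x
  m-stem {x} lt s with mates x lt
  ... | stem _ e = e
  ... | down _ t _ _ _ _ = ⊥-elim (tree-or-stem {ty} {m} s (inj₁ t))
  ... | upward _ t _ _ _ = ⊥-elim (tree-or-stem {ty} {m} s (inj₂ t))

  m-tree : ∀ {x} → x < N → TreeL (ty x) → TreeL (ty (m x))
  m-tree {x} lt s with mates x lt
  ... | stem t _ = ⊥-elim (tree-or-stem {ty} {m} t s)
  ... | down _ _ _ t _ _ = inj₂ t
  ... | upward _ _ _ t _ = inj₁ t

  m-≢ : ∀ {x} → x < N → TreeL (ty x) → m x ≢ x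
  m-≢ {x} lt s with mates x lt
  ... | stem t _ = ⊥-elim (tree-or-stem {ty} {m} t s)
  ... | down _ _ r′ _ _ _ = λ e → <-irrefl (sym e) (reads-≤ r′)
  ... | upward _ _ r′ _ _ = λ e → <-irrefl e (reads-≤ r′)

  nxt : ℕ → ℕ
  nxt j with suc j ℕP.≟ N
  ... | yes _ = 0
  ... | no _ = suc j

  nxt-suc : ∀ {j} → suc j < N → nxt j ≡ suc j
  nxt-suc {j} lt with suc j ℕP.≟ N
  ... | yes e = contradiction lt (<-irrefl e)
  ... | no _ = refl

  nxt-0 : ∀ {j} → suc j ≡ N → nxt j ≡ 0
  nxt-0 {j} e with suc j ℕP.≟ N
  ... | yes _ = refl
  ... | no ne = contradiction e ne

  nxt-cases : ∀ {j} → j < N → (suc j < N × nxt j ≡ suc j) ⊎ (suc j ≡ N × nxt j ≡ 0)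
  nxt-cases {j} lt with suc j ℕP.≟ N
  ... | yes e = inj₂ (e , refl)
  ... | no ne = inj₁ (≤∧≢⇒< lt ne , refl)

  nxt< : ∀ {j} → j < N → nxt j < N
  nxt< lt with nxt-cases lt
  ... | inj₁ (a , e) = subst (_< N) (sym e) a
  ... | inj₂ (a , e) = subst (_< N) (sym e) (s≤s z≤n)

  nxt-inj : ∀ {i j} → i < N → j < N → nxt i ≡ nxt j → i ≡ j
  nxt-inj a b e with nxt-cases a | nxt-cases b
  ... | inj₁ (_ , p) | inj₁ (_ , q) = suc-injective (trans (sym p) (trans e q))
  ... | inj₁ (_ , p) | inj₂ (_ , q) = case trans (sym p) (trans e q) of λ ()
  ... | inj₂ (_ , p) | inj₁ (_ , q) = case trans (sym q) (trans (sym e) p) of λ ()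
  ... | inj₂ (p , _) | inj₂ (q , _) = suc-injective (trans p (sym q))

  nxt-invariant : ∀ {A : Set} (g : ℕ → A) → g N ≡ g 0 → ∀ {j} → j < N → g (nxt j) ≡ g (suc j)
  nxt-invariant g e lt with nxt-cases lt
  ... | inj₁ (_ , p) = cong g p
  ... | inj₂ (q , p) = trans (cong g p) (trans (sym e) (cong g (sym q)))

  rots : List (List ℕ × Color)
  rots = (Out.labs walk , c) ∷ Out.rots walk

  f : ℕ → ℕ
  f x = nxt (m x)

  rots-ok : All (Rot f cw) rots
  rots-ok = root-rot (reads-labs c r) (labs-color c c r) ∷ reads-rots c (λ {x} → nxt-suc {m x}) r ≤-refl refl
    where
    root-rot : ∀ {L} → Chain m 0 L N → All (λ x → cw x ≡ c) L → Rot f cw (L , c)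
    root-rot ch@(_ ∷ _) cs = record { first = 0 ; rest = _ ; shape = refl
      ; cyc = chain-root (λ {x} → nxt-suc {m x}) (λ {x} → nxt-0 {m x}) ch ; color = cs ; incr = chain-incr ch }

  labels-↭ : rotLabels rots ↭ upTo N
  labels-↭ with walk-labels c r
  ... | xs , I , P = ↭-trans P (unique-↭ (interval-unique I) (UniqueP.upTo⁺ N)
          (λ i → ∈-upTo⁺ (proj₂ (interval-bounds I i))) (λ i → interval-∈ I z≤n (∈-upTo⁻ i)))

  labels-cover : ∀ {x} → x < N → x ∈ rotLabels rots
  labels-cover lt = ∈-resp-↭ (↭-sym labels-↭) (∈-upTo⁺ lt)

  full : ℕ → ℕ
  full = αℕ (Out.alphas walk ++ symPairs pairs)

  full-tree : ∀ {x} → x < N → TreeL (ty x) → full x ≡ m x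
  full-tree {x} lt t = αℕ-found (Out.alphas walk) (symPairs pairs)
    (All-map (λ (_ , e) e′ → trans (sym e) (cong m e′)) (reads-alphas c r)) (alphas-cover c r z≤n lt t)

  full-stem : ∀ {x} → Stem (ty x) → full x ≡ mateS x
  full-stem {x} s = αℕ-miss (Out.alphas walk) (symPairs pairs)
    (All-map (λ { (t , _) refl → tree-or-stem {ty} {m} s t }) (reads-alphas c r))

  full-facts : ∀ {x} → x < N → full x < N × full (full x) ≡ x × full x ≢ x
  full-facts {x} lt with letter-cases (ty x)
  ... | inj₂ t = subst (_< N) (sym e) (m< lt) ,
                 trans (cong full e) (trans (full-tree (m< lt) (m-tree lt t)) (mm lt)) , λ e′ → m-≢ lt t (trans (sym e) e′)
    where e = full-tree lt t
  ... | inj₁ (inj₁ t) = subst (_< N) (sym e) mate< , trans (cong full e) (trans (full-stem (inj₂ mate-ty)) mate-mate) ,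
                        λ e′ → case trans (sym t) (trans (cong ty (trans (sym e′) e)) mate-ty) of λ ()
    where
    e = full-stem (inj₁ t)
    open OpnFacts (opn-facts lt t)
  ... | inj₁ (inj₂ t) = subst (_< N) (sym e) mate< , trans (cong full e) (trans (full-stem (inj₁ mate-ty)) mate-mate) ,
                        λ e′ → case trans (sym t) (trans (cong ty (trans (sym e′) e)) mate-ty) of λ ()
    where
    e = full-stem (inj₂ t)
    open ClsFacts (cls-facts lt t)

  toℕ-σ : ∀ x → toℕ (σ x) ≡ f (toℕ x)
  toℕ-σ x = trans (toℕ-toFinOr x _ (subst (_< N) (sym e) (nxt< (m< (toℕ<n x))))) e
    where e = σℕ-rots rots rots-ok (labels-cover (toℕ<n x))

  toℕ-α : ∀ x → toℕ (α x) ≡ full (toℕ x)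
  toℕ-α x = toℕ-toFinOr x _ (proj₁ (full-facts (toℕ<n x)))

  col-cw : ∀ x → col x ≡ cw (toℕ x)
  col-cw x = colℕ-rots rots rots-ok (labels-cover (toℕ<n x))

  cw-m : ∀ {x} → x < N → TreeL (ty x) → cw (m x) ≡ flipC (cw x)
  cw-m {x} lt t with mates x lt
  ... | stem s _ = ⊥-elim (tree-or-stem {ty} {m} s t)
  ... | down _ t′ r′ _ _ _ = trans (reads-color c r′) (color-dn {ty} {m} c {x} t′)
  ... | upward _ _ r′ t′ _ = sym (trans (cong flipC (trans (reads-color c r′) (color-dn {ty} {m} c {m x} t′))) (flipC-flipC _))

  cw-tree : ∀ {x} → TreeL (ty x) → cw (suc x) ≡ flipC (cw x)
  cw-tree {x} (inj₁ t) = color-dn {ty} {m} c {x} t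
  cw-tree {x} (inj₂ t) = color-up {ty} {m} c {x} t

  cw-f : ∀ {x} → x < N → cw (f x) ≡ cw x
  cw-f {x} lt with letter-cases (ty x)
  ... | inj₁ s = trans (nxt-invariant cw (reads-color c r) (m< lt)) (trans (cong (cw ∘ suc) (m-stem lt s)) (color-stem {ty} {m} c {x} s))
  ... | inj₂ t = trans (nxt-invariant cw (reads-color c r) (m< lt)) (trans (cw-tree (m-tree lt t))
                   (trans (cong flipC (cw-m lt t)) (flipC-flipC _)))

  opn-black : ∀ {x} → x < N → ty x ≡ opn → cw x ≡ black
  opn-black lt = proj₁ (local _ lt)

  cls-white : ∀ {x} → x < N → ty x ≡ cls → cw x ≡ white
  cls-white lt = proj₁ (proj₂ (local _ lt))

  cw-full : ∀ {x} → x < N → cw (full x) ≡ flipC (cw x)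
  cw-full {x} lt with letter-cases (ty x)
  ... | inj₂ t = trans (cong cw (full-tree lt t)) (cw-m lt t)
  ... | inj₁ (inj₁ t) = trans (cong cw (full-stem (inj₁ t))) (trans (cls-white mate< mate-ty) (cong flipC (sym (opn-black lt t))))
    where open OpnFacts (opn-facts lt t)
  ... | inj₁ (inj₂ t) = trans (cong cw (full-stem (inj₂ t))) (trans (opn-black mate< mate-ty) (cong flipC (sym (cls-white lt t))))
    where open ClsFacts (cls-facts lt t)

  laws : MapLaws M
  laws = record
    { σ-inj = λ {x} {y} e → toℕ-injective (trans (sym (mm (toℕ<n x))) (trans (cong m
        (nxt-inj (m< (toℕ<n x)) (m< (toℕ<n y)) (trans (sym (toℕ-σ x)) (trans (cong toℕ e) (toℕ-σ y))))) (mm (toℕ<n y))))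
    ; αα = λ x → toℕ-injective (trans (toℕ-α (α x)) (trans (cong full (toℕ-α x)) (proj₁ (proj₂ (full-facts (toℕ<n x))))))
    ; α≢ = λ x e → proj₂ (proj₂ (full-facts (toℕ<n x))) (trans (sym (toℕ-α x)) (cong toℕ e))
    ; col-σ = λ x → trans (col-cw (σ x)) (trans (cong cw (toℕ-σ x)) (trans (cw-f (toℕ<n x)) (sym (col-cw x))))
    ; col-α = λ x → trans (col-cw (α x)) (trans (cong cw (toℕ-α x)) (trans (cw-full (toℕ<n x)) (cong flipC (sym (col-cw x))))) }

  open MapLaws laws public using (αα; α≢; σ-inj)

  lab : ℕ → Fin N
  lab = toFinOr fzero

  toℕ-lab : ∀ {j} → j < N → toℕ (lab j) ≡ j
  toℕ-lab {j} = toℕ-toFinOr fzero j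

  lab-toℕ : ∀ x → lab (toℕ x) ≡ x
  lab-toℕ x = toℕ-injective (toℕ-lab (toℕ<n x))

  st : Fin N → Bool
  st x = isStem (ty (toℕ x))

  stk : Fin N → List (Fin N)
  stk x = map lab (cyc-stk (toℕ x))

  open Contour M st

  treeMate-m : ∀ x → toℕ (treeMate x) ≡ m (toℕ x)
  treeMate-m x with letter-cases (ty (toℕ x))
  ... | inj₁ s rewrite true-stem s = sym (m-stem (toℕ<n x) s)
  ... | inj₂ t rewrite false-tree t = trans (toℕ-α x) (full-tree (toℕ<n x) t)

  toℕ-τ : ∀ x → toℕ (τ x) ≡ nxt (toℕ x)
  toℕ-τ x = trans (toℕ-σ (treeMate x)) (trans (cong f (treeMate-m x)) (cong nxt (mm (toℕ<n x))))

  stk-τ : ∀ x → stk (τ x) ≡ map lab (cyc-stk (suc (toℕ x)))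
  stk-τ x = cong (map lab) (trans (cong cyc-stk (toℕ-τ x)) (nxt-invariant cyc-stk cyc-wrap (toℕ<n x)))

  st-α : ∀ x → st (α x) ≡ st x
  st-α x = trans (cong (isStem ∘ ty) (toℕ-α x)) (go (letter-cases (ty (toℕ x))))
    where
    lt = toℕ<n x
    go : Stem (ty (toℕ x)) ⊎ TreeL (ty (toℕ x)) → isStem (ty (full (toℕ x))) ≡ isStem (ty (toℕ x))
    go (inj₂ t) = trans (cong (isStem ∘ ty) (full-tree lt t)) (trans (false-tree (m-tree lt t)) (sym (false-tree t)))
    go (inj₁ (inj₁ t)) = trans (cong (isStem ∘ ty) (full-stem (inj₁ t)))
      (trans (cong isStem (OpnFacts.mate-ty (opn-facts lt t))) (sym (cong isStem t)))
    go (inj₁ (inj₂ t)) = trans (cong (isStem ∘ ty) (full-stem (inj₂ t)))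
      (trans (cong isStem (ClsFacts.mate-ty (cls-facts lt t))) (sym (cong isStem t)))

  stem-black : ∀ {x} → st x ≡ true → col x ≡ black → ty (toℕ x) ≡ opn
  stem-black {x} s cb with stem-true s
  ... | inj₁ t = t
  ... | inj₂ t = case trans (sym cb) (trans (col-cw x) (cls-white (toℕ<n x) t)) of λ ()

  stem-white : ∀ {x} → st x ≡ true → col x ≡ white → ty (toℕ x) ≡ cls
  stem-white {x} s cb with stem-true s
  ... | inj₂ t = t
  ... | inj₁ t = case trans (sym cb) (trans (col-cw x) (opn-black (toℕ<n x) t)) of λ ()

  α-stem : ∀ x → Stem (ty (toℕ x)) → toℕ (α x) ≡ mateS (toℕ x)
  α-stem x s = trans (toℕ-α x) (full-stem s)

  -- Along a face the walk goes from an opening stem to the corner after its partner, where it has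
  -- been popped again, and from a closing stem to the corner after its partner, where that has just
  -- been pushed.
  level : ∀ x → stk (σ (α x)) ≡ stk x
  level x = cong (map lab) (trans (cong cyc-stk (trans (toℕ-σ (α x)) (cong f (toℕ-α x)))) (go (letter-cases (ty (toℕ x)))))
    where
    lt = toℕ<n x
    go : Stem (ty (toℕ x)) ⊎ TreeL (ty (toℕ x)) → cyc-stk (f (full (toℕ x))) ≡ cyc-stk (toℕ x)
    go (inj₂ t) = trans (cong (cyc-stk ∘ nxt) (trans (cong m (full-tree lt t)) (mm lt)))
      (trans (nxt-invariant cyc-stk cyc-wrap lt) (cyc-tree t))
    go (inj₁ (inj₁ t)) = trans (cong (cyc-stk ∘ nxt) (trans (cong m (full-stem (inj₁ t))) (m-stem mate< (inj₂ mate-ty))))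
      (trans (nxt-invariant cyc-stk cyc-wrap mate<) (∷-injectiveʳ (trans (sym (ClsFacts.mate-stk (cls-facts mate< mate-ty))) mate-stk)))
      where open OpnFacts (opn-facts lt t)
    go (inj₁ (inj₂ t)) = trans (cong (cyc-stk ∘ nxt) (trans (cong m (full-stem (inj₂ t))) (m-stem mate< (inj₁ mate-ty))))
      (trans (nxt-invariant cyc-stk cyc-wrap mate<) (trans (cyc-opn mate-ty) (trans (cong (mateS (toℕ x) ∷_) mate-stk′) (sym mate-stk))))
      where open ClsFacts (cls-facts lt t)

  -- `outer` has least depth, hence least height, and by `cyc-empty` the least height is 0.
  outer-stk : cyc-stk (toℕ outer) ≡ []
  outer-stk with cyc-empty (s≤s z≤n)
  ... | j , j< , e = length-0 (cyc-stk (toℕ outer)) (n≤0⇒n≡0 (ℤP.drop‿+≤+ (subst₂ ℤ._≤_ (heightℤ (toℕ<n outer))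
          (trans (heightℤ j<) (cong (λ s → ℤ.+ length s) e))
          (ℤP.+-monoˡ-≤ (ℤ.+ ℓ 0) (subst (λ k → depth (Out.stems walk) k ℤ.≤ depth (Out.stems walk) j) (sym outer≡) (proj₂ min j j<))))))
    where
    min = outerℕ-min (Out.stems walk) n
    outer≡ : toℕ outer ≡ outerℕ (Out.stems walk) N
    outer≡ = toℕ-lab (proj₁ min)
    heightℤ : ∀ {j} → j < N → depth (Out.stems walk) j ℤ.+ ℤ.+ ℓ 0 ≡ ℤ.+ ℓ j
    heightℤ lt = depth-stack (λ j → ℤ.+ ℓ j) (reads-stems c r) cyc-steps z≤n (<⇒≤ lt)
    length-0 : ∀ {A : Set} (xs : List A) → length xs ≡ 0 → xs ≡ []
    length-0 [] e = refl

  stk-∷ : ∀ {x b s} → stk x ≡ b ∷ s → stk b ≡ s × ty (toℕ b) ≡ opn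
  stk-∷ {x} {b} {s} e = go (cyc-stk (toℕ x)) refl e
    where
    go : ∀ l → cyc-stk (toℕ x) ≡ l → map lab l ≡ b ∷ s → stk b ≡ s × ty (toℕ b) ≡ opn
    go (a ∷ l) q refl with cyc-nested (<⇒≤ (toℕ<n x)) q
    ... | e′ , lt , t = cong (map lab) (trans (cong cyc-stk (toℕ-lab lt)) e′) , trans (cong ty (toℕ-lab lt)) t

  -- If `w` is the first passage of its edge, this is charge at most 1 for the black child. If it is
  -- the second, `w` belongs to a white child, whose nonnegative charge gives even `ℓ w ≤ ℓ (m w)`.
  tree-bound : ∀ {w} → w < N → TreeL (ty w) → cw w ≡ white → ℓ w ≤ suc (ℓ (m w))
  tree-bound {w} lt t cw′ with mates w lt
  ... | stem s _ = ⊥-elim (tree-or-stem {ty} {m} s t)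
  ... | down _ t′ _ _ _ _ = proj₁ (proj₂ (proj₂ (local w lt)) t′) cw′
  ... | upward _ _ r′ t′ e = ≤-trans (subst (λ z → ℓ z ≤ ℓ (m w)) e (proj₂ (proj₂ (proj₂ (local (m w) (m< lt))) t′) cb)) (n≤1+n _)
    where
    cb : cw (m w) ≡ black
    cb = trans (cw-m lt t) (cong flipC cw′)

  length-stk : ∀ x → length (stk x) ≡ ℓ (toℕ x)
  length-stk x = length-map lab (cyc-stk (toℕ x))

  opened : Opened M
  opened = record
    { st = st ; stk = stk ; st-α = st-α
    ; neutral = λ {y} e → trans (stk-τ y) (cong (map lab) (cyc-tree (stem-false e)))
    ; push = λ {y} s cb → let t = stem-black s cb in
        trans (stk-τ y) (trans (cong (map lab) (cyc-opn t)) (cong (_∷ stk y) (lab-toℕ y))) ,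
        trans (cong (map lab ∘ cyc-stk) (α-stem y (inj₁ t)))
          (trans (cong (map lab) (OpnFacts.mate-stk (opn-facts (toℕ<n y) t))) (cong (_∷ stk y) (lab-toℕ y)))
    ; pop = λ {y} s cb → let t = stem-white s cb in
        trans (cong (map lab) (ClsFacts.mate-stk (cls-facts (toℕ<n y) t)))
          (cong₂ _∷_ (trans (cong lab (sym (α-stem y (inj₂ t)))) (lab-toℕ (α y))) (sym (stk-τ y)))
    ; level = level
    ; nested = λ {y} e → proj₁ (stk-∷ {y} e)
    ; outer-empty = cong (map lab) outer-stk
    ; top = λ {y} {b} e → let t = proj₂ (stk-∷ {y} e) in
        cong isStem t , trans (col-cw b) (opn-black (toℕ<n b) t)
    ; bound = λ {w} cw′ → subst₂ (λ a b → a ≤ suc b) (sym (length-stk w)) (sym (length-stk (α w)))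
        (bound w (trans (sym (col-cw w)) cw′)) }
    where
    bound : ∀ w → cw (toℕ w) ≡ white → ℓ (toℕ w) ≤ suc (ℓ (toℕ (α w)))
    bound w cw′ with letter-cases (ty (toℕ w))
    ... | inj₂ t = subst (λ z → ℓ (toℕ w) ≤ suc (ℓ z)) (sym (trans (toℕ-α w) (full-tree (toℕ<n w) t))) (tree-bound (toℕ<n w) t cw′)
    ... | inj₁ (inj₁ t) = case trans (sym cw′) (opn-black (toℕ<n w) t) of λ ()
    ... | inj₁ (inj₂ t) = ≤-reflexive (trans (cong length (trans (ClsFacts.mate-stk fs) (cong (mateS (toℕ w) ∷_) (sym (ClsFacts.mate-stk′ fs)))))
            (cong (suc ∘ ℓ) (sym (α-stem w (inj₂ t)))))
      where fs = cls-facts (toℕ<n w) t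

  toℕ-iter : ∀ j → j < N → toℕ (iter τ j root) ≡ j
  toℕ-iter zero lt = refl
  toℕ-iter (suc j) lt = trans (toℕ-τ (iter τ j root)) (trans (cong nxt (toℕ-iter j (<-trans (n<1+n j) lt))) (nxt-suc lt))

  enum : Enum τ root
  enum = record
    { pos = toℕ ; pos< = toℕ<n
    ; iter-pos = λ y → toℕ-injective (toℕ-iter (toℕ y) (toℕ<n y))
    ; pos-iter = λ {j} → toℕ-iter j
    ; iter-n = toℕ-injective (trans (toℕ-τ (iter τ n root)) (trans (cong nxt (toℕ-iter n (n<1+n n))) (nxt-0 refl))) }

  -- A tight tree edge met first at its black end would lead to a white child of charge -1.
  good : Good M opened enum
  good {b} cb sb tight with letter-cases (ty (toℕ b))
  ... | inj₁ s = case trans (sym sb) (true-stem s) of λ ()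
  ... | inj₂ t with mates (toℕ b) (toℕ<n b)
  ...   | stem s _ = ⊥-elim (tree-or-stem {ty} {m} s t)
  ...   | upward _ _ r′ _ _ = subst (_< toℕ b) (sym (trans (toℕ-α b) (full-tree (toℕ<n b) t))) (reads-≤ r′)
  ...   | down _ t′ _ _ _ _ = contradiction (proj₂ (proj₂ (proj₂ (local (toℕ b) (toℕ<n b))) t′) (trans (sym (col-cw b)) cb))
            (<⇒≱ (≤-reflexive (trans (cong suc (sym (length-stk b))) (trans (sym tight) (trans (length-stk (α b))
              (cong ℓ (trans (toℕ-α b) (full-tree (toℕ<n b) t))))))))

  layout : Layout M
  layout = EnumProps.layout laws opened enum good

  private
    τ-inj′ : Inj τ
    τ-inj′ = τ-inj st-α αα σ-inj

    -- The second use of `Stack`, now with `treeMate`: the tree edges between the root and the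
    -- current vertex. Their nesting yields Euler's formula for the closure.
    tstk : Fin N → List (Fin N)
    tstk x = map lab (treeStack ty (toℕ x))
    tstk-τ : ∀ x → tstk (τ x) ≡ map lab (treeStack ty (suc (toℕ x)))
    tstk-τ x = cong (map lab) (trans (cong (treeStack ty) (toℕ-τ x)) (nxt-invariant (treeStack ty) (reads-treeStack r) (toℕ<n x)))
    dn-step : ∀ {x} → ty x ≡ dn → treeStack ty (suc x) ≡ x ∷ treeStack ty x
    dn-step {x} t = cong (λ l → stepT l x (treeStack ty x)) t
    up-step : ∀ {x} → ty x ≡ up → treeStack ty (suc x) ≡ drop 1 (treeStack ty x)
    up-step {x} t = cong (λ l → stepT l x (treeStack ty x)) t
    stem-step : ∀ {x} → Stem (ty x) → treeStack ty (suc x) ≡ treeStack ty x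
    stem-step {x} (inj₁ t) = cong (λ l → stepT l x (treeStack ty x)) t
    stem-step {x} (inj₂ t) = cong (λ l → stepT l x (treeStack ty x)) t
    down-stk : ∀ {x js} → ty x ≡ dn → Reads ty m (suc x) js (m x) → treeStack ty (m x) ≡ x ∷ treeStack ty x
    down-stk t r′ = trans (reads-treeStack r′) (dn-step t)
    up-stk : ∀ {x js} → ty (m x) ≡ dn → Reads ty m (suc (m x)) js x → treeStack ty x ≡ m x ∷ treeStack ty (m x)
    up-stk t r′ = trans (reads-treeStack r′) (dn-step t)
    at-mate : ∀ x → tstk (treeMate x) ≡ map lab (treeStack ty (m (toℕ x)))
    at-mate x = cong (map lab ∘ treeStack ty) (treeMate-m x)
    down-push : ∀ x {js} → ty (toℕ x) ≡ dn → Reads ty m (suc (toℕ x)) js (m (toℕ x)) →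
      tstk (τ x) ≡ x ∷ tstk x × tstk (treeMate x) ≡ x ∷ tstk x
    down-push x t r′ = trans (tstk-τ x) (trans (cong (map lab) (dn-step t)) (cong (_∷ tstk x) (lab-toℕ x))) ,
      trans (at-mate x) (trans (cong (map lab) (down-stk t r′)) (cong (_∷ tstk x) (lab-toℕ x)))
    kind : ∀ x → (treeMate x ≡ x × tstk (τ x) ≡ tstk x) ⊎ (tstk (τ x) ≡ x ∷ tstk x × tstk (treeMate x) ≡ x ∷ tstk x) ⊎
                 (tstk x ≡ treeMate x ∷ tstk (τ x))
    kind x with mates (toℕ x) (toℕ<n x)
    ... | stem s e = inj₁ (toℕ-injective (trans (treeMate-m x) e) , trans (tstk-τ x) (cong (map lab) (stem-step s)))
    ... | down _ t r′ _ _ _ = inj₂ (inj₁ (down-push x t r′))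
    ... | upward _ t r′ t′ _ = inj₂ (inj₂ (trans (cong (map lab) (up-stk t′ r′)) (cong₂ _∷_
            (trans (cong lab (sym (treeMate-m x))) (lab-toℕ (treeMate x)))
            (sym (trans (tstk-τ x) (cong (map lab) (trans (up-step t) (cong (drop 1) (up-stk t′ r′)))))))))
    level′ : ∀ x → tstk (τ (treeMate x)) ≡ tstk x
    level′ x = trans (tstk-τ (treeMate x)) (cong (map lab) (trans (cong (treeStack ty ∘ suc) (treeMate-m x)) (go (mates (toℕ x) (toℕ<n x)))))
      where
      go : At {ty} {m} N (toℕ x) → treeStack ty (suc (m (toℕ x))) ≡ treeStack ty (toℕ x)
      go (stem s e) = trans (cong (treeStack ty ∘ suc) e) (stem-step s)
      go (down _ t r′ t′ _ _) = trans (up-step t′) (cong (drop 1) (down-stk t r′))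
      go (upward _ _ r′ t′ _) = trans (dn-step t′) (sym (up-stk t′ r′))
    nested′ : ∀ {x b s} → tstk x ≡ b ∷ s → tstk b ≡ s
    nested′ {x} {b} {s} e = go (treeStack ty (toℕ x)) refl e
      where
      go : ∀ l → treeStack ty (toℕ x) ≡ l → map lab l ≡ b ∷ s → tstk b ≡ s
      go (a ∷ l) q refl with treeStack-nested ty (toℕ x) {[]} q
      ... | e′ , lt = cong (map lab) (trans (cong (treeStack ty) (toℕ-lab (<-trans lt (toℕ<n x)))) e′)

    tree-stack : Stack τ treeMate
    tree-stack = record { stk = tstk ; kind = kind ; level = level′ ; nested = λ {x} → nested′ {x} }

    tree-pushes : ∀ {y} → st y ≡ false → toℕ y < toℕ (α y) → Stack.Push tree-stack y
    tree-pushes {y} s lt with mates (toℕ y) (toℕ<n y)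
    ... | stem t _ = case trans (sym s) (true-stem t) of λ ()
    ... | upward _ t r′ _ _ = contradiction (subst (toℕ y <_) (trans (toℕ-α y) (full-tree (toℕ<n y) (inj₂ t))) lt) (<-asym (reads-≤ r′))
    ... | down _ t r′ _ _ _ = down-push y t r′

  isMap : IsRBPMap (edgeMap M)
  isMap = inj⇒perm σ-inj , αα , α≢ , connected , EnumProps.tree-stack⇒euler laws opened enum tree-stack tree-pushes ,
    MapLaws.col-σ laws , λ x e → flipC-≢ (trans (sym (MapLaws.col-α laws x)) e)
    where
    connected : ∀ x y → Reach σ α x y
    connected x y = let (k , e) = orb-trans (orb-sym τ-inj′ (Enum.reach enum x)) (Enum.reach enum y) in subst (Reach σ α x) e (reach-iter x k)

  root-col : col root ≡ c
  root-col = col-cw root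

-- Rebuilding the tree from an opening

-- The last argument tells whether the half-edge is passed before its mate.
letterOf : Bool → Color → Bool → Letter
letterOf true black _ = opn
letterOf true white _ = cls
letterOf false _ true = dn
letterOf false _ false = up

drop-[]-mono : ∀ {A : Set} {i j} (xs : List A) → i ≤ j → drop i xs ≡ [] → drop j xs ≡ []
drop-[]-mono {j = j} [] le e = drop-[] j
drop-[]-mono (x ∷ xs) (s≤s le) e = drop-[]-mono xs le e

closure-edgeMap : ∀ c is {ty m n} → Reads ty m 0 is (suc n) → closure (ctree c (node is)) ≡ edgeMap (buildC c (walkItems c is 0) n)
closure-edgeMap c is r = cong (mkMap c (walkItems c is 0)) (reads-next c r)

module Parse {M : CMap} (laws : MapLaws M) (O : Opened M) (enum : Enum (Contour.τ M (Opened.st O)) (CMap.root M))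
             (good : Good M O enum) (euler : EnumProps.Euler laws O enum)
             {n : ℕ} (size≡ : CMap.size M ≡ suc n) where
  open CMap M
  open MapLaws laws
  open Opened O using (st; stk; st-α; neutral; push; pop; outer-empty; bound)
  open EnumProps laws O enum using (τ; treeMate; treeMate-tree; treeMate-stem; treeMate-inv; τ-treeMate; h; noncrossing; empty⇒outer; white-stk)
  open Enum enum

  letter : Fin size → Letter
  letter x = letterOf (st x) (col x) (does (pos x <? pos (α x)))

  ty : ℕ → Letter
  ty j with j <? size
  ... | yes _ = letter (h j)
  ... | no _ = up

  ty-letter : ∀ {j} → j < size → ty j ≡ letter (h j)
  ty-letter {j} lt with j <? size
  ... | yes _ = refl
  ... | no nl = contradiction lt nl

  m : ℕ → ℕ
  m j = pos (treeMate (h j))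

  h-m : ∀ j → h (m j) ≡ treeMate (h j)
  h-m j = iter-pos (treeMate (h j))

  pos-h : ∀ {j} → j < size → pos (h j) ≡ j
  pos-h = pos-iter

  mm : ∀ {j} → j < size → m (m j) ≡ j
  mm {j} lt = trans (cong (pos ∘ treeMate) (h-m j)) (trans (cong pos (treeMate-inv st-α αα (h j))) (pos-h lt))

  m< : ∀ j → m j < size
  m< j = pos< _

  h-size : h size ≡ root
  h-size = iter-n

  data Kind (j : ℕ) : Set where
    kopn : ty j ≡ opn → st (h j) ≡ true → col (h j) ≡ black → Kind j
    kcls : ty j ≡ cls → st (h j) ≡ true → col (h j) ≡ white → Kind j
    kdn  : ty j ≡ dn → st (h j) ≡ false → h (m j) ≡ α (h j) → j < m j → Kind j
    kup  : ty j ≡ up → st (h j) ≡ false → h (m j) ≡ α (h j) → m j < j → Kind j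

  kind : ∀ {j} → j < size → Kind j
  kind {j} lt with bool-cases (st (h j)) | color-cases (col (h j))
  ... | inj₁ s | inj₁ c = kopn (trans (ty-letter lt) (cong₂ (λ a b → letterOf a b (does (pos (h j) <? pos (α (h j))))) s c)) s c
  ... | inj₁ s | inj₂ c = kcls (trans (ty-letter lt) (cong₂ (λ a b → letterOf a b (does (pos (h j) <? pos (α (h j))))) s c)) s c
  ... | inj₂ s | _ with <-cmp (pos (h j)) (pos (α (h j)))
  ...   | tri≈ _ e _ = contradiction (sym (pos-inj e)) (α≢ (h j))
  ...   | tri< a _ _ = kdn (trans (ty-letter lt) (cong₂ (λ a b → letterOf a (col (h j)) b) s (dec-true (pos (h j) <? pos (α (h j))) a))) s
            (trans (h-m j) (treeMate-tree s)) (subst₂ _<_ (pos-h lt) (cong pos (sym (treeMate-tree s))) a)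
  ...   | tri> na _ b = kup (trans (ty-letter lt) (cong₂ (λ a b → letterOf a (col (h j)) b) s (dec-false (pos (h j) <? pos (α (h j))) na))) s
            (trans (h-m j) (treeMate-tree s)) (subst₂ _<_ (cong pos (sym (treeMate-tree s))) (pos-h lt) b)

  m-stem : ∀ {j} → j < size → st (h j) ≡ true → m j ≡ j
  m-stem lt s = trans (cong pos (treeMate-stem s)) (pos-h lt)

  mate-unstemmed : ∀ {j} → j < size → m j ≢ j → st (h j) ≡ false
  mate-unstemmed {j} lt ne with bool-cases (st (h j))
  ... | inj₁ s = contradiction (m-stem lt s) ne
  ... | inj₂ s = s

  no-crossing : ∀ {p x} → p < size → x < size → p < x → x < m p → m p < m x → ⊥
  no-crossing {p} {x} p< x< a b c = noncrossing euler sp sx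
    (subst₂ _<_ (sym (pos-h p<)) (sym (pos-h x<)) a)
    (subst₂ _<_ (sym (pos-h x<)) (cong pos (treeMate-tree sp)) b)
    (subst₂ _<_ (cong pos (treeMate-tree sp)) (cong pos (treeMate-tree sx)) c)
    where
    sp = mate-unstemmed p< (λ e → <-irrefl (sym e) (<-trans a b))
    sx = mate-unstemmed x< (λ e → <-irrefl (sym e) (<-trans b c))

  Closed : ℕ → ℕ → Set
  Closed p q = ∀ x → p ≤ x → x < q → p ≤ m x × m x < q

  -- Recursive descent on an interval of labels closed under mates. A `dn` at `p` with mate `u`
  -- splits it into the labels between `p` and `u` and those after `u`; since mates do not cross,
  -- both parts are closed again. `k` bounds the length of the interval and makes the recursion
  -- structural.
  parse : ∀ k p q → p ≤ q → q ≤ size → q ≤ p + k → Closed p q → ∃ λ is → Reads ty m p is q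
  parse k p q p≤q q≤ fuel cl with p ℕP.≟ q
  ... | yes refl = [] , done
  parse zero p q p≤q q≤ fuel cl | no ne = contradiction (≤-antisym p≤q (≤-trans fuel (≤-reflexive (+-identityʳ p)))) ne
  parse (suc k) p q p≤q q≤ fuel cl | no ne = go (kind p<size)
    where
    p<q : p < q
    p<q = ≤∧≢⇒< p≤q ne
    p<size : p < size
    p<size = <-≤-trans p<q q≤
    fuel′ : q ≤ suc p + k
    fuel′ = ≤-trans fuel (≤-reflexive (+-suc p k))
    mate-inj : ∀ {x y} → x < q → y < q → m x ≡ m y → x ≡ y
    mate-inj a b e = trans (sym (mm (<-≤-trans a q≤))) (trans (cong m e) (mm (<-≤-trans b q≤)))
    after : m p ≡ p → Closed (suc p) q
    after e x a b = ≤∧≢⇒< (proj₁ (cl x (<⇒≤ a) b)) (λ e′ → <-irrefl (mate-inj p<q b (trans e e′)) a) , proj₂ (cl x (<⇒≤ a) b)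
    go : Kind p → ∃ λ is → Reads ty m p is q
    go (kopn t s _) = let (is , r) = parse k (suc p) q p<q q≤ fuel′ (after (m-stem p<size s)) in opening ∷ is , open′ t (m-stem p<size s) r
    go (kcls t s _) = let (is , r) = parse k (suc p) q p<q q≤ fuel′ (after (m-stem p<size s)) in closing ∷ is , close′ t (m-stem p<size s) r
    go (kup _ _ _ lt) = contradiction (proj₁ (cl p ≤-refl p<q)) (<⇒≱ lt)
    go (kdn t s e p<u) = child (node (proj₁ inner)) ∷ proj₁ rest ,
        branch t refl (proj₂ inner) up-u (mm p<size) (proj₂ rest)
      where
      u = m p
      u<q : u < q
      u<q = proj₂ (cl p ≤-refl p<q)
      closed-in : Closed (suc p) u
      closed-in x a b = ≤∧≢⇒< (proj₁ both) (λ e′ → <-irrefl (trans (sym (mm x<size)) (cong m (sym e′))) b) , mx<u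
        where
        x<q = <-trans b u<q
        x<size = <-≤-trans x<q q≤
        both = cl x (<⇒≤ a) x<q
        mx<u : m x < u
        mx<u with <-cmp (m x) u
        ... | tri< lt _ _ = lt
        ... | tri≈ _ e′ _ = contradiction (mate-inj x<q p<q e′) (λ e″ → <-irrefl (sym e″) a)
        ... | tri> _ _ gt = ⊥-elim (no-crossing p<size x<size a b gt)
      closed-out : Closed (suc u) q
      closed-out x a b = u<mx , proj₂ both
        where
        x<size = <-≤-trans b q≤
        both = cl x (<⇒≤ (<-trans p<u a)) b
        u<mx : u < m x
        u<mx with <-cmp (m x) u
        ... | tri> _ _ gt = gt
        ... | tri≈ _ e′ _ = contradiction (mate-inj b p<q e′) (λ e″ → <-irrefl (sym e″) (<-trans p<u a))
        -- A mate before `u` is either `p`, whose own mate is `u`, or lies inside, where `closed-in`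
        -- would keep `x` inside as well.
        ... | tri< lt _ _ with m x ℕP.≟ p
        ...   | yes e′ = contradiction (trans (sym (mm x<size)) (cong m e′)) (λ e″ → <-irrefl (sym e″) a)
        ...   | no ne′ = contradiction (proj₂ (closed-in (m x) (≤∧≢⇒< (proj₁ both) (ne′ ∘ sym)) lt))
                  (<-asym (subst (u <_) (sym (mm x<size)) a))
      inner : ∃ λ js → Reads ty m (suc p) js u
      inner = parse k (suc p) u p<u (≤-trans (<⇒≤ u<q) q≤) (≤-trans (<⇒≤ u<q) fuel′) closed-in
      rest : ∃ λ is → Reads ty m (suc u) is q
      rest = parse k (suc u) q u<q q≤ (≤-trans fuel′ (+-monoˡ-≤ k (s≤s (<⇒≤ p<u)))) closed-out
      up-u : ty u ≡ up
      up-u with kind {u} (<-≤-trans u<q q≤)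
      ... | kup t′ _ _ _ = t′
      ... | kdn _ _ _ lt = contradiction (subst (u <_) (mm p<size) lt) (<-asym p<u)
      ... | kopn _ s′ _ = contradiction (trans (sym (m-stem (m< p) s′)) (mm p<size)) (λ e′ → <-irrefl (sym e′) p<u)
      ... | kcls _ s′ _ = contradiction (trans (sym (m-stem (m< p) s′)) (mm p<size)) (λ e′ → <-irrefl (sym e′) p<u)

  parsed : ∃ λ is → Reads ty m 0 is size
  parsed = parse size 0 size z≤n ≤-refl ≤-refl (λ x _ _ → z≤n , m< x)

  is : List Item
  is = proj₁ parsed

  reads : Reads ty m 0 is (suc n)
  reads = subst (Reads ty m 0 is) size≡ (proj₂ parsed)

  c : Color
  c = col root

  τ-stem : ∀ {y} → st y ≡ true → τ y ≡ σ y
  τ-stem s = cong σ (treeMate-stem s)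

  τ-tree : ∀ {y} → st y ≡ false → τ y ≡ σ (α y)
  τ-tree s = cong σ (treeMate-tree s)

  color≡ : ∀ j → j ≤ size → colorAt ty c j ≡ col (h j)
  color≡ zero lt = refl
  color≡ (suc j) lt with kind lt | color≡ j (<⇒≤ lt)
  ... | kopn t s _ | e = trans (cong (λ l → stepC l (colorAt ty c j)) t) (trans e (sym (trans (cong col (τ-stem s)) (col-σ (h j)))))
  ... | kcls t s _ | e = trans (cong (λ l → stepC l (colorAt ty c j)) t) (trans e (sym (trans (cong col (τ-stem s)) (col-σ (h j)))))
  ... | kdn t s _ _ | e = trans (cong (λ l → stepC l (colorAt ty c j)) t) (trans (cong flipC e) (sym (trans (cong col (τ-tree s)) (trans (col-σ _) (col-α (h j))))))
  ... | kup t s _ _ | e = trans (cong (λ l → stepC l (colorAt ty c j)) t) (trans (cong flipC e) (sym (trans (cong col (τ-tree s)) (trans (col-σ _) (col-α (h j))))))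

  height : ℕ → ℕ
  height j = length (stk (h j))

  steps : ∀ j → j < size → gain (ty j) ℤ.+ ℤ.+ height (suc j) ≡ ℤ.+ height j
  steps j lt with kind lt
  ... | kopn t s cb = trans (cong (λ l → gain l ℤ.+ ℤ.+ height (suc j)) t) (cong (λ l → -[1+ 0 ] ℤ.+ ℤ.+ length l) (proj₁ (push s cb)))
  ... | kcls t s cb = trans (cong (λ l → gain l ℤ.+ ℤ.+ height (suc j)) t) (cong (λ l → ℤ.+ length l) (sym (pop s cb)))
  ... | kdn t s _ _ = trans (cong (λ l → gain l ℤ.+ ℤ.+ height (suc j)) t) (cong (λ l → ℤ.+ length l) (neutral s))
  ... | kup t s _ _ = trans (cong (λ l → gain l ℤ.+ ℤ.+ height (suc j)) t) (cong (λ l → ℤ.+ length l) (neutral s))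

  -- The contour is closed, so the height returns to its initial value and its total fall, the
  -- charge, is 0.
  charge0 : chargeItems is ≡ ℤ.+ 0
  charge0 = ℤP.≤-antisym (ℤ-cancelʳ-≤ z _ _ (ℤP.≤-reflexive e)) (ℤ-cancelʳ-≤ z _ _ (ℤP.≤-reflexive (sym e)))
    where
    z = ℤ.+ height 0
    e : chargeItems is ℤ.+ z ≡ ℤ.+ 0 ℤ.+ z
    e = trans (cong (λ x → chargeItems is ℤ.+ ℤ.+ length (stk x)) (sym h-size))
      (trans (charge-telescopes (λ j → ℤ.+ height j) (proj₂ parsed) steps) (sym (ℤP.+-identityˡ z)))

  local : ∀ x → 0 ≤ x → x < size → Local {ty} {m} c height x
  local x _ lt with kind lt
  ... | kopn t _ cb = (λ _ → trans (color≡ x (<⇒≤ lt)) cb) , (λ t′ → case trans (sym t) t′ of λ ()) , λ t′ → case trans (sym t) t′ of λ ()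
  ... | kcls t _ cb = (λ t′ → case trans (sym t) t′ of λ ()) , (λ _ → trans (color≡ x (<⇒≤ lt)) cb) , λ t′ → case trans (sym t) t′ of λ ()
  ... | kup t _ _ _ = (λ t′ → case trans (sym t) t′ of λ ()) , (λ t′ → case trans (sym t) t′ of λ ()) , λ t′ → case trans (sym t) t′ of λ ()
  ... | kdn t s e x<m = (λ t′ → case trans (sym t) t′ of λ ()) , (λ t′ → case trans (sym t) t′ of λ ()) , λ _ →
          (λ cw → subst (λ z → height x ≤ suc (length (stk z))) (sym e) (bound (trans (sym (color≡ x (<⇒≤ lt))) cw))) ,
          -- Black end first: `bound` at the white end allows a rise by one, and `good` rules out
          -- the tight case. Here the preference becomes the nonnegative charge of white children.
          (λ cb → let cb′ = trans (sym (color≡ x (<⇒≤ lt))) cb in subst (λ z → length (stk z) ≤ height x) (sym e)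
             (≤-pred (≤∧≢⇒< (subst (λ z → length (stk (α (h x))) ≤ suc (length (stk z))) (αα (h x)) (bound (trans (col-α _) (cong flipC cb′))))
               (λ tight → <-asym (good cb′ s tight) (subst₂ _<_ (sym (pos-h lt)) (cong pos (treeMate-tree s)) x<m)))))

  wc : WCItems c is
  wc = local⇒wc c height (proj₂ parsed) steps local

  module Rebuild (is : List Item) (reads : Reads ty m 0 is (suc n)) (charge0 : chargeItems is ≡ ℤ.+ 0) (wc : WCItems c is) where
    module C = ClosureMap c is reads charge0 wc

    S₀ : List (Fin size)
    S₀ = stk root

    -- `S₀` holds the stems already open at the root corner; a closing stem that finds no stem
    -- opened since then takes the next one from `S₀`.
    stack≡ : ∀ j → j ≤ size → stk (h j) ≡ map h (stemStack ty j) ++ drop (unmatched ty j) S₀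
    stack≡ zero lt = refl
    stack≡ (suc j) lt with kind lt | stack≡ j (<⇒≤ lt)
    ... | kopn t s cb | e rewrite t = trans (proj₁ (push s cb)) (cong (h j ∷_) e)
    ... | kdn t s _ _ | e rewrite t = trans (neutral s) e
    ... | kup t s _ _ | e rewrite t = trans (neutral s) e
    ... | kcls t s cb | e rewrite t with stemStack ty j
    ...   | a ∷ l = ∷-injectiveʳ (trans (sym (pop s cb)) e)
    ...   | [] = sym (drop-∷ (unmatched ty j) S₀ (trans (sym e) (pop s cb)))

    -- The stack is empty at the outer corner, so by then every stem of `S₀` has been closed. What
    -- is open at the end of the turn was thus opened during it and, the contour being closed, it is
    -- `S₀` again.
    emptied : drop (unmatched ty size) S₀ ≡ []
    emptied = drop-[]-mono S₀ (unmatched-mono ty (<⇒≤ (pos< outer)))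
      (++-[]ʳ (map h (stemStack ty (pos outer))) (trans (sym (stack≡ (pos outer) (<⇒≤ (pos< outer)))) (trans (cong stk (iter-pos outer)) outer-empty)))
      where
      ++-[]ʳ : ∀ {A : Set} (xs : List A) {ys} → xs ++ ys ≡ [] → ys ≡ []
      ++-[]ʳ [] e = e

    S₀≡ : S₀ ≡ map h C.final
    S₀≡ = trans (cong stk (sym h-size)) (trans (stack≡ size ≤-refl) (trans (cong (map h (stemStack ty size) ++_) emptied)
      (trans (++-identityʳ _) (cong (map h ∘ stemStack ty) size≡))))

    cyc-stack≡ : ∀ j → j ≤ size → stk (h j) ≡ map h (C.cyc-stk j)
    cyc-stack≡ j lt = trans (stack≡ j lt) (trans (cong (map h (stemStack ty j) ++_)
      (trans (cong (drop (unmatched ty j)) S₀≡) (drop-map (unmatched ty j) C.final))) (sym (map-++ h (stemStack ty j) _)))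

    to-size : ∀ {j} → j < suc n → j < size
    to-size = subst (_ <_) (sym size≡)

    stem-color : ∀ {x} → x < suc n → Stem (ty x) → st (h x) ≡ true × (ty x ≡ cls → col (h x) ≡ white)
    stem-color {x} lt s with kind (to-size lt)
    ... | kopn t e _ = e , λ t′ → case trans (sym t) t′ of λ ()
    ... | kcls _ e w = e , λ _ → w
    ... | kdn t _ _ _ = ⊥-elim (tree-or-stem {ty} {m} s (inj₁ t))
    ... | kup t _ _ _ = ⊥-elim (tree-or-stem {ty} {m} s (inj₂ t))

    -- The matching of the closure and the cut edges of the map are both read off the top of the
    -- same stack.
    h-mateS-cls : ∀ {x} → x < suc n → ty x ≡ cls → h (C.mateS x) ≡ α (h x)
    h-mateS-cls {x} lt t = let (s , w) = stem-color lt (inj₂ t) in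
      ∷-injectiveˡ (trans (sym (trans (cyc-stack≡ x (<⇒≤ (to-size lt))) (cong (map h) (C.ClsFacts.mate-stk (C.cls-facts lt t))))) (pop s (w t)))

    h-mateS-opn : ∀ {x} → x < suc n → ty x ≡ opn → h (C.mateS x) ≡ α (h x)
    h-mateS-opn {x} lt t = trans (sym (αα (h (C.mateS x))))
      (cong α (trans (sym (h-mateS-cls mate< mate-ty)) (cong h mate-mate)))
      where open C.OpnFacts (C.opn-facts lt t)

    h-full : ∀ {x} → x < suc n → h (C.full x) ≡ α (h x)
    h-full {x} lt with kind (to-size lt)
    ... | kopn t s _ = trans (cong h (C.full-stem (inj₁ t))) (h-mateS-opn lt t)
    ... | kcls t s _ = trans (cong h (C.full-stem (inj₂ t))) (h-mateS-cls lt t)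
    ... | kdn t _ e _ = trans (cong h (C.full-tree lt (inj₁ t))) e
    ... | kup t _ e _ = trans (cong h (C.full-tree lt (inj₂ t))) e

    iso : CIso C.M M
    iso = π , (π⁻ , (λ x → trans (cong C.lab (pos-h (to-size (toℕ<n x)))) (C.lab-toℕ x)) ,
                λ y → trans (cong h (C.toℕ-lab (subst (pos y <_) size≡ (pos< y)))) (iter-pos y)) ,
      (λ x → trans (cong h (C.toℕ-σ x)) (trans (C.nxt-invariant h (trans (cong h (sym size≡)) h-size) (C.m< (toℕ<n x)))
        (trans (cong τ (h-m (toℕ x))) (τ-treeMate st-α αα (π x))))) ,
      (λ x → trans (cong h (C.toℕ-α x)) (h-full (toℕ<n x))) ,
      refl ,
      -- `outerℕ` picks just one corner of the outer face of the closure; its image has an empty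
      -- stack and so lies on the outer face of `M`.
      empty⇒outer (trans (cyc-stack≡ _ (<⇒≤ (to-size (toℕ<n (CMap.outer C.M))))) (cong (map h) C.outer-stk)) ,
      λ x → trans (sym (color≡ (toℕ x) (<⇒≤ (to-size (toℕ<n x))))) (sym (C.col-cw x))
      where
      π : Fin (suc n) → Fin size
      π x = h (toℕ x)
      π⁻ : Fin size → Fin (suc n)
      π⁻ y = C.lab (pos y)

    rebuilt : Σ CTree (λ T → InT0 T × (closure T ≅ edgeMap M))
    rebuilt = ctree c (node is) , (wc , charge0) , subst (_≅ edgeMap M) (sym (closure-edgeMap c is reads)) iso

from-opening : ∀ {M} (laws : MapLaws M) → (∃ λ O → ∃ λ E → Good M O E) → (let open CMap M) →
  2 * numOrbits size σ + 2 * numOrbits size (λ x → σ (α x)) ≡ size + 4 → ∀ {n} → size ≡ suc n →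
  Σ CTree (λ T → InT0 T × (closure T ≅ edgeMap M))
from-opening laws (O , E , g) euler e = P.Rebuild.rebuilt P.is P.reads P.charge0 P.wc
  where module P = Parse laws O E g euler e

opening-exists : (M : RMap) → IsRBPMap M → Σ CTree (λ T → InT0 T × (closure T ≅ M))
opening-exists (vertexMap c) _ = ctree c (node []) , (tt , refl) , refl
opening-exists (edgeMap M) isM@(_ , _ , _ , connected , euler , _) = go (CMap.size M) refl
  where
  go : ∀ k → CMap.size M ≡ k → Σ CTree (λ T → InT0 T × (closure T ≅ edgeMap M))
  go zero e with () ← subst Fin e (CMap.root M)
  go (suc n) e = from-opening (mapLaws M isM) (Distance.good-opening (mapLaws M isM) connected) euler e

-- The bijection

module Degrees {N : ℕ} {σ : Fin N → Fin N} (σ-inj : Inj σ) {f : ℕ → ℕ} {lab : ℕ → Fin N} {C₀ : ℕ → Color}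
               (toℕ-lab : ∀ {j} → j < N → toℕ (lab j) ≡ j) (lab-toℕ : ∀ x → lab (toℕ x) ≡ x)
               (σ-lab : ∀ {j} → j < N → σ (lab j) ≡ lab (f j)) where

  -- One listed rotation is one orbit. Its first label is the least, so it alone passes
  -- `isOrbitRep`, and the vertex is counted once, with the length of the list as its degree.
  module Vertex {y : ℕ} {ys : List ℕ} (C : Cyc f y (y ∷ ys)) (incr : AllPairs _<_ (y ∷ ys)) (bound : All (_< N) (y ∷ ys)) where

    cyc-next : ∀ {z l x} → Cyc f z l → x ∈ l → f x ≡ z ⊎ f x ∈ l
    cyc-next (last e) (here refl) = inj₁ e
    cyc-next (link e c) (here refl) = inj₂ (there (here e))
    cyc-next (link e c) (there i) = Data.Sum.map₂ there (cyc-next c i)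

    OnVertex : Fin N → Set
    OnVertex x = ∃ λ j → j ∈ y ∷ ys × x ≡ lab j

    onVertex-σ : ∀ x → OnVertex x → OnVertex (σ x)
    onVertex-σ x (j , i , refl) = f j , [ (λ e → here e) , id ]′ (cyc-next C i) , σ-lab (All-lookup bound i)

    y< : ∀ {j} → j ∈ ys → y < j
    y< = All-lookup (head-< incr)
      where
      head-< : ∀ {y ys} → AllPairs _<_ (y ∷ ys) → All (y <_) ys
      head-< (lt ∷ _) = lt

    head-≤ : ∀ {j} → j ∈ y ∷ ys → y ≤ j
    head-≤ (here refl) = ≤-refl
    head-≤ (there i) = <⇒≤ (y< i)

    y<N : y < N
    y<N = All-lookup bound (here refl)

    head-rep : isOrbitRep N σ (lab y) ≡ true
    head-rep = isRep⇐ σ λ k _ → go (orb-closed OnVertex onVertex-σ (y , here refl , refl) (k , refl))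
      where
      go : ∀ {x} → OnVertex x → toℕ (lab y) ≤ toℕ x
      go (j , i , refl) = subst₂ _≤_ (sym (toℕ-lab y<N)) (sym (toℕ-lab (All-lookup bound i))) (head-≤ i)

    suffix-return : ∀ {a l} → Cyc f y (a ∷ l) → All (_< N) (a ∷ l) → iter σ (length (a ∷ l)) (lab a) ≡ lab y
    suffix-return (last e) (b ∷ []) = trans (σ-lab b) (cong lab e)
    suffix-return {a} {b ∷ l} (link e c) (p ∷ ps) = trans (sym (iter-suc σ (length (b ∷ l)) (lab a)))
      (trans (cong (iter σ (length (b ∷ l))) (trans (σ-lab p) (cong lab e))) (suffix-return c ps))

    suffix-iter : ∀ {a l} → Cyc f y (a ∷ l) → All (_< N) (a ∷ l) → ∀ i → i < length l → ∃ λ j → j ∈ l × iter σ (suc i) (lab a) ≡ lab j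
    suffix-iter {a} {b ∷ l} (link e c) (p ∷ ps) zero lt = b , here refl , trans (σ-lab p) (cong lab e)
    suffix-iter {a} {b ∷ l} (link e c) (p ∷ ps) (suc i) (s≤s lt) =
      let (j , i∈ , q) = suffix-iter c ps i lt
      in j , there i∈ , trans (sym (iter-suc σ (suc i) (lab a))) (trans (cong (iter σ (suc i)) (trans (σ-lab p) (cong lab e))) q)

    suffix-orb : ∀ {l x} → Cyc f y l → All (_< N) l → x ∈ l → Orb σ (lab x) (lab y)
    suffix-orb {a ∷ l} c bs (here refl) = length (a ∷ l) , suffix-return c bs
    suffix-orb (link e c) (_ ∷ bs) (there i) = suffix-orb c bs i

    tail-not-rep : ∀ {x} → x ∈ ys → isOrbitRep N σ (lab x) ≡ false
    tail-not-rep {x} i = Bool-false λ e → <⇒≱ (y< i) (subst₂ _≤_ (toℕ-lab (All-lookup bound (there i))) (toℕ-lab y<N)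
      (isRep-≤ σ-inj e (suffix-orb C bound (there i))))

    not-earlier : ∀ {k} → 1 ≤ k → k < length (y ∷ ys) → iter σ k (lab y) ≢ lab y
    not-earlier {suc k} _ (s≤s lt) e = let (j , i , q) = suffix-iter C bound k lt in
      <-irrefl (trans (sym (toℕ-lab y<N)) (trans (cong toℕ (trans (sym e) q)) (toℕ-lab (All-lookup bound (there i))))) (y< i)

    head-size : orbitSize N σ (lab y) ≡ length (y ∷ ys)
    head-size = orbitSize-least N σ (lab y) (length (y ∷ ys)) (s≤s z≤n) length≤ (suffix-return C bound) not-earlier
      where
      -- `orbitSize` searches up to `N` only; a longer list would contradict the period of `σ`,
      -- which is at most `N`.
      length≤ : length (y ∷ ys) ≤ N
      length≤ = let (k , lt , e) = period σ-inj (lab y) in ≮⇒≥ λ N< → not-earlier (s≤s z≤n) (≤-<-trans lt N<) e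

    module _ (k : ℕ) where
      counted : ℕ → Bool
      counted j = isOrbitRep N σ (lab j) ∧ (orbitSize N σ (lab j) ≡ᵇ k)

      count-tail : ∀ zs → (∀ {x} → x ∈ zs → x ∈ ys) → countB counted zs ≡ 0
      count-tail [] h = refl
      count-tail (z ∷ zs) h rewrite tail-not-rep (h (here refl)) = count-tail zs (h ∘ there)

      count-vertex : countB counted (y ∷ ys) ≡ (if length (y ∷ ys) ≡ᵇ k then 1 else 0)
      count-vertex = trans count-head (trans
        (cong₂ (λ b z → (if b then 1 else 0) + z) (cong₂ _∧_ head-rep (cong (_≡ᵇ k) head-size)) (count-tail ys id))
        (+-identityʳ _))
        where
        count-head : countB counted (y ∷ ys) ≡ (if counted y then 1 else 0) + countB counted ys
        count-head with counted y
        ... | true = refl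
        ... | false = refl

  module _ (k : ℕ) where
    private
      g : Fin N → Bool
      g x = isOrbitRep N σ x ∧ (orbitSize N σ x ≡ᵇ k)

      countB-++ : ∀ {A : Set} (p : A → Bool) xs ys → countB p (xs ++ ys) ≡ countB p xs + countB p ys
      countB-++ p [] ys = refl
      countB-++ p (x ∷ xs) ys with p x
      ... | true = cong suc (countB-++ p xs ys)
      ... | false = countB-++ p xs ys

      countB-map : ∀ {A B : Set} (p : B → Bool) (q : A → B) xs → countB p (map q xs) ≡ countB (p ∘ q) xs
      countB-map p q [] = refl
      countB-map p q (x ∷ xs) with p (q x)
      ... | true = cong suc (countB-map p q xs)
      ... | false = countB-map p q xs

      countB-cong : ∀ {A : Set} {p q : A → Bool} → (∀ x → p x ≡ q x) → ∀ xs → countB p xs ≡ countB q xs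
      countB-cong h [] = refl
      countB-cong {p = p} {q} h (x ∷ xs) with p x | q x | h x
      ... | true | _ | refl = cong suc (countB-cong h xs)
      ... | false | _ | refl = countB-cong h xs

      per-vertex : ∀ rs → All (Rot f C₀) rs → (∀ {x} → x ∈ rotLabels rs → x < N) → countB (g ∘ lab) (rotLabels rs) ≡ vertexCount k rs
      per-vertex [] [] h = refl
      per-vertex ((r , c) ∷ rs) (R ∷ Rs) h = trans (countB-++ (g ∘ lab) r (rotLabels rs))
        (cong₂ _+_ (one r (Rot.shape R) (Rot.cyc R) (Rot.incr R) (All-tabulate (h ∘ ∈-++⁺ˡ))) (per-vertex rs Rs (h ∘ ∈-++⁺ʳ r)))
        where
        one : ∀ r {y ys} → r ≡ y ∷ ys → Cyc f y r → AllPairs _<_ r → All (_< N) r →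
          countB (g ∘ lab) r ≡ (if length r ≡ᵇ k then 1 else 0)
        one _ refl C I B = Vertex.count-vertex C I B k

    count-orbits : ∀ rs → All (Rot f C₀) rs → rotLabels rs ↭ upTo N → countB g (allFin N) ≡ vertexCount k rs
    count-orbits rs Rs labels-↭ = begin
      countB g (allFin N) ≡⟨ countB-cong (λ x → cong g (sym (lab-toℕ x))) (allFin N) ⟩
      countB (g ∘ lab ∘ toℕ) (allFin N) ≡⟨ sym (countB-map (g ∘ lab) toℕ (allFin N)) ⟩
      countB (g ∘ lab) (map toℕ (allFin N)) ≡⟨ ↭-length (filter-↭ (T? ∘ g ∘ lab) labels) ⟩
      countB (g ∘ lab) (rotLabels rs) ≡⟨ per-vertex rs Rs (λ i → ∈-upTo⁻ (∈-resp-↭ labels-↭ i)) ⟩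
      vertexCount k rs ∎
      where
      open ≡-Reasoning
      labels : map toℕ (allFin N) ↭ rotLabels rs
      labels = ↭-trans (unique-↭ (UniqueP.map⁺ toℕ-injective (UniqueP.allFin⁺ N)) (UniqueP.upTo⁺ N)
        (λ i → let (x , _ , e) = ∈-map⁻ toℕ i in subst (_∈ upTo N) (sym e) (∈-upTo⁺ (toℕ<n x)))
        (λ i → subst (_∈ map toℕ (allFin N)) (toℕ-fromℕ< (∈-upTo⁻ i)) (∈-map⁺ toℕ (∈-allFin (fromℕ< (∈-upTo⁻ i))))))
        (↭-sym labels-↭)

module ClosureProps (c : Color) (is : List Item) {ty : ℕ → Letter} {m : ℕ → ℕ} {n : ℕ} (r : Reads ty m 0 is (suc n))
                    (charge0 : chargeItems is ≡ ℤ.+ 0) (wc : WCItems c is) where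
  open ClosureMap c is r charge0 wc
  open CMap M using (σ; α; root; col)

  -- Recovers the contour word from the cut, the colours and the order in which the two ends of each
  -- edge are met. An isomorphism that respects cuts and labels therefore preserves the word.
  ty-letterOf : ∀ x → ty (toℕ x) ≡ letterOf (st x) (col x) (does (toℕ x <? toℕ (α x)))
  ty-letterOf x = go (ty (toℕ x)) refl
    where
    lt = toℕ<n x
    α-tree : TreeL (ty (toℕ x)) → toℕ (α x) ≡ m (toℕ x)
    α-tree t = trans (toℕ-α x) (full-tree lt t)
    go : ∀ l → ty (toℕ x) ≡ l → ty (toℕ x) ≡ letterOf (st x) (col x) (does (toℕ x <? toℕ (α x)))
    go opn t = trans t (sym (cong₂ (λ a b → letterOf a b (does (toℕ x <? toℕ (α x)))) (cong isStem t) (trans (col-cw x) (opn-black lt t))))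
    go cls t = trans t (sym (cong₂ (λ a b → letterOf a b (does (toℕ x <? toℕ (α x)))) (cong isStem t) (trans (col-cw x) (cls-white lt t))))
    go dn t with mates (toℕ x) lt
    ... | stem s _ = ⊥-elim (tree-or-stem {ty} {m} s (inj₁ t))
    ... | upward _ t′ _ _ _ = case trans (sym t) t′ of λ ()
    ... | down _ _ r′ _ _ _ = trans t (sym (cong₂ (λ a b → letterOf a (col x) b) (cong isStem t)
            (dec-true (toℕ x <? toℕ (α x)) (subst (toℕ x <_) (sym (α-tree (inj₁ t))) (reads-≤ r′)))))
    go up t with mates (toℕ x) lt
    ... | stem s _ = ⊥-elim (tree-or-stem {ty} {m} s (inj₂ t))
    ... | down _ t′ _ _ _ _ = case trans (sym t) t′ of λ ()
    ... | upward _ _ r′ _ _ = trans t (sym (cong₂ (λ a b → letterOf a (col x) b) (cong isStem t)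
            (dec-false (toℕ x <? toℕ (α x)) (λ lt′ → <-asym (reads-≤ r′) (subst (toℕ x <_) (α-tree (inj₂ t)) lt′)))))

  f< : ∀ {x} → x < N → f x < N
  f< lt = nxt< (m< lt)

  σ-lab : ∀ {j} → j < N → σ (lab j) ≡ lab (f j)
  σ-lab {j} lt = toℕ-injective (trans (toℕ-σ (lab j)) (trans (cong f (toℕ-lab lt)) (sym (toℕ-lab (f< lt)))))

  degrees : ∀ k → mapDegCount (edgeMap M) k ≡ treeDegCount (ctree c (node is)) k
  degrees k = trans (Degrees.count-orbits σ-inj toℕ-lab lab-toℕ σ-lab k rots rots-ok labels-↭)
    (cong₂ (λ l z → (if l ≡ᵇ k then 1 else 0) + z) (length-labs c is 0) (sym (degCount-walk k c is 0)))

nonempty-reads : ∀ is → is ≢ [] → ∃ λ n → length (word is) ≡ suc n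
nonempty-reads [] ne = contradiction refl ne
nonempty-reads (opening ∷ is) ne = _ , refl
nonempty-reads (closing ∷ is) ne = _ , refl
nonempty-reads (child (node js) ∷ is) ne = _ , refl

-- Trees with at least one item, with the reading of their own word. `end` provides the final `up`
-- that `reads-unique` asks for at the outermost list.
record Edged (T : CTree) : Set where
  field
    c : Color
    is : List Item
    len : ℕ
    T≡ : T ≡ ctree c (node is)
    reads : Reads (at (word is)) (mate is 0) 0 is (suc len)
    end   : at (word is) (suc len) ≡ up
    charge0 : chargeItems is ≡ ℤ.+ 0
    wc : WCItems c is

  open ClosureMap c is reads charge0 wc public using (M; laws; layout; isMap; root-col; st; toℕ-α; toℕ-iter)
  open ClosureProps c is reads charge0 wc public using (ty-letterOf; degrees)

  closure≡ : closure T ≡ edgeMap M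
  closure≡ = trans (cong closure T≡) (closure-edgeMap c is reads)

tree-cases : ∀ T → InT0 T → (∃ λ c → T ≡ ctree c (node [])) ⊎ Edged T
tree-cases (ctree c (node [])) _ = inj₁ (c , refl)
tree-cases (ctree c (node is@(i ∷ _))) (wc , ch) with nonempty-reads is (λ ())
... | n , e = inj₂ record
  { c = c ; is = is ; len = n ; T≡ = refl
  ; reads = subst (Reads (at (word is)) (mate is 0) 0 is) e (items-read is)
  ; end = trans (cong (at (word is)) (sym e)) (at-end (word is))
  ; charge0 = ch ; wc = wc }

closure-isMap : ∀ T → InT0 T → IsRBPMap (closure T)
closure-isMap T t with tree-cases T t
... | inj₁ (c , refl) = tt
... | inj₂ E = subst IsRBPMap (sym (Edged.closure≡ E)) (Edged.isMap E)

closure-stats : ∀ T → InT0 T → (∀ k → mapDegCount (closure T) k ≡ treeDegCount T k) × mapRootColor (closure T) ≡ rootColor T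
closure-stats T t with tree-cases T t
... | inj₁ (c , refl) = (λ k → sym (+-identityʳ _)) , refl
... | inj₂ E = (λ k → trans (cong (λ M → mapDegCount M k) closure≡) (trans (degrees k) (cong (λ T → treeDegCount T k) (sym T≡)))) ,
               trans (cong mapRootColor closure≡) (trans root-col (cong rootColor (sym T≡)))
  where open Edged E

-- With the second layout pulled back, both live on one map and cut the same edges. Hence the
-- contours coincide, `π` preserves labels, and the two trees have the same word.
module SameClosure {T T′ : CTree} (E : Edged T) (E′ : Edged T′) (iso : CIso (Edged.M E) (Edged.M E′)) where
  private
    module E = Edged E
    module E′ = Edged E′
    module M = CMap E.M
    module M′ = CMap E′.M
    π = proj₁ iso
    π-α = proj₁ (proj₂ (proj₂ (proj₂ iso)))
    π-root = proj₁ (proj₂ (proj₂ (proj₂ (proj₂ iso))))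
    π-col = proj₂ (proj₂ (proj₂ (proj₂ (proj₂ (proj₂ iso)))))
    pulled : Layout E.M
    pulled = pull-layout {E.M} {E′.M} iso E′.laws E′.layout
    module O = Layout E.layout
    module O′ = Layout pulled

  same-st : ∀ x → O.st x ≡ O′.st x
  same-st = LayoutUnique.layout-unique E.laws E.layout pulled

  same-pos : ∀ x → Enum.pos O′.enum x ≡ Enum.pos O.enum x
  same-pos x = trans (cong (Enum.pos O′.enum) (trans (sym (Enum.iter-pos O.enum x))
      (iter-cong (λ y → cong (λ b → M.σ (if b then y else M.α y)) (same-st y)) (Enum.pos O.enum x) M.root)))
    (Enum.pos-iter O′.enum (Enum.pos< O.enum x))

  toℕ-π : ∀ x → toℕ (π x) ≡ toℕ x
  -- In a closure the contour position of a half-edge is its number, so `same-pos` already speaks of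
  -- `toℕ`.
  toℕ-π = same-pos

  same-letter : ∀ x → at (word E.is) (toℕ x) ≡ at (word E′.is) (toℕ x)
  same-letter x = begin
    at (word E.is) (toℕ x) ≡⟨ E.ty-letterOf x ⟩
    letterOf (E.st x) (M.col x) (does (toℕ x <? toℕ (M.α x))) ≡⟨ cong₂ (λ a b → letterOf a b (does (toℕ x <? toℕ (M.α x)))) (same-st x) (sym (π-col x)) ⟩
    letterOf (E′.st (π x)) (M′.col (π x)) (does (toℕ x <? toℕ (M.α x))) ≡⟨ cong₂ (λ a b → letterOf (E′.st (π x)) (M′.col (π x)) (does (a <? b)))
                                                                                             (sym (toℕ-π x)) (trans (sym (toℕ-π (M.α x))) (cong toℕ (π-α x))) ⟩
    letterOf (E′.st (π x)) (M′.col (π x)) (does (toℕ (π x) <? toℕ (M′.α (π x)))) ≡⟨ sym (E′.ty-letterOf (π x)) ⟩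
    at (word E′.is) (toℕ (π x)) ≡⟨ cong (at (word E′.is)) (toℕ-π x) ⟩
    at (word E′.is) (toℕ x) ∎
    where open ≡-Reasoning

  same-n : suc E.len ≡ suc E′.len
  same-n = iso-size {E.M} {E′.M} iso

  same-items : E.is ≡ E′.is
  same-items = proj₁ (reads-unique E.reads E.end
    (reads-cong (λ x lt → sym (letters x (subst (x <_) (sym same-n) lt))) E′.reads)
    (trans (cong (at (word E.is)) (sym same-n)) E.end))
    where
    letters : ∀ x → x < suc E.len → at (word E.is) x ≡ at (word E′.is) x
    letters x lt = subst (λ k → at (word E.is) k ≡ at (word E′.is) k) (toℕ-fromℕ< lt) (same-letter (fromℕ< lt))

  same-color : E.c ≡ E′.c
  same-color = trans (sym E.root-col) (trans (sym (π-col M.root)) (trans (cong M′.col π-root) E′.root-col))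

  same-tree : T ≡ T′
  same-tree = trans E.T≡ (trans (cong₂ (λ c is → ctree c (node is)) same-color same-items) (sym E′.T≡))

closure-injective : ∀ T T′ → InT0 T → InT0 T′ → closure T ≅ closure T′ → T ≡ T′
closure-injective T T′ t t′ i with tree-cases T t | tree-cases T′ t′
... | inj₁ (c , refl) | inj₁ (d , refl) = cong (λ c → ctree c (node [])) i
... | inj₁ (c , refl) | inj₂ E′ = ⊥-elim (subst (vertexMap c ≅_) (Edged.closure≡ E′) i)
... | inj₂ E | inj₁ (d , refl) = ⊥-elim (subst (_≅ vertexMap d) (Edged.closure≡ E) i)
... | inj₂ E | inj₂ E′ = SameClosure.same-tree E E′ (subst₂ _≅_ (Edged.closure≡ E) (Edged.closure≡ E′) i)

theorem2p5 : ((T : CTree) → InT0 T → IsRBPMap (closure T)) ×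
    ((T T′ : CTree) → InT0 T → InT0 T′ → closure T ≅ closure T′ → T ≡ T′) ×
    ((M : RMap) → IsRBPMap M → Σ CTree (λ T → InT0 T × (closure T ≅ M))) ×
    ((T : CTree) → InT0 T →
    ((k : ℕ) → mapDegCount (closure T) k ≡ treeDegCount T k) ×
    (mapRootColor (closure T) ≡ rootColor T))
theorem2p5 = closure-isMap , closure-injective , opening-exists , closure-stats
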